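{- Let $\Bbbk$ be a perfect field and let $K$ be an $n$-dimensional topological local field over $\Bbbk$. The data $\bigl(\mathrm{E}(K), \{\mathrm{E}(K)_{i,j}\}_{i \in \{1,\ldots,n\},\, j \in \{1,2\}}\bigr)$ of local Beilinson-Tate operators is an $n$-dimensional cubically decomposed ring of operators on $K$.
   Context: **Cubically decomposed rings.** For a commutative $\Bbbk$-ring $A$, an $n$-dimensional cubically decomposed ring of operators on $A$ is data $(E,\{E_{i,j}\})$ consisting of a $\Bbbk$-subring $E\subset\operatorname{End}_{\Bbbk}(A)$ containing $A$ (acting by multiplication), and two-sided ideals $E_{i,j}\subset E$ for $i\in\{1,\ldots,n\}$, $j\in\{1,2\}$, such that: (i) $E=E_{i,1}+E_{i,2}$ for every $i$; (ii) every $\phi\in\bigcap_{i=1}^n\bigcap_{j=1}^2E_{i,j}$ is finite potent, i.e. for some positive integer $q$ the operator $\phi^q$ has finite rank over $\Bbbk$. **Semi-topological (ST) rings and modules.** $\Bbbk$ is a perfect field with the discrete topology. A $\Bbbk$-linear topology on a $\Bbbk$-module is a module topology in which $0$ has a basis of open neighborhoods consisting of $\Bbbk$-submodules. A commutative ST $\Bbbk$-ring is a commutative $\Bbbk$-ring $A$ with a $\Bbbk$-linear topology such that for every $a \in A$ the map $A \to A$, $b \mapsto ab$, is continuous; homomorphisms of ST $\Bbbk$-rings are the continuous $\Bbbk$-ring homomorphisms. A ST $A$-module is an $A$-module $M$ with a $\Bbbk$-linear topology such that for every $a \in A$ and $m \in M$ the maps $M \to M$, $m' \mapsto a m'$, and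 $A \to M$, $a' \mapsto a' m$, are continuous. The fine $A$-module topology on an $A$-module is the finest $\Bbbk$-linear topology making it a ST $A$-module (it exists). **Laurent series.** For a commutative ST $\Bbbk$-ring $A$: give $A[t]/(t^{i+1})$ the fine $A$-module topology, $A[[t]] = \lim_{\leftarrow i} A[t]/(t^{i+1})$ the inverse limit topology, and $A((t)) = A[[t]][t^{ -1}]$ the fine $A[[t]]$-module topology. Recursively $A((t_1,\ldots,t_n)) := A((t_2,\ldots,t_n))((t_1))$. **Local fields.** An $n$-dimensional local field is a field $K$ with complete discrete valuation rings $\mathcal{O}_1(K),\ldots,\mathcal{O}_n(K)$ such that $K$ is the fraction field of $\mathcal{O}_1(K)$ and for $1\le i\le n-1$ the residue field of $\mathcal{O}_i(K)$ is the fraction field of $\mathcal{O}_{i+1}(K)$. Let $\boldsymbol{k}_i(K)$ be the residue field of $\mathcal{O}_i(K)$, and $\boldsymbol{k}_0(K):=K$. The ring of integers $\mathcal{O}(K) := \mathcal{O}_1(K)\times_{\boldsymbol{k}_1(K)}\mathcal{O}_2(K)\cdots\times_{\boldsymbol{k}_{n-1}(K)}\mathcal{O}_n(K)$ is a subring of $K$ ($\mathcal{O}(K)=K$ if $n=0$). For a finite field extension $\Bbbk'$ of $\Bbbk$ (discrete topology), the standard $n$-dimensional topological local field is $\Bbbk'((t_1,\ldots,t_n))$ with the iterated Laurent series topology (obtained from the discrete topology on $\Bbbk'$ by the recursion $\Bbbk'((t_1,\ldots,t_n)) = \Bbbk'((t_2,\ldots,t_n))((t_1))$, where $A((t))$ has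 the fine $A[[t]]$-module topology) and with $\mathcal{O}_i = \Bbbk'((t_{i+1},\ldots,t_n))[[t_i]]$. An $n$-dimensional topological local field (TLF) over $\Bbbk$ is an $n$-dimensional local field $K$ with a ring homomorphism $\Bbbk\to\mathcal{O}(K)$ such that $\Bbbk\to\boldsymbol{k}_n(K)$ is finite, and a topology making $K$ a ST $\Bbbk$-ring, for which there exists a $\Bbbk$-ring isomorphism $\Bbbk'((t_1,\ldots,t_n)) \to K$, $\Bbbk' := \boldsymbol{k}_n(K)$, that is a homeomorphism and respects the valuation rings (it maps $\mathcal{O}_1$ onto $\mathcal{O}_1$, the induced map on residue fields maps $\mathcal{O}_2$ onto $\mathcal{O}_2$, etc.). Each $\mathcal{O}_i(K)\subset\boldsymbol{k}_{i-1}(K)$ has the subspace topology and each $\boldsymbol{k}_i(K)$ has the quotient topology from $\mathcal{O}_i(K)$; then $\boldsymbol{k}_i(K)$ is an $(n-i)$-dimensional TLF. **Systems of liftings.** A system of liftings for $K$ is a sequence $\boldsymbol{\sigma}=(\sigma_1,\ldots,\sigma_n)$, where each $\sigma_i:\boldsymbol{k}_i(K)\to\mathcal{O}_i(K)$ is a continuous $\Bbbk$-ring homomorphism splitting the canonical surjection $\mathcal{O}_i(K)\to\boldsymbol{k}_i(K)$ (the empty sequence if $n=0$). If $n \geq 1$, $\mathrm{d}_1(\boldsymbol{\sigma}) := (\sigma_2,\ldots,\sigma_n)$, a system of liftings for $\boldsymbol{k}_1(K)$. **Lattices.** "Finite module" means finitely generated. For $n \ge 1$ and a finite $K$-module $M$,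 an $\mathcal{O}_1(K)$-lattice in $M$ is a finite $\mathcal{O}_1(K)$-submodule $L$ with $M = K\cdot L$; $\operatorname{Lat}(M)$ is the set of lattices, and $\operatorname{Lat}(M_1,M_2):=\operatorname{Lat}(M_1)\times\operatorname{Lat}(M_2)$. For lattices $L\subset L'$, $L'/L$ has finite length over $\mathcal{O}_1(K)$, and $\operatorname{rest}_{\sigma_1}(L'/L)$ denotes it as a finite $\boldsymbol{k}_1(K)$-module via $\sigma_1$. For a $\Bbbk$-linear $\phi:M_1\to M_2$ and $(L_1,L_2),(L'_1,L'_2)\in\operatorname{Lat}(M_1,M_2)$, $(L'_1,L'_2)$ is a $\phi$-refinement of $(L_1,L_2)$, written $(L'_1,L'_2)\prec_\phi(L_1,L_2)$, if $L'_1\subset L_1$, $L_2\subset L'_2$, $\phi(L'_1)\subset L_2$ and $\phi(L_1)\subset L'_2$; then there is an induced $\bar\phi:L_1/L'_1\to L'_2/L_2$. **BT operators.** For finite $K$-modules $M_1,M_2$ define $\mathrm{E}^K_{\boldsymbol{\sigma}}(M_1,M_2)\subset\operatorname{Hom}_{\Bbbk}(M_1,M_2)$ recursively. If $n=0$ it is all of $\operatorname{Hom}_{\Bbbk}(M_1,M_2)$. If $n\ge1$, $\phi$ belongs to it iff: (i) every $(L_1,L_2)\in\operatorname{Lat}(M_1,M_2)$ has some $\phi$-refinement; and (ii) for every $\phi$-refinement $(L'_1,L'_2)\prec_\phi(L_1,L_2)$ the induced $\bar\phi$ belongs to $\mathrm{E}^{\boldsymbol{k}_1(K)}_{\mathrm{d}_1(\boldsymbol{\sigma})}(\operatorname{rest}_{\sigma_1}(L_1/L'_1),\operatorname{rest}_{\sigma_1}(L'_2/L_2))$.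 For $n\ge1$, $i\in\{1,\ldots,n\}$, $j\in\{1,2\}$, the subset $\mathrm{E}^K_{\boldsymbol{\sigma}}(M_1,M_2)_{i,j}$ consists of those $\phi\in\mathrm{E}^K_{\boldsymbol{\sigma}}(M_1,M_2)$ such that: for $(i,j)=(1,1)$, $\phi(M_1)\subset L_2$ for some $L_2\in\operatorname{Lat}(M_2)$; for $(i,j)=(1,2)$, $\phi(L_1)=0$ for some $L_1\in\operatorname{Lat}(M_1)$; for $i\ge2$, for every $\phi$-refinement $(L'_1,L'_2)\prec_\phi(L_1,L_2)$ the induced $\bar\phi$ belongs to $\mathrm{E}^{\boldsymbol{k}_1(K)}_{\mathrm{d}_1(\boldsymbol{\sigma})}(\operatorname{rest}_{\sigma_1}(L_1/L'_1),\operatorname{rest}_{\sigma_1}(L'_2/L_2))_{i-1,j}$. **The ring of local Beilinson-Tate operators.** $\mathrm{E}(K):=\mathrm{E}^K_{\boldsymbol{\sigma}}(K,K)$ and $\mathrm{E}(K)_{i,j}:=\mathrm{E}^K_{\boldsymbol{\sigma}}(K,K)_{i,j}$, where $\boldsymbol{\sigma}$ is any system of liftings for $K$ (such systems exist, and these sets do not depend on the choice of $\boldsymbol{\sigma}$). -}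

module Defs where

open import Algebra.Bundles using (Ring; RawRing; CommutativeRing)
open import Algebra.Core using (Op₁; Op₂)
import Algebra.Definitions.RawMonoid as MonoidOps
import Algebra.Definitions.RawSemiring as SemiringOps
import Algebra.Module.Construct.TensorUnit as TensorUnit
open import Algebra.Module.Bundles using (LeftModule; RawLeftModule)
open import Algebra.Module.Morphism.Structures using (module LeftModuleMorphisms)
open import Algebra.Morphism.Structures using (module RingMorphisms)
import Algebra.Properties.Group as GroupProperties
import Algebra.Properties.Ring as RingProperties
import Algebra.Solver.Ring.NaturalCoefficients.Default as Solver
open import Data.Fin.Base using (Fin; zero; suc; toℕ)
open import Data.List.Base using (List; []; _∷_; _++_)
open import Data.Nat.Base as ℕ using (ℕ; zero; suc; _∸_)
open import Data.Nat.Primality using (Prime)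
open import Data.Product.Base using (Σ; ∃; ∃₂; _×_; _,_; proj₁; proj₂)
open import Data.Sum.Base using (_⊎_)
open import Data.Unit.Base using (⊤)
open import Function.Base using (_∘_; id)
open import Level using (Level; Lift; lift; _⊔_) renaming (suc to lsuc)
open import Relation.Binary.Core using (Rel)
import Relation.Binary.Reasoning.Setoid as SetoidReasoning
open import Relation.Binary.Structures using (IsEquivalence)
open import Relation.Nullary.Negation.Core using (¬_)
open import Relation.Unary using (Pred; _∈_; _⊆_)

private
  variable
    ℓ p : Level
    n   : ℕ

-- Modules over a commutative ring are rendered as the library's left modules.

CRing : ∀ ℓ → Set (lsuc ℓ)
CRing ℓ = CommutativeRing ℓ ℓ

LMod : Ring ℓ ℓ → Set (lsuc ℓ)
LMod {ℓ} R = LeftModule R ℓ ℓ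

Mod : CRing ℓ → Set (lsuc ℓ)
Mod R = LMod (CommutativeRing.ring R)

∣_∣ : CRing ℓ → Set ℓ
∣_∣ = CommutativeRing.Carrier

RawMod : Set ℓ → Set (lsuc ℓ)
RawMod {ℓ} S = RawLeftModule S ℓ ℓ

raw : {R : Ring ℓ ℓ} → LMod R → RawMod (Ring.Carrier R)
raw = LeftModule.rawLeftModule

unit : (R : CRing ℓ) → Mod R
unit R = TensorUnit.leftModule {R = CommutativeRing.ring R}

module _ {A : Set ℓ} {_≈_ : Rel A ℓ} {_+_ _*_ : Op₂ A} { -_ : Op₁ A} {0# 1# : A}
         (isEquivalence : IsEquivalence _≈_)
         (+-cong : ∀ {x y u v} → x ≈ y → u ≈ v → (x + u) ≈ (y + v))
         (*-cong : ∀ {x y u v} → x ≈ y → u ≈ v → (x * u) ≈ (y * v))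
         (-‿cong : ∀ {x y} → x ≈ y → (- x) ≈ (- y))
         (+-assoc : ∀ x y z → ((x + y) + z) ≈ (x + (y + z)))
         (+-comm : ∀ x y → (x + y) ≈ (y + x))
         (+-identityˡ : ∀ x → (0# + x) ≈ x)
         (-‿inverseˡ : ∀ x → ((- x) + x) ≈ 0#)
         (*-assoc : ∀ x y z → ((x * y) * z) ≈ (x * (y * z)))
         (*-comm : ∀ x y → (x * y) ≈ (y * x))
         (*-identityˡ : ∀ x → (1# * x) ≈ x)
         (distribʳ : ∀ x y z → ((y + z) * x) ≈ ((y * x) + (z * x)))
         where

  open IsEquivalence isEquivalence

  mkCRing : CRing ℓ
  mkCRing .CommutativeRing.Carrier = A
  mkCRing .CommutativeRing._≈_ = _≈_
  mkCRing .CommutativeRing._+_ = _+_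
  mkCRing .CommutativeRing._*_ = _*_
  mkCRing .CommutativeRing.-_ = -_
  mkCRing .CommutativeRing.0# = 0#
  mkCRing .CommutativeRing.1# = 1#
  mkCRing .CommutativeRing.isCommutativeRing = record
      { isRing = record
        { +-isAbelianGroup = record
          { isGroup = record
            { isMonoid = record
              { isSemigroup = record
                { isMagma = record { isEquivalence = isEquivalence ; ∙-cong = +-cong }
                ; assoc   = +-assoc }
              ; identity = +-identityˡ , λ x → trans (+-comm x 0#) (+-identityˡ x) }
            ; inverse = -‿inverseˡ , λ x → trans (+-comm x (- x)) (-‿inverseˡ x)
            ; ⁻¹-cong = -‿cong }
          ; comm = +-comm }
        ; *-cong     = *-cong
        ; *-assoc    = *-assoc
        ; *-identity = *-identityˡ , λ x → trans (*-comm x 1#) (*-identityˡ x)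
        ; distrib    = (λ x y z → trans (*-comm x (y + z))
                          (trans (distribʳ x y z) (+-cong (*-comm y x) (*-comm z x))))
                     , distribʳ }
      ; *-comm = *-comm }

record RingHom (R S : CRing ℓ) : Set ℓ where
  private
    module R = CommutativeRing R
    module S = CommutativeRing S
  open RingMorphisms R.rawRing S.rawRing public using (IsRingHomomorphism)
  field
    ⟦_⟧               : ∣ R ∣ → ∣ S ∣
    isRingHomomorphism : IsRingHomomorphism ⟦_⟧
  open RingMorphisms.IsRingHomomorphism isRingHomomorphism public

open RingHom using (⟦_⟧)

mkRingHom : {R S : CRing ℓ} → let module R = CommutativeRing R; module S = CommutativeRing S in
            (f : ∣ R ∣ → ∣ S ∣) →
            (∀ {x y} → x R.≈ y → f x S.≈ f y) →
            (∀ x y → f (x R.+ y) S.≈ f x S.+ f y) →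
            (∀ x y → f (x R.* y) S.≈ f x S.* f y) →
            f R.1# S.≈ S.1# → RingHom R S
mkRingHom {R = R} {S} f cong +-homo *-homo 1-homo = record
  { ⟦_⟧ = f
  ; isRingHomomorphism = record
    { isSemiringHomomorphism = record
      { isNearSemiringHomomorphism = record
        { +-isMonoidHomomorphism = record
          { isMagmaHomomorphism = record
            { isRelHomomorphism = record { cong = cong } ; homo = +-homo }
          ; ε-homo = 0-homo }
        ; *-homo = *-homo }
      ; 1#-homo = 1-homo }
    ; -‿homo = λ x → inverseˡ-unique (f (R.- x)) (f x)
        (S.trans (S.sym (+-homo (R.- x) x)) (S.trans (cong (R.-‿inverseˡ x)) 0-homo)) } }
  where
  module R = CommutativeRing R
  module S = CommutativeRing S
  open GroupProperties S.+-group using (inverseˡ-unique; identityˡ-unique)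
  0-homo : f R.0# S.≈ S.0#
  0-homo = identityˡ-unique (f R.0#) (f R.0#)
    (S.trans (S.sym (+-homo R.0# R.0#)) (cong (R.+-identityˡ R.0#)))

_∘ʳ_ : {R S T : CRing ℓ} → RingHom S T → RingHom R S → RingHom R T
_∘ʳ_ {T = T} g f = mkRingHom (⟦ g ⟧ ∘ ⟦ f ⟧)
  (g.⟦⟧-cong ∘ f.⟦⟧-cong)
  (λ x y → trans (g.⟦⟧-cong (f.+-homo x y)) (g.+-homo _ _))
  (λ x y → trans (g.⟦⟧-cong (f.*-homo x y)) (g.*-homo _ _))
  (trans (g.⟦⟧-cong f.1#-homo) g.1#-homo)
  where
  module g = RingHom g
  module f = RingHom f
  open CommutativeRing T using (trans)

restrict : {R S : CRing ℓ} → RingHom R S → Mod S → Mod R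
restrict f M .LeftModule.Carrierᴹ = LeftModule.Carrierᴹ M
restrict f M .LeftModule._≈ᴹ_ = LeftModule._≈ᴹ_ M
restrict f M .LeftModule._+ᴹ_ = LeftModule._+ᴹ_ M
restrict f M .LeftModule._*ₗ_ = λ r → LeftModule._*ₗ_ M (⟦ f ⟧ r)
restrict f M .LeftModule.0ᴹ = LeftModule.0ᴹ M
restrict f M .LeftModule.-ᴹ_ = LeftModule.-ᴹ_ M
restrict f M .LeftModule.isLeftModule = record
    { isLeftSemimodule = record
      { +ᴹ-isCommutativeMonoid = M.+ᴹ-isCommutativeMonoid
      ; isPreleftSemimodule = record
        { *ₗ-cong      = λ r m → M.*ₗ-cong (f.⟦⟧-cong r) m
        ; *ₗ-zeroˡ     = λ m → M.≈ᴹ-trans (M.*ₗ-congʳ f.0#-homo) (M.*ₗ-zeroˡ m)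
        ; *ₗ-distribʳ  = λ m r s → M.≈ᴹ-trans (M.*ₗ-congʳ (f.+-homo r s)) (M.*ₗ-distribʳ m _ _)
        ; *ₗ-identityˡ = λ m → M.≈ᴹ-trans (M.*ₗ-congʳ f.1#-homo) (M.*ₗ-identityˡ m)
        ; *ₗ-assoc     = λ r s m → M.≈ᴹ-trans (M.*ₗ-congʳ (f.*-homo r s)) (M.*ₗ-assoc _ _ m)
        ; *ₗ-zeroʳ     = λ r → M.*ₗ-zeroʳ _
        ; *ₗ-distribˡ  = λ r → M.*ₗ-distribˡ _ } }
    ; -ᴹ‿cong    = M.-ᴹ‿cong
    ; -ᴹ‿inverse = M.-ᴹ‿inverse }
  where
  module M = LeftModule M
  module f = RingHom f

-- The underlying 𝕜-module.  Submodules, linear maps and linear topologies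
-- over 𝕜 only refer to the operations; on raw modules successive restrictions
-- of scalars compose definitionally.
_↾_ : {𝕜 R : CRing ℓ} → Mod R → RingHom 𝕜 R → RawMod ∣ 𝕜 ∣
M ↾ ι = raw (restrict ι M)

module _ {S : Set ℓ} (M : RawMod S) where
  open RawLeftModule M

  private
    sum : ∀ {r} → (Fin r → Carrierᴹ) → Carrierᴹ
    sum = MonoidOps.sum +ᴹ-rawMonoid

  record Submodule : Set (lsuc ℓ) where
    field
      Member    : Pred Carrierᴹ ℓ
      resp      : ∀ {x y} → x ≈ᴹ y → Member x → Member y
      0-closed  : Member 0ᴹ
      +-closed  : ∀ {x y} → Member x → Member y → Member (x +ᴹ y)
      -‿closed  : ∀ {x} → Member x → Member (-ᴹ x)
      *-closed  : ∀ r {x} → Member x → Member (r *ₗ x)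

  InSpan : Pred Carrierᴹ ℓ → Pred Carrierᴹ ℓ
  InSpan P x = ∃ λ r → Σ (Fin r → Carrierᴹ) λ g → (∀ i → P (g i)) ×
               Σ (Fin r → S) λ c → x ≈ᴹ sum (λ i → c i *ₗ g i)

  FinitelyGenerated : Set ℓ
  FinitelyGenerated = ∃ λ r → Σ (Fin r → Carrierᴹ) λ g →
    ∀ x → Σ (Fin r → S) λ c → x ≈ᴹ sum (λ i → c i *ₗ g i)

  _-ᴹ′_ : Op₂ Carrierᴹ
  x -ᴹ′ y = x +ᴹ (-ᴹ y)

record Linear {S : Set ℓ} (M N : RawMod S) : Set ℓ where
  private
    module M = RawLeftModule M
    module N = RawLeftModule N
  open LeftModuleMorphisms M N using (IsLeftModuleHomomorphism)
  field
    fun      : M.Carrierᴹ → N.Carrierᴹ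
    isLinear : IsLeftModuleHomomorphism fun
  open LeftModuleMorphisms.IsLeftModuleHomomorphism isLinear public

open Linear using (fun)

mkLinear : {R : Ring ℓ ℓ} {M N : LMod R} →
           let module M = LeftModule M; module N = LeftModule N in
           (f : M.Carrierᴹ → N.Carrierᴹ) →
           (∀ {x y} → x M.≈ᴹ y → f x N.≈ᴹ f y) →
           (∀ x y → f (x M.+ᴹ y) N.≈ᴹ f x N.+ᴹ f y) →
           (∀ r x → f (r M.*ₗ x) N.≈ᴹ r N.*ₗ f x) →
           Linear (raw M) (raw N)
mkLinear {M = M} {N} f cong +-homo *-homo = record
  { fun = f
  ; isLinear = record
    { +ᴹ-isGroupHomomorphism = record
      { isMonoidHomomorphism = record
        { isMagmaHomomorphism = record
          { isRelHomomorphism = record { cong = cong } ; homo = +-homo }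
        ; ε-homo = 0-homo }
      ; ⁻¹-homo = λ x → inverseˡ-unique (f (M.-ᴹ x)) (f x)
          (N.≈ᴹ-trans (N.≈ᴹ-sym (+-homo (M.-ᴹ x) x))
            (N.≈ᴹ-trans (cong (proj₁ M.-ᴹ‿inverse x)) 0-homo)) }
    ; *ₗ-homo = *-homo } }
  where
  module M = LeftModule M
  module N = LeftModule N
  open GroupProperties N.+ᴹ-group using (inverseˡ-unique; identityˡ-unique)
  0-homo : f M.0ᴹ N.≈ᴹ N.0ᴹ
  0-homo = identityˡ-unique (f M.0ᴹ) (f M.0ᴹ)
    (N.≈ᴹ-trans (N.≈ᴹ-sym (+-homo M.0ᴹ M.0ᴹ)) (cong (proj₁ M.+ᴹ-identity M.0ᴹ)))

open Submodule using (Member)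

whole : {S : Set ℓ} (M : RawMod S) → Submodule M
whole M = record
  { Member   = λ _ → Lift _ ⊤ ; resp = λ _ _ → _ ; 0-closed = _
  ; +-closed = λ _ _ → _ ; -‿closed = λ _ → _ ; *-closed = λ _ _ → _ }

_∩ˢ_ : {S : Set ℓ} {M : RawMod S} → Submodule M → Submodule M → Submodule M
P ∩ˢ Q = record
  { Member   = λ x → P.Member x × Q.Member x
  ; resp     = λ { e (p , q) → P.resp e p , Q.resp e q }
  ; 0-closed = P.0-closed , Q.0-closed
  ; +-closed = λ { (p , q) (p′ , q′) → P.+-closed p p′ , Q.+-closed q q′ }
  ; -‿closed = λ { (p , q) → P.-‿closed p , Q.-‿closed q }
  ; *-closed = λ { r (p , q) → P.*-closed r p , Q.*-closed r q } }
  where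
  module P = Submodule P
  module Q = Submodule Q

module _ {R : Ring ℓ ℓ} where

  -- A submodule as a module; its elements carry a proof of membership, which
  -- equality ignores.
  asModule : (M : LMod R) → Submodule (raw M) → LMod R
  asModule M N .LeftModule.Carrierᴹ = ∃ (Submodule.Member N)
  asModule M N .LeftModule._≈ᴹ_ = λ x y → LeftModule._≈ᴹ_ M (proj₁ x) (proj₁ y)
  asModule M N .LeftModule._+ᴹ_ = λ x y → LeftModule._+ᴹ_ M (proj₁ x) (proj₁ y) , Submodule.+-closed N (proj₂ x) (proj₂ y)
  asModule M N .LeftModule._*ₗ_ = λ r x → LeftModule._*ₗ_ M r (proj₁ x) , Submodule.*-closed N r (proj₂ x)
  asModule M N .LeftModule.0ᴹ = LeftModule.0ᴹ M , Submodule.0-closed N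
  asModule M N .LeftModule.-ᴹ_ = λ x → LeftModule.-ᴹ_ M (proj₁ x) , Submodule.-‿closed N (proj₂ x)
  asModule M N .LeftModule.isLeftModule = record
      { isLeftSemimodule = record
        { +ᴹ-isCommutativeMonoid = record
          { isMonoid = record
            { isSemigroup = record
              { isMagma = record
                { isEquivalence = record
                  { refl = M.≈ᴹ-refl ; sym = M.≈ᴹ-sym ; trans = M.≈ᴹ-trans }
                ; ∙-cong = M.+ᴹ-cong }
              ; assoc = λ _ _ _ → M.+ᴹ-assoc _ _ _ }
            ; identity = (λ _ → M.+ᴹ-identityˡ _) , (λ _ → M.+ᴹ-identityʳ _) }
          ; comm = λ _ _ → M.+ᴹ-comm _ _ }
        ; isPreleftSemimodule = record
          { *ₗ-cong      = M.*ₗ-cong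
          ; *ₗ-zeroˡ     = λ _ → M.*ₗ-zeroˡ _
          ; *ₗ-distribʳ  = λ _ _ _ → M.*ₗ-distribʳ _ _ _
          ; *ₗ-identityˡ = λ _ → M.*ₗ-identityˡ _
          ; *ₗ-assoc     = λ _ _ _ → M.*ₗ-assoc _ _ _
          ; *ₗ-zeroʳ     = λ _ → M.*ₗ-zeroʳ _
          ; *ₗ-distribˡ  = λ _ _ _ → M.*ₗ-distribˡ _ _ _ } }
      ; -ᴹ‿cong    = M.-ᴹ‿cong
      ; -ᴹ‿inverse = (λ _ → proj₁ M.-ᴹ‿inverse _) , (λ _ → proj₂ M.-ᴹ‿inverse _) }
    where
    module M = LeftModule M
    module N = Submodule N

  -- Quotients keep the carrier and coarsen the equality.
  infix 8 _/_
  _/_ : (M : LMod R) → Submodule (raw M) → LMod R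
  (M / N) .LeftModule.Carrierᴹ = LeftModule.Carrierᴹ M
  (M / N) .LeftModule._≈ᴹ_ = λ x y → _-ᴹ′_ (raw M) x y ∈ Submodule.Member N
  (M / N) .LeftModule._+ᴹ_ = LeftModule._+ᴹ_ M
  (M / N) .LeftModule._*ₗ_ = LeftModule._*ₗ_ M
  (M / N) .LeftModule.0ᴹ = LeftModule.0ᴹ M
  (M / N) .LeftModule.-ᴹ_ = LeftModule.-ᴹ_ M
  (M / N) .LeftModule.isLeftModule = record
      { isLeftSemimodule = record
        { +ᴹ-isCommutativeMonoid = record
          { isMonoid = record
            { isSemigroup = record
              { isMagma = record
                { isEquivalence = record
                  { refl = ⌊ M.≈ᴹ-refl ⌋
                  ; sym = λ {x} {y} p → N.resp (neg-sub x y) (N.-‿closed p)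
                  ; trans = λ {x} {y} {z} p q → N.resp (sub-trans x y z) (N.+-closed p q) }
                ; ∙-cong = λ {x} {y} {u} {v} p q → N.resp (+-sub x y u v) (N.+-closed p q) }
              ; assoc = λ x y z → ⌊ M.+ᴹ-assoc x y z ⌋ }
            ; identity = (λ x → ⌊ M.+ᴹ-identityˡ x ⌋) , (λ x → ⌊ M.+ᴹ-identityʳ x ⌋) }
          ; comm = λ x y → ⌊ M.+ᴹ-comm x y ⌋ }
        ; isPreleftSemimodule = record
          { *ₗ-cong      = λ {r} {s} {x} {y} r≈s p →
              N.resp (*-sub r x y r≈s) (N.*-closed r p)
          ; *ₗ-zeroˡ     = λ x → ⌊ M.*ₗ-zeroˡ x ⌋
          ; *ₗ-distribʳ  = λ x r s → ⌊ M.*ₗ-distribʳ x r s ⌋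
          ; *ₗ-identityˡ = λ x → ⌊ M.*ₗ-identityˡ x ⌋
          ; *ₗ-assoc     = λ r s x → ⌊ M.*ₗ-assoc r s x ⌋
          ; *ₗ-zeroʳ     = λ r → ⌊ M.*ₗ-zeroʳ r ⌋
          ; *ₗ-distribˡ  = λ r x y → ⌊ M.*ₗ-distribˡ r x y ⌋ } }
      ; -ᴹ‿cong    = λ {x} {y} p → N.resp (neg-+ x (M.-ᴹ y)) (N.-‿closed p)
      ; -ᴹ‿inverse = (λ x → ⌊ proj₁ M.-ᴹ‿inverse x ⌋) , (λ x → ⌊ proj₂ M.-ᴹ‿inverse x ⌋) }
    where
    module M = LeftModule M
    module N = Submodule N
    module R = Ring R
    open M
    open SetoidReasoning ≈ᴹ-setoid
    open GroupProperties +ᴹ-group using (inverseˡ-unique; ⁻¹-involutive; ⁻¹-anti-homo-∙)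
    _-_ : Op₂ Carrierᴹ
    x - y = x +ᴹ (-ᴹ y)
    ⌊_⌋ : ∀ {x y} → x ≈ᴹ y → Member N (x - y)
    ⌊_⌋ {x} {y} p = N.resp (≈ᴹ-sym (≈ᴹ-trans (+ᴹ-congʳ p) (proj₂ -ᴹ‿inverse y))) N.0-closed
    neg-+ : ∀ x y → -ᴹ (x +ᴹ y) ≈ᴹ (-ᴹ x) +ᴹ (-ᴹ y)
    neg-+ x y = ≈ᴹ-trans (⁻¹-anti-homo-∙ x y) (+ᴹ-comm _ _)
    neg-sub : ∀ x y → -ᴹ (x - y) ≈ᴹ y - x
    neg-sub x y = ≈ᴹ-trans (⁻¹-anti-homo-∙ x (-ᴹ y)) (+ᴹ-congʳ (⁻¹-involutive y))
    interchange : ∀ a b c d → (a +ᴹ b) +ᴹ (c +ᴹ d) ≈ᴹ (a +ᴹ c) +ᴹ (b +ᴹ d)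
    interchange a b c d = begin
      (a +ᴹ b) +ᴹ (c +ᴹ d)  ≈⟨ +ᴹ-assoc a b _ ⟩
      a +ᴹ (b +ᴹ (c +ᴹ d))  ≈⟨ +ᴹ-congˡ (+ᴹ-assoc b c d) ⟨
      a +ᴹ ((b +ᴹ c) +ᴹ d)  ≈⟨ +ᴹ-congˡ (+ᴹ-congʳ (+ᴹ-comm b c)) ⟩
      a +ᴹ ((c +ᴹ b) +ᴹ d)  ≈⟨ +ᴹ-congˡ (+ᴹ-assoc c b d) ⟩
      a +ᴹ (c +ᴹ (b +ᴹ d))  ≈⟨ +ᴹ-assoc a c _ ⟨
      (a +ᴹ c) +ᴹ (b +ᴹ d)  ∎
    +-sub : ∀ x y u v → (x - y) +ᴹ (u - v) ≈ᴹ (x +ᴹ u) - (y +ᴹ v)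
    +-sub x y u v = ≈ᴹ-trans (interchange x _ u _) (+ᴹ-congˡ (≈ᴹ-sym (neg-+ y v)))
    sub-trans : ∀ x y z → (x - y) +ᴹ (y - z) ≈ᴹ x - z
    sub-trans x y z = begin
      (x - y) +ᴹ (y - z)              ≈⟨ +ᴹ-assoc x _ _ ⟩
      x +ᴹ ((-ᴹ y) +ᴹ (y - z))        ≈⟨ +ᴹ-congˡ (+ᴹ-assoc _ y _) ⟨
      x +ᴹ (((-ᴹ y) +ᴹ y) +ᴹ (-ᴹ z))  ≈⟨ +ᴹ-congˡ (+ᴹ-congʳ (proj₁ -ᴹ‿inverse y)) ⟩
      x +ᴹ (0ᴹ +ᴹ (-ᴹ z))             ≈⟨ +ᴹ-congˡ (+ᴹ-identityˡ _) ⟩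
      x - z                           ∎
    *-neg : ∀ r y → r *ₗ (-ᴹ y) ≈ᴹ -ᴹ (r *ₗ y)
    *-neg r y = inverseˡ-unique (r *ₗ (-ᴹ y)) (r *ₗ y) (≈ᴹ-trans (≈ᴹ-sym (*ₗ-distribˡ r _ y))
                (≈ᴹ-trans (*ₗ-congˡ (proj₁ -ᴹ‿inverse y)) (*ₗ-zeroʳ r)))
    *-sub : ∀ {s} r x y → r R.≈ s → r *ₗ (x - y) ≈ᴹ (r *ₗ x) - (s *ₗ y)
    *-sub r x y r≈s = ≈ᴹ-trans (*ₗ-distribˡ r x _)
                (+ᴹ-congˡ (≈ᴹ-trans (*-neg r y) (-ᴹ‿cong (*ₗ-congʳ r≈s))))

  preimage : (M N : LMod R) → Linear (raw M) (raw N) → Submodule (raw N) → Submodule (raw M)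
  preimage M N f P = record
    { Member   = λ x → P.Member (f.fun x)
    ; resp     = λ x≈y → P.resp (f.⟦⟧-cong x≈y)
    ; 0-closed = P.resp (N.≈ᴹ-sym f.0ᴹ-homo) P.0-closed
    ; +-closed = λ p q → P.resp (N.≈ᴹ-sym (f.+ᴹ-homo _ _)) (P.+-closed p q)
    ; -‿closed = λ p → P.resp (N.≈ᴹ-sym (f.-ᴹ-homo _)) (P.-‿closed p)
    ; *-closed = λ r p → P.resp (N.≈ᴹ-sym (f.*ₗ-homo r _)) (P.*-closed r p) }
    where
    module f = Linear f
    module P = Submodule P
    module N = LeftModule N

  image : (M N : LMod R) → Linear (raw M) (raw N) → Submodule (raw M) → Submodule (raw N)
  image M N f P = record
    { Member   = λ y → ∃ λ x → P.Member x × f.fun x N.≈ᴹ y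
    ; resp     = λ { y≈z (x , p , e) → x , p , N.≈ᴹ-trans e y≈z }
    ; 0-closed = M.0ᴹ , P.0-closed , f.0ᴹ-homo
    ; +-closed = λ { (x , p , d) (y , q , e) →
        (x M.+ᴹ y) , P.+-closed p q , N.≈ᴹ-trans (f.+ᴹ-homo x y) (N.+ᴹ-cong d e) }
    ; -‿closed = λ { (x , p , d) → (M.-ᴹ x) , P.-‿closed p , N.≈ᴹ-trans (f.-ᴹ-homo x) (N.-ᴹ‿cong d) }
    ; *-closed = λ { r (x , p , d) →
        (r M.*ₗ x) , P.*-closed r p , N.≈ᴹ-trans (f.*ₗ-homo r x) (N.*ₗ-congˡ d) } }
    where
    module f = Linear f
    module P = Submodule P
    module M = LeftModule M
    module N = LeftModule N

  -- N viewed inside L; for N ⊆ L the quotient `asModule M L / within M L N` is L/N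
  within : (M : LMod R) (L N : Submodule (raw M)) → Submodule (raw (asModule M L))
  within M L N = record
    { Member   = λ x → N.Member (proj₁ x)
    ; resp     = N.resp
    ; 0-closed = N.0-closed
    ; +-closed = N.+-closed
    ; -‿closed = N.-‿closed
    ; *-closed = λ r → N.*-closed r }
    where module N = Submodule N

record IsSubring {a b} (R : Ring a b) (P : Pred (Ring.Carrier R) p) : Set (a ⊔ b ⊔ p) where
  open Ring R
  field
    resp      : ∀ {x y} → x ≈ y → P x → P y
    0-closed  : P 0#
    1-closed  : P 1#
    +-closed  : ∀ {x y} → P x → P y → P (x + y)
    -‿closed  : ∀ {x} → P x → P (- x)
    *-closed  : ∀ {x y} → P x → P y → P (x * y)

record IsTwoSidedIdeal {a b} (R : Ring a b) (E P : Pred (Ring.Carrier R) p) : Set (a ⊔ b ⊔ p) where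
  open Ring R
  field
    contained : P ⊆ E
    resp      : ∀ {x y} → x ≈ y → P x → P y
    0-closed  : P 0#
    +-closed  : ∀ {x y} → P x → P y → P (x + y)
    -‿closed  : ∀ {x} → P x → P (- x)
    *-closedˡ : ∀ {e x} → E e → P x → P (e * x)
    *-closedʳ : ∀ {e x} → E e → P x → P (x * e)

record Subring (R : CRing ℓ) : Set (lsuc ℓ) where
  open CommutativeRing R
  field
    Contains    : Pred Carrier ℓ
    isSubring : IsSubring ring Contains
  open IsSubring isSubring public

  asRing : CRing ℓ
  asRing = mkCRing {A = ∃ Contains} {_≈_ = λ x y → proj₁ x ≈ proj₁ y}
    {_+_ = λ x y → (proj₁ x + proj₁ y) , +-closed (proj₂ x) (proj₂ y)}
    {_*_ = λ x y → (proj₁ x * proj₁ y) , *-closed (proj₂ x) (proj₂ y)}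
    { -_ = λ x → (- proj₁ x) , -‿closed (proj₂ x)}
    {0# = 0# , 0-closed} {1# = 1# , 1-closed}
    (record { refl = refl ; sym = sym ; trans = trans })
    +-cong *-cong -‿cong
    (λ _ _ _ → +-assoc _ _ _) (λ _ _ → +-comm _ _) (λ _ → +-identityˡ _) (λ _ → -‿inverseˡ _)
    (λ _ _ _ → *-assoc _ _ _) (λ _ _ → *-comm _ _) (λ _ → *-identityˡ _) (λ _ _ _ → distribʳ _ _ _)

  inclusion : RingHom asRing R
  inclusion = mkRingHom proj₁ id (λ _ _ → refl) (λ _ _ → refl) refl

Ideal : CRing ℓ → Set (lsuc ℓ)
Ideal R = Submodule (raw (unit R))

_/ʳ_ : (R : CRing ℓ) → Ideal R → CRing ℓ
R /ʳ I = mkCRing {_≈_ = Q._≈ᴹ_} {_+_ = _+_} {_*_ = _*_} { -_ = -_} {0# = 0#} {1# = 1#}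
  (record { refl = Q.≈ᴹ-refl ; sym = Q.≈ᴹ-sym ; trans = Q.≈ᴹ-trans })
  Q.+ᴹ-cong
  (λ {x} {y} {u} {v} p q → Q.≈ᴹ-trans {x * u} {x * v} {y * v} (Q.*ₗ-congˡ {x} {u} {v} q)
     (Q.≈ᴹ-trans {x * v} {v * x} {y * v} (inj (*-comm x v))
       (Q.≈ᴹ-trans {v * x} {v * y} {y * v} (Q.*ₗ-congˡ {v} {x} {y} p) (inj (*-comm v y)))))
  Q.-ᴹ‿cong
  (λ x y z → inj (+-assoc x y z)) (λ x y → inj (+-comm x y)) (λ x → inj (+-identityˡ x))
  (λ x → inj (-‿inverseˡ x)) (λ x y z → inj (*-assoc x y z)) (λ x y → inj (*-comm x y))
  (λ x → inj (*-identityˡ x)) (λ x y z → inj (distribʳ x y z))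
  where
  open CommutativeRing R
  module Q = LeftModule (unit R / I)
  inj : ∀ {x y} → x ≈ y → x Q.≈ᴹ y
  inj {x} {y} p = Submodule.resp I (sym (trans (+-congʳ p) (-‿inverseʳ y))) (Submodule.0-closed I)

projection : (R : CRing ℓ) (I : Ideal R) → RingHom R (R /ʳ I)
projection R I = mkRingHom id inj (λ _ _ → Q.refl) (λ _ _ → Q.refl) Q.refl
  where
  open CommutativeRing R
  module Q = CommutativeRing (R /ʳ I)
  inj : ∀ {x y} → x ≈ y → x Q.≈ y
  inj {x} {y} p = Submodule.resp I (sym (trans (+-congʳ p) (-‿inverseʳ y))) (Submodule.0-closed I)

module _ (R : CRing ℓ) where
  open CommutativeRing R

  IsUnit : Pred Carrier ℓ
  IsUnit x = ∃ λ y → x * y ≈ 1#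

  IsField : Set ℓ
  IsField = ¬ (1# ≈ 0#) × (∀ x → ¬ (x ≈ 0#) → IsUnit x)

  -- characteristic 0, or characteristic p with surjective Frobenius
  IsPerfectField : Set ℓ
  IsPerfectField = IsField × (∀ p → Prime p → p ·ℕ 1# ≈ 0# → ∀ x → ∃ λ y → y ^ p ≈ x)
    where open SemiringOps (RawRing.rawSemiring rawRing) using (_^_) renaming (_×_ to infixr 8 _·ℕ_)

  IsDomain : Set ℓ
  IsDomain = ¬ (1# ≈ 0#) × (∀ x y → x * y ≈ 0# → x ≈ 0# ⊎ y ≈ 0#)

  IsPrincipal : Pred (Ideal R) ℓ
  IsPrincipal I = ∃ λ g → (g ∈ Member I) × (∀ x → x ∈ Member I → ∃ λ r → x ≈ r * g)

  -- I ^ i, spanned by the products of i elements of I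
  Power : Ideal R → ℕ → Pred Carrier ℓ
  Power I zero    x = Lift ℓ ⊤
  Power I (suc i) x = InSpan (raw (unit R))
    (λ y → ∃₂ λ a b → (a ∈ Member I) × (b ∈ Power I i) × y ≈ a * b) x

  -- R → lim R / I ^ i is injective and surjective
  IsAdicallyComplete : Pred (Ideal R) ℓ
  IsAdicallyComplete I =
    (∀ x → (∀ i → x ∈ Power I i) → x ≈ 0#) ×
    (∀ (a : ℕ → Carrier) → (∀ i → (a (suc i) - a i) ∈ Power I i) →
       ∃ λ x → ∀ i → (x - a i) ∈ Power I i)

  -- a complete local principal ideal domain which is not a field
  record IsCompleteDVR : Set (lsuc ℓ) where
    field
      isDomain    : IsDomain
      principal   : ∀ I → IsPrincipal I
      𝔪           : Ideal R
      𝔪⇒nonunit   : ∀ x → x ∈ Member 𝔪 → ¬ IsUnit x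
      nonunit⇒𝔪   : ∀ x → ¬ IsUnit x → x ∈ Member 𝔪
      notField    : ∃ λ x → x ∈ Member 𝔪 × ¬ (x ≈ 0#)
      complete    : IsAdicallyComplete 𝔪

record CompleteDVRIn (K : CRing ℓ) : Set (lsuc ℓ) where
  open CommutativeRing K
  field
    subring       : Subring K
    isCompleteDVR : IsCompleteDVR (Subring.asRing subring)
    fraction      : ∀ x → ∃₂ λ a b → a ∈ Subring.Contains subring × b ∈ Subring.Contains subring ×
                    ¬ (b ≈ 0#) × x * b ≈ a
  open Subring subring public using (Contains; inclusion)
  open IsCompleteDVR isCompleteDVR public using (𝔪)

  𝒪 : CRing ℓ
  𝒪 = Subring.asRing subring

  𝜿 : CRing ℓ
  𝜿 = 𝒪 /ʳ 𝔪

  residue : RingHom 𝒪 𝜿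
  residue = projection 𝒪 𝔪

-- 𝒪₁ is given as a subring of K, and 𝒪₂, …, 𝒪ₙ by the local field structure on the
-- residue field of 𝒪₁.
data LocalField {ℓ} : ℕ → CRing ℓ → Set (lsuc ℓ) where
  dim0 : ∀ {K} → IsField K → LocalField 0 K
  step : ∀ {n K} → IsField K → (V : CompleteDVRIn K) → LocalField n (CompleteDVRIn.𝜿 V) →
         LocalField (suc n) K

-- 𝒌ₙ(K)
lastResidueField : (K : CRing ℓ) → LocalField n K → CRing ℓ
lastResidueField K (dim0 _)     = K
lastResidueField K (step _ V L) = lastResidueField (CompleteDVRIn.𝜿 V) L

-- The ring of integers 𝒪(K) as a subring of K: an element of the iterated fibre
-- product is determined by its component in 𝒪₁, whose successive residues must
-- lie in 𝒪₂, 𝒪₃, …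
InRingOfIntegers : (K : CRing ℓ) → LocalField n K → Pred ∣ K ∣ ℓ
InRingOfIntegers K (dim0 _)     x = Lift _ ⊤
InRingOfIntegers K (step _ V L) x =
  Σ (x ∈ CompleteDVRIn.Contains V) λ p → (x , p) ∈ InRingOfIntegers (CompleteDVRIn.𝜿 V) L

-- a ring homomorphism 𝕜 → 𝒪(K)
record StructureMap (𝕜 K : CRing ℓ) (L : LocalField n K) : Set ℓ where
  field
    ι        : RingHom 𝕜 K
    integral : ∀ c → ⟦ ι ⟧ c ∈ InRingOfIntegers K L

module Step {𝕜 K : CRing ℓ} {isField : IsField K} (V : CompleteDVRIn K)
            (L : LocalField n (CompleteDVRIn.𝜿 V)) (s : StructureMap 𝕜 K (step isField V L)) where
  open CompleteDVRIn V public
  open StructureMap s public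
  private module ι = RingHom ι

  ι𝒪 : RingHom 𝕜 𝒪
  ι𝒪 = mkRingHom (λ c → ⟦ ι ⟧ c , proj₁ (integral c)) ι.⟦⟧-cong ι.+-homo ι.*-homo ι.1#-homo

  ι𝜿 : RingHom 𝕜 𝜿
  ι𝜿 = residue ∘ʳ ι𝒪

  residueStructure : StructureMap 𝕜 𝜿 L
  residueStructure = record { ι = ι𝜿 ; integral = λ c → proj₂ (integral c) }

lastStructure : (𝕜 K : CRing ℓ) (L : LocalField n K) → StructureMap 𝕜 K L →
                RingHom 𝕜 (lastResidueField K L)
lastStructure 𝕜 K (dim0 _)     s = StructureMap.ι s
lastStructure 𝕜 K (step _ V L) s = lastStructure 𝕜 (CompleteDVRIn.𝜿 V) L (Step.residueStructure V L s)

-- For a discrete ring 𝕜, a 𝕜-linear topology is given by a basis of open neighbourhoods of 0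
-- consisting of submodules; translates of these form a basis of the topology.
record LinearTopology {𝕜 : Set ℓ} (M : RawMod 𝕜) : Set (lsuc (lsuc ℓ)) where
  field
    Index    : Set (lsuc ℓ)
    U        : Index → Submodule M
    nonempty : Index
    directed : ∀ i j → ∃ λ k → Member (U k) ⊆ Member (U i) × Member (U k) ⊆ Member (U j)

module _ {𝕜 : Set ℓ} {M : RawMod 𝕜} where
  open LinearTopology
  open RawLeftModule M using (Carrierᴹ; _≈ᴹ_; 0ᴹ)

  Continuous : {N : RawMod 𝕜} → LinearTopology M → LinearTopology N →
               (Carrierᴹ → RawLeftModule.Carrierᴹ N) → Set (lsuc ℓ)
  Continuous {N = N} S T f = ∀ x j → ∃ λ i → ∀ y →
    _-ᴹ′_ M y x ∈ Member (U S i) → _-ᴹ′_ N (f y) (f x) ∈ Member (U T j)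

  -- the inverse of a bijection f is continuous
  InverseContinuous : {N : RawMod 𝕜} → LinearTopology M → LinearTopology N →
                      (Carrierᴹ → RawLeftModule.Carrierᴹ N) → Set (lsuc ℓ)
  InverseContinuous {N = N} S T f = ∀ x i → ∃ λ j → ∀ y →
    _-ᴹ′_ N (f y) (f x) ∈ Member (U T j) → _-ᴹ′_ M y x ∈ Member (U S i)

  _FinerThan_ : LinearTopology M → LinearTopology M → Set (lsuc ℓ)
  S FinerThan T = ∀ j → ∃ λ i → Member (U S i) ⊆ Member (U T j)

  IsDiscrete : LinearTopology M → Set (lsuc ℓ)
  IsDiscrete T = ∃ λ i → ∀ x → x ∈ Member (U T i) → x ≈ᴹ 0ᴹ

module _ {𝕜 : Ring ℓ ℓ} (M : LMod 𝕜) where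
  open LinearTopology

  -- the topology induced by a linear map f to N; for injective f, the subspace topology
  inducedTopology : (N : LMod 𝕜) → Linear (raw M) (raw N) →
                    LinearTopology (raw N) → LinearTopology (raw M)
  inducedTopology N f T = record
    { Index    = Index T
    ; U        = λ i → preimage M N f (U T i)
    ; nonempty = nonempty T
    ; directed = λ i j → let k , k⊆i , k⊆j = directed T i j in
        k , (λ {x} → k⊆i {fun f x}) , (λ {x} → k⊆j {fun f x}) }

  -- the quotient topology along a surjective linear map f from N
  quotientTopology : (N : LMod 𝕜) → Linear (raw N) (raw M) →
                     LinearTopology (raw N) → LinearTopology (raw M)
  quotientTopology N f T = record
    { Index    = Index T
    ; U        = λ i → image N M f (U T i)
    ; nonempty = nonempty T
    ; directed = λ i j → let k , k⊆i , k⊆j = directed T i j in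
        k , (λ { (x , p , e) → x , k⊆i p , e }) , (λ { (x , p , e) → x , k⊆j p , e }) }

  -- the coarsest linear topology making all the f i continuous; the neighbourhoods
  -- are finite intersections of preimages
  module _ {I : Set} (N : I → LMod 𝕜) (f : ∀ i → Linear (raw M) (raw (N i)))
           (T : ∀ i → LinearTopology (raw (N i))) where

    private
      Indices : Set (lsuc ℓ)
      Indices = List (Σ I λ i → Index (T i))

      nbhd : Indices → Submodule (raw M)
      nbhd []             = whole (raw M)
      nbhd ((i , j) ∷ js) = preimage M (N i) (f i) (U (T i) j) ∩ˢ nbhd js

      ++-⊆ˡ : ∀ is js → Member (nbhd (is ++ js)) ⊆ Member (nbhd is)
      ++-⊆ˡ []       js _       = _
      ++-⊆ˡ (_ ∷ is) js (p , q) = p , ++-⊆ˡ is js q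

      ++-⊆ʳ : ∀ is js → Member (nbhd (is ++ js)) ⊆ Member (nbhd js)
      ++-⊆ʳ []       js p       = p
      ++-⊆ʳ (_ ∷ is) js (_ , q) = ++-⊆ʳ is js q

    initialTopology : LinearTopology (raw M)
    initialTopology = record
      { Index    = Indices
      ; U        = nbhd
      ; nonempty = []
      ; directed = λ is js → (is ++ js) , (λ {x} → ++-⊆ˡ is js {x}) , (λ {x} → ++-⊆ʳ is js {x}) }

record Alg (𝕜 : CRing ℓ) : Set (lsuc ℓ) where
  constructor alg
  field
    ring : CRing ℓ
    ι    : RingHom 𝕜 ring

  -- the underlying 𝕜-module, of the algebra and of its modules
  ↓ : Mod 𝕜
  ↓ = restrict ι (unit ring)

  ↓ᴹ : Mod ring → RawMod ∣ 𝕜 ∣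
  ↓ᴹ M = M ↾ ι

module _ {𝕜 : CRing ℓ} (A : Alg 𝕜) (T : LinearTopology (raw (Alg.↓ A))) where
  open Alg A
  open CommutativeRing ring using (_*_)

  IsSTRing : Set (lsuc ℓ)
  IsSTRing = ∀ a → Continuous T T (a *_)

  module _ (M : Mod ring) where
    open LeftModule M using (_*ₗ_)

    IsSTModule : LinearTopology (↓ᴹ M) → Set (lsuc ℓ)
    IsSTModule S = (∀ a → Continuous S S (a *ₗ_)) × (∀ m → Continuous T S (_*ₗ m))

    IsFine : LinearTopology (↓ᴹ M) → Set (lsuc (lsuc ℓ))
    IsFine S = IsSTModule S × (∀ S′ → IsSTModule S′ → S FinerThan S′)

module _ (A : CRing ℓ) where
  open CommutativeRing A
  open MonoidOps +-rawMonoid using (sum)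
  open SetoidReasoning setoid
  open Solver commutativeSemiring using (solve; _:=_; _:+_; _:*_)

  private
    infixl 7 _⊛_
    infixl 6 _⊕_
    infix 4 _≋_

    Series : Set ℓ
    Series = ℕ → Carrier

    _⊛_ : Op₂ Series
    (f ⊛ g) n = sum {suc n} λ i → f (toℕ i) * g (n ∸ toℕ i)

    _≋_ : Rel Series ℓ
    f ≋ g = ∀ n → f n ≈ g n

    _⊕_ : Op₂ Series
    (f ⊕ g) n = f n + g n

    0s : Series
    0s _ = 0#

    C : Carrier → Series
    C a zero    = a
    C a (suc _) = 0#

    ⊛-cong : ∀ {f f′ g g′} → f ≋ f′ → g ≋ g′ → (f ⊛ g) ≋ (f′ ⊛ g′)
    ⊛-cong p q zero    = +-congʳ (*-cong (p 0) (q 0))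
    ⊛-cong p q (suc n) = +-cong (*-cong (p 0) (q (suc n))) (⊛-cong (p ∘ suc) q n)

    ⊛-distribʳ : ∀ f g h → ((g ⊕ h) ⊛ f) ≋ ((g ⊛ f) ⊕ (h ⊛ f))
    ⊛-distribʳ f g h zero = begin
      (g 0 + h 0) * f 0 + 0#  ≈⟨ +-identityʳ _ ⟩
      (g 0 + h 0) * f 0       ≈⟨ distribʳ _ _ _ ⟩
      g 0 * f 0 + h 0 * f 0   ≈⟨ +-cong (+-identityʳ _) (+-identityʳ _) ⟨
      (g 0 * f 0 + 0#) + (h 0 * f 0 + 0#) ∎
    ⊛-distribʳ f g h (suc n) = begin
      (g 0 + h 0) * f (suc n) + (((g ∘ suc) ⊕ (h ∘ suc)) ⊛ f) n
        ≈⟨ +-congˡ (⊛-distribʳ f (g ∘ suc) (h ∘ suc) n) ⟩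
      (g 0 + h 0) * f (suc n) + ((g ∘ suc ⊛ f) n + (h ∘ suc ⊛ f) n)
        ≈⟨ solve 5 (λ a b c x y → (a :+ b) :* c :+ (x :+ y) := (a :* c :+ x) :+ (b :* c :+ y)) refl
             (g 0) (h 0) (f (suc n)) ((g ∘ suc ⊛ f) n) ((h ∘ suc ⊛ f) n) ⟩
      (g 0 * f (suc n) + (g ∘ suc ⊛ f) n) + (h 0 * f (suc n) + (h ∘ suc ⊛ f) n) ∎

    ⊛-zeroˡ : ∀ f → (0s ⊛ f) ≋ 0s
    ⊛-zeroˡ f zero    = trans (+-identityʳ _) (zeroˡ _)
    ⊛-zeroˡ f (suc n) = trans (+-cong (zeroˡ _) (⊛-zeroˡ f n)) (+-identityʳ _)

    ⊛-scale : ∀ a f g → ((λ n → a * f n) ⊛ g) ≋ (λ n → a * (f ⊛ g) n)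
    ⊛-scale a f g zero = trans (+-identityʳ _) (trans (*-assoc _ _ _) (*-congˡ (sym (+-identityʳ _))))
    ⊛-scale a f g (suc n) = trans (+-cong (*-assoc _ _ _) (⊛-scale a (f ∘ suc) g n)) (sym (distribˡ _ _ _))

    C-⊛ : ∀ a f → (C a ⊛ f) ≋ (λ n → a * f n)
    C-⊛ a f zero    = +-identityʳ _
    C-⊛ a f (suc n) = trans (+-congˡ (⊛-zeroˡ f n)) (+-identityʳ _)

    ⊛-unfoldʳ : ∀ f g n → (f ⊛ g) (suc n) ≈ (f ⊛ (g ∘ suc)) n + f (suc n) * g 0
    ⊛-unfoldʳ f g zero = begin
      f 0 * g 1 + (f 1 * g 0 + 0#) ≈⟨ +-cong (sym (+-identityʳ _)) (+-identityʳ _) ⟩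
      (f 0 * g 1 + 0#) + f 1 * g 0 ∎
    ⊛-unfoldʳ f g (suc n) = trans (+-congˡ (⊛-unfoldʳ (f ∘ suc) g n)) (sym (+-assoc _ _ _))

    ⊛-comm : ∀ f g → (f ⊛ g) ≋ (g ⊛ f)
    ⊛-comm f g zero    = +-congʳ (*-comm _ _)
    ⊛-comm f g (suc n) = begin
      f 0 * g (suc n) + (f ∘ suc ⊛ g) n ≈⟨ +-cong (*-comm _ _) (⊛-comm (f ∘ suc) g n) ⟩
      g (suc n) * f 0 + (g ⊛ f ∘ suc) n ≈⟨ +-comm _ _ ⟩
      (g ⊛ f ∘ suc) n + g (suc n) * f 0 ≈⟨ ⊛-unfoldʳ g f n ⟨
      (g ⊛ f) (suc n) ∎

    ⊛-assoc : ∀ f g h → ((f ⊛ g) ⊛ h) ≋ (f ⊛ (g ⊛ h))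
    ⊛-assoc f g h zero = solve 3 (λ a b c → (a :* b :+ con 0) :* c :+ con 0
                                          := a :* (b :* c :+ con 0) :+ con 0) refl (f 0) (g 0) (h 0)
      where open Solver commutativeSemiring using (con)
    ⊛-assoc f g h (suc n) = begin
      (f 0 * g 0 + 0#) * h (suc n) + (((λ i → f 0 * g (suc i)) ⊕ (f ∘ suc ⊛ g)) ⊛ h) n
        ≈⟨ +-cong (*-congʳ (+-identityʳ _)) (⊛-distribʳ h (λ i → f 0 * g (suc i)) (f ∘ suc ⊛ g) n) ⟩
      f 0 * g 0 * h (suc n) + (((λ i → f 0 * g (suc i)) ⊛ h) n + ((f ∘ suc ⊛ g) ⊛ h) n)
        ≈⟨ +-congˡ (+-cong (⊛-scale (f 0) (g ∘ suc) h n) (⊛-assoc (f ∘ suc) g h n)) ⟩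
      f 0 * g 0 * h (suc n) + (f 0 * (g ∘ suc ⊛ h) n + (f ∘ suc ⊛ (g ⊛ h)) n)
        ≈⟨ solve 5 (λ a b c x y → a :* b :* c :+ (a :* x :+ y) := a :* (b :* c :+ x) :+ y) refl
             (f 0) (g 0) (h (suc n)) ((g ∘ suc ⊛ h) n) ((f ∘ suc ⊛ (g ⊛ h)) n) ⟩
      f 0 * (g 0 * h (suc n) + (g ∘ suc ⊛ h) n) + (f ∘ suc ⊛ (g ⊛ h)) n ∎

  PowerSeries : CRing ℓ
  PowerSeries = mkCRing {_≈_ = _≋_} {_⊕_} {_⊛_} {λ f n → - f n} {0s} {C 1#}
    (record { refl = λ _ → refl ; sym = λ p n → sym (p n) ; trans = λ p q n → trans (p n) (q n) })
    (λ p q n → +-cong (p n) (q n)) ⊛-cong (λ p n → -‿cong (p n))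
    (λ _ _ _ _ → +-assoc _ _ _) (λ _ _ _ → +-comm _ _) (λ _ _ → +-identityˡ _) (λ _ _ → -‿inverseˡ _)
    ⊛-assoc ⊛-comm (λ f n → trans (C-⊛ 1# f n) (*-identityˡ _)) ⊛-distribʳ

  constant : RingHom A PowerSeries
  constant = mkRingHom C
    (λ { p zero → p ; p (suc _) → refl })
    (λ { x y zero → refl ; x y (suc _) → sym (+-identityˡ _) })
    (λ { x y zero → sym (C-⊛ x (C y) 0) ; x y (suc n) → sym (trans (C-⊛ x (C y) (suc n)) (zeroʳ x)) })
    (λ { zero → refl ; (suc _) → refl })

  constant-* : ∀ a f n → CommutativeRing._*_ PowerSeries (⟦ constant ⟧ a) f n ≈ a * f n
  constant-* = C-⊛

  𝑡 : ∣ PowerSeries ∣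
  𝑡 1 = 1#
  𝑡 _ = 0#

  -- A[t]/(tⁱ⁺¹) as an A-module, with basis 1, t, …, tⁱ
  Truncated : ℕ → Mod A
  Truncated i .LeftModule.Carrierᴹ = Fin (suc i) → Carrier
  Truncated i .LeftModule._≈ᴹ_ = λ f g → ∀ k → f k ≈ g k
  Truncated i .LeftModule._+ᴹ_ = λ f g k → f k + g k
  Truncated i .LeftModule._*ₗ_ = λ a f k → a * f k
  Truncated i .LeftModule.0ᴹ = λ _ → 0#
  Truncated i .LeftModule.-ᴹ_ = λ f k → - f k
  Truncated i .LeftModule.isLeftModule = record
      { isLeftSemimodule = record
        { +ᴹ-isCommutativeMonoid = record
          { isMonoid = record
            { isSemigroup = record
              { isMagma = record
                { isEquivalence = record
                  { refl = λ _ → refl ; sym = λ p k → sym (p k) ; trans = λ p q k → trans (p k) (q k) }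
                ; ∙-cong = λ p q k → +-cong (p k) (q k) }
              ; assoc = λ _ _ _ _ → +-assoc _ _ _ }
            ; identity = (λ _ _ → +-identityˡ _) , (λ _ _ → +-identityʳ _) }
          ; comm = λ _ _ _ → +-comm _ _ }
        ; isPreleftSemimodule = record
          { *ₗ-cong      = λ p q k → *-cong p (q k)
          ; *ₗ-zeroˡ     = λ _ _ → zeroˡ _
          ; *ₗ-distribʳ  = λ _ _ _ _ → distribʳ _ _ _
          ; *ₗ-identityˡ = λ _ _ → *-identityˡ _
          ; *ₗ-assoc     = λ _ _ _ _ → *-assoc _ _ _
          ; *ₗ-zeroʳ     = λ _ _ → zeroʳ _
          ; *ₗ-distribˡ  = λ _ _ _ _ → distribˡ _ _ _ } }
      ; -ᴹ‿cong    = λ p k → -‿cong (p k)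
      ; -ᴹ‿inverse = (λ _ _ → -‿inverseˡ _) , (λ _ _ → -‿inverseʳ _) }

module _ (R : CRing ℓ) (s : ∣ R ∣) where
  open CommutativeRing R
  open SemiringOps (RawRing.rawSemiring rawRing) using (_^_)
  open SetoidReasoning setoid
  open Solver commutativeSemiring using (solve; _:=_; _:+_; _:*_; con)

  private
    IsPower : Pred Carrier ℓ
    IsPower d = ∃ λ m → d ≈ s ^ m

    1-power : IsPower 1#
    1-power = 0 , refl

    *-power : ∀ {d e} → IsPower d → IsPower e → IsPower (d * e)
    *-power (m , p) (n , q) = m ℕ.+ n , trans (*-cong p q) (sym (^-+ m))
      where
      ^-+ : ∀ m → s ^ (m ℕ.+ n) ≈ s ^ m * s ^ n
      ^-+ zero    = sym (*-identityˡ _)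
      ^-+ (suc m) = trans (*-congˡ (^-+ m)) (sym (*-assoc _ _ _))

    record Fraction : Set ℓ where
      constructor frac
      field
        num     : Carrier
        den     : Carrier
        isPower : IsPower den

    _≃_ : Rel Fraction ℓ
    frac a d _ ≃ frac a′ d′ _ = ∃ λ u → IsPower u × u * (a * d′) ≈ u * (a′ * d)

    _⊞_ _⊠_ : Op₂ Fraction
    frac a d p ⊞ frac b e q = frac (a * e + b * d) (d * e) (*-power p q)
    frac a d p ⊠ frac b e q = frac (a * b) (d * e) (*-power p q)

    ⊟_ : Op₁ Fraction
    ⊟ frac a d p = frac (- a) d p

    eq : ∀ {x y} → let open Fraction in num x * den y ≈ num y * den x → x ≃ y
    eq p = 1# , 1-power , *-congˡ p

    ≃-trans : ∀ {x y z} → x ≃ y → y ≃ z → x ≃ z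
    ≃-trans {frac a d _} {frac b e q} {frac c f _} (u , pu , p) (v , pv , r) =
      (u * v) * e , *-power (*-power pu pv) q , (begin
        ((u * v) * e) * (a * f)  ≈⟨ solve 5 (λ u v e a f → ((u :* v) :* e) :* (a :* f)
                                      := (v :* f) :* (u :* (a :* e))) refl u v e a f ⟩
        (v * f) * (u * (a * e))  ≈⟨ *-congˡ p ⟩
        (v * f) * (u * (b * d))  ≈⟨ solve 5 (λ u v d b f → (v :* f) :* (u :* (b :* d))
                                      := (u :* d) :* (v :* (b :* f))) refl u v d b f ⟩
        (u * d) * (v * (b * f))  ≈⟨ *-congˡ r ⟩
        (u * d) * (v * (c * e))  ≈⟨ solve 5 (λ u v d c e → (u :* d) :* (v :* (c :* e))
                                      := ((u :* v) :* e) :* (c :* d)) refl u v d c e ⟩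
        ((u * v) * e) * (c * d)  ∎)

    ⊞-cong : ∀ {x y z w} → x ≃ y → z ≃ w → (x ⊞ z) ≃ (y ⊞ w)
    ⊞-cong {frac a d _} {frac a′ d′ _} {frac b e _} {frac b′ e′ _} (u , pu , p) (v , pv , q) =
      u * v , *-power pu pv , (begin
        (u * v) * ((a * e + b * d) * (d′ * e′))
          ≈⟨ solve 8 (λ u v a d d′ b e e′ → (u :* v) :* ((a :* e :+ b :* d) :* (d′ :* e′))
               := (v :* (e :* e′)) :* (u :* (a :* d′)) :+ (u :* (d :* d′)) :* (v :* (b :* e′)))
               refl u v a d d′ b e e′ ⟩
        (v * (e * e′)) * (u * (a * d′)) + (u * (d * d′)) * (v * (b * e′))
          ≈⟨ +-cong (*-congˡ p) (*-congˡ q) ⟩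
        (v * (e * e′)) * (u * (a′ * d)) + (u * (d * d′)) * (v * (b′ * e))
          ≈⟨ solve 8 (λ u v a′ d d′ b′ e e′ →
               (v :* (e :* e′)) :* (u :* (a′ :* d)) :+ (u :* (d :* d′)) :* (v :* (b′ :* e))
               := (u :* v) :* ((a′ :* e′ :+ b′ :* d′) :* (d :* e)))
               refl u v a′ d d′ b′ e e′ ⟩
        (u * v) * ((a′ * e′ + b′ * d′) * (d * e)) ∎)

    ⊠-cong : ∀ {x y z w} → x ≃ y → z ≃ w → (x ⊠ z) ≃ (y ⊠ w)
    ⊠-cong {frac a d _} {frac a′ d′ _} {frac b e _} {frac b′ e′ _} (u , pu , p) (v , pv , q) =
      u * v , *-power pu pv , (begin
        (u * v) * ((a * b) * (d′ * e′))    ≈⟨ solve 6 (λ u v a d′ b e′ →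
                                                (u :* v) :* ((a :* b) :* (d′ :* e′))
                                                := (u :* (a :* d′)) :* (v :* (b :* e′))) refl u v a d′ b e′ ⟩
        (u * (a * d′)) * (v * (b * e′))    ≈⟨ *-cong p q ⟩
        (u * (a′ * d)) * (v * (b′ * e))    ≈⟨ solve 6 (λ u v a d′ b e′ →
                                                (u :* (a :* d′)) :* (v :* (b :* e′))
                                                := (u :* v) :* ((a :* b) :* (d′ :* e′))) refl u v a′ d b′ e ⟩
        (u * v) * ((a′ * b′) * (d * e))    ∎)

    +assoc : ∀ a d b e c f → ((a * e + b * d) * f + c * (d * e)) * (d * (e * f))
                           ≈ (a * (e * f) + (b * f + c * e) * d) * ((d * e) * f)
    +assoc = solve 6 (λ a d b e c f → ((a :* e :+ b :* d) :* f :+ c :* (d :* e)) :* (d :* (e :* f))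
                       := (a :* (e :* f) :+ (b :* f :+ c :* e) :* d) :* ((d :* e) :* f)) refl

    ⊟-cong : ∀ {x y} → x ≃ y → (⊟ x) ≃ (⊟ y)
    ⊟-cong {frac a d _} {frac a′ d′ _} (u , pu , p) = u , pu , (begin
        u * (- a * d′)      ≈⟨ *-congˡ (-‿distribˡ-* a d′) ⟨
        u * - (a * d′)      ≈⟨ -‿distribʳ-* u _ ⟨
        - (u * (a * d′))    ≈⟨ -‿cong p ⟩
        - (u * (a′ * d))    ≈⟨ -‿distribʳ-* u _ ⟩
        u * - (a′ * d)      ≈⟨ *-congˡ (-‿distribˡ-* a′ d) ⟩
        u * (- a′ * d)      ∎)
      where open RingProperties ring using (-‿distribˡ-*; -‿distribʳ-*)

  -- R[s⁻¹]; s may be a zero divisor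
  Localization : CRing ℓ
  Localization = mkCRing {_≈_ = _≃_} {_⊞_} {_⊠_} {⊟_} {frac 0# 1# 1-power} {frac 1# 1# 1-power}
    (record { refl  = λ {x} → eq {x} {x} refl
            ; sym   = λ { {frac _ _ _} {frac _ _ _} (u , pu , p) → u , pu , sym p }
            ; trans = λ {x} {y} {z} → ≃-trans {x} {y} {z} })
    (λ {x} {y} {z} {w} → ⊞-cong {x} {y} {z} {w})
    (λ {x} {y} {z} {w} → ⊠-cong {x} {y} {z} {w})
    (λ {x} {y} → ⊟-cong {x} {y})
    (λ { x@(frac a d _) y@(frac b e _) z@(frac c f _) →
         eq {(x ⊞ y) ⊞ z} {x ⊞ (y ⊞ z)} (+assoc a d b e c f) })
    (λ { x@(frac a d _) y@(frac b e _) → eq {x ⊞ y} {y ⊞ x}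
         (solve 4 (λ a d b e → (a :* e :+ b :* d) :* (e :* d) := (b :* d :+ a :* e) :* (d :* e))
            refl a d b e) })
    (λ { x@(frac a d _) → eq {frac 0# 1# 1-power ⊞ x} {x}
         (solve 2 (λ a d → (con 0 :* d :+ a :* con 1) :* d := a :* (con 1 :* d)) refl a d) })
    (λ { x@(frac a d _) → eq {(⊟ x) ⊞ x} {frac 0# 1# 1-power} (begin
         (- a * d + a * d) * 1#  ≈⟨ *-congʳ (distribʳ d (- a) a) ⟨
         (- a + a) * d * 1#      ≈⟨ *-congʳ (*-congʳ (-‿inverseˡ a)) ⟩
         0# * d * 1#             ≈⟨ *-congʳ (zeroˡ d) ⟩
         0# * 1#                 ≈⟨ zeroˡ 1# ⟩
         0#                      ≈⟨ zeroˡ (d * d) ⟨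
         0# * (d * d)            ∎) })
    (λ { x@(frac a d _) y@(frac b e _) z@(frac c f _) → eq {(x ⊠ y) ⊠ z} {x ⊠ (y ⊠ z)}
         (*-cong (*-assoc a b c) (sym (*-assoc d e f))) })
    (λ { x@(frac a d _) y@(frac b e _) → eq {x ⊠ y} {y ⊠ x} (*-cong (*-comm a b) (*-comm e d)) })
    (λ { x@(frac a d _) → eq {frac 1# 1# 1-power ⊠ x} {x}
         (solve 2 (λ a d → (con 1 :* a) :* d := a :* (con 1 :* d)) refl a d) })
    (λ { x@(frac a d _) y@(frac b e _) z@(frac c f _) → eq {(y ⊞ z) ⊠ x} {(y ⊠ x) ⊞ (z ⊠ x)}
         (solve 6 (λ a d b e c f → ((b :* f :+ c :* e) :* a) :* ((e :* d) :* (f :* d))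
                    := ((b :* a) :* (f :* d) :+ (c :* a) :* (e :* d)) :* ((e :* f) :* d))
            refl a d b e c f) })

  localize : RingHom R Localization
  localize = mkRingHom (λ a → frac a 1# 1-power)
    (λ p → 1# , 1-power , *-congˡ (*-congʳ p))
    (λ a b → 1# , 1-power ,
       solve 2 (λ a b → con 1 :* ((a :+ b) :* (con 1 :* con 1))
                     := con 1 :* ((a :* con 1 :+ b :* con 1) :* con 1)) refl a b)
    (λ a b → 1# , 1-power , solve 2 (λ a b → con 1 :* ((a :* b) :* (con 1 :* con 1))
                                          := con 1 :* ((a :* b) :* con 1)) refl a b)
    (1# , 1-power , refl)

module _ {𝕜 : CRing ℓ} where

  module _ (A : Alg 𝕜) where
    open Alg A

    powerSeriesAlg : Alg 𝕜
    powerSeriesAlg = alg (PowerSeries ring) (constant ring ∘ʳ ι)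

    -- A((t)) = A[[t]][t⁻¹]
    laurentRing : CRing ℓ
    laurentRing = Localization (PowerSeries ring) (𝑡 ring)

    fromPowerSeries : RingHom (PowerSeries ring) laurentRing
    fromPowerSeries = localize (PowerSeries ring) (𝑡 ring)

    laurentAlg : Alg 𝕜
    laurentAlg = alg laurentRing (fromPowerSeries ∘ʳ (constant ring ∘ʳ ι))

    truncate : ∀ i → Linear (raw (Alg.↓ powerSeriesAlg)) (raw (restrict ι (Truncated ring i)))
    truncate i = mkLinear {M = Alg.↓ powerSeriesAlg} {restrict ι (Truncated ring i)}
      (λ f k → f (toℕ k)) (λ p k → p (toℕ k)) (λ _ _ _ → CommutativeRing.refl ring)
      (λ c f k → constant-* ring (⟦ ι ⟧ c) f (toℕ k))

    inverseLimitTopology : (∀ i → LinearTopology (↓ᴹ (Truncated ring i))) →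
                           LinearTopology (raw (Alg.↓ powerSeriesAlg))
    inverseLimitTopology =
      initialTopology (Alg.↓ powerSeriesAlg) (λ i → restrict ι (Truncated ring i)) truncate

    IsLaurentTopology : LinearTopology (raw ↓) → LinearTopology (raw (Alg.↓ laurentAlg)) →
                        Set (lsuc (lsuc ℓ))
    IsLaurentTopology T S =
      Σ (∀ i → LinearTopology (↓ᴹ (Truncated ring i))) λ T′ →
        (∀ i → IsFine A T (Truncated ring i) (T′ i)) ×
        IsFine powerSeriesAlg (inverseLimitTopology T′)
               (restrict fromPowerSeries (unit laurentRing)) S

  iteratedLaurent : ℕ → Alg 𝕜 → Alg 𝕜
  iteratedLaurent zero    A = A
  iteratedLaurent (suc n) A = laurentAlg (iteratedLaurent n A)

  IsStandardTopology : ∀ n (A : Alg 𝕜) → LinearTopology (raw (Alg.↓ (iteratedLaurent n A))) →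
                       Set (lsuc (lsuc ℓ))
  IsStandardTopology zero    A T = Lift _ (IsDiscrete T)
  IsStandardTopology (suc n) A T = ∃ λ T′ →
    IsStandardTopology n A T′ × IsLaurentTopology (iteratedLaurent n A) T′ T

  InPowerSeries : (A : Alg 𝕜) → Pred ∣ laurentRing A ∣ ℓ
  InPowerSeries A x = ∃ λ f → x ≈ ⟦ fromPowerSeries A ⟧ f
    where open CommutativeRing (laurentRing A) using (_≈_)

  -- F maps 𝒪₁ = A[[t₁]] onto 𝒪₁(K), and the induced map on residue fields again
  -- respects the valuation rings.  The residue field of A[[t]] is identified with
  -- A through the constant series, so the induced map sends a to the residue class
  -- of F a.
  RespectsValuations : (A : Alg 𝕜) (K : CRing ℓ) (L : LocalField n K) →
                       (∣ Alg.ring (iteratedLaurent n A) ∣ → ∣ K ∣) → Set ℓ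
  RespectsValuations A K (dim0 _) F = Lift _ ⊤
  RespectsValuations A K (step {n} _ V L) F =
    Σ (∀ {x} → x ∈ InPowerSeries B → F x ∈ Contains) λ into →
      (∀ {y} → y ∈ Contains → ∃ λ x → x ∈ InPowerSeries B × F x ≈ y) ×
      RespectsValuations A 𝜿 L
        (λ b → F (embed b) , into (⟦ constant (Alg.ring B) ⟧ b , Laurent.refl {embed b}))
    where
    open CompleteDVRIn V
    open CommutativeRing K using (_≈_)
    B = iteratedLaurent n A
    module Laurent = CommutativeRing (laurentRing B)
    embed : ∣ Alg.ring B ∣ → ∣ laurentRing B ∣
    embed b = ⟦ fromPowerSeries B ⟧ (⟦ constant (Alg.ring B) ⟧ b)

record TopologicalLocalField (𝕜 : CRing ℓ) (n : ℕ) : Set (lsuc (lsuc ℓ)) where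
  field
    K          : CRing ℓ
    localField : LocalField n K
    structure  : StructureMap 𝕜 K localField

  open StructureMap structure public using (ι)

  algebra : Alg 𝕜
  algebra = alg K ι

  -- 𝕜′ = 𝒌ₙ(K)
  residueAlg : Alg 𝕜
  residueAlg = alg (lastResidueField K localField) (lastStructure 𝕜 K localField structure)

  standard : Alg 𝕜
  standard = iteratedLaurent n residueAlg

  field
    finite     : FinitelyGenerated (raw (Alg.↓ residueAlg))
    topology   : LinearTopology (raw (Alg.↓ algebra))
    isSTRing   : IsSTRing algebra topology

    standardTopology   : LinearTopology (raw (Alg.↓ standard))
    isStandardTopology : IsStandardTopology n residueAlg standardTopology
    parametrization    : RingHom (Alg.ring standard) K
    isIsomorphism      : RingMorphisms.IsRingIsomorphism
                           (CommutativeRing.rawRing (Alg.ring standard)) (CommutativeRing.rawRing K)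
                           ⟦ parametrization ⟧
    isAlgHom           : ∀ c → CommutativeRing._≈_ K
                           (⟦ parametrization ⟧ (⟦ Alg.ι standard ⟧ c)) (⟦ ι ⟧ c)
    continuous         : Continuous standardTopology topology ⟦ parametrization ⟧
    inverseContinuous  : InverseContinuous standardTopology topology ⟦ parametrization ⟧
    respectsValuations : RespectsValuations residueAlg K localField ⟦ parametrization ⟧

module Lift₁ {𝕜 K : CRing ℓ} {isField : IsField K} (V : CompleteDVRIn K)
             (L : LocalField n (CompleteDVRIn.𝜿 V)) (s : StructureMap 𝕜 K (step isField V L))
             (T : LinearTopology (unit K ↾ StructureMap.ι s)) where
  open Step V L s
  private
    K↓ = restrict ι (unit K)
    𝒪↓ = restrict ι𝒪 (unit 𝒪)
    𝜿↓ = restrict ι𝜿 (unit 𝜿)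
    module K = CommutativeRing K
    module 𝒪 = CommutativeRing 𝒪
    module 𝜿 = CommutativeRing 𝜿
    module residue = RingHom residue

  topology𝒪 : LinearTopology (raw 𝒪↓)
  topology𝒪 = inducedTopology 𝒪↓ K↓
    (mkLinear {M = 𝒪↓} {K↓} proj₁ id (λ _ _ → K.refl) (λ _ _ → K.refl)) T

  topology𝜿 : LinearTopology (raw 𝜿↓)
  topology𝜿 = quotientTopology 𝜿↓ 𝒪↓
    (mkLinear {M = 𝒪↓} {𝜿↓} ⟦ residue ⟧ residue.⟦⟧-cong residue.+-homo (λ _ _ → 𝜿.refl)) topology𝒪

  record Lifting : Set (lsuc ℓ) where
    field
      σ          : RingHom 𝜿 𝒪
      isAlgHom   : ∀ c → ⟦ σ ⟧ (⟦ ι𝜿 ⟧ c) 𝒪.≈ ⟦ ι𝒪 ⟧ c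
      continuous : Continuous topology𝜿 topology𝒪 ⟦ σ ⟧
      splits     : ∀ x → ⟦ residue ⟧ (⟦ σ ⟧ x) 𝜿.≈ x

SystemOfLiftings : (𝕜 K : CRing ℓ) (L : LocalField n K) (s : StructureMap 𝕜 K L) →
                   LinearTopology (unit K ↾ StructureMap.ι s) → Set (lsuc ℓ)
SystemOfLiftings 𝕜 K (dim0 _)     s T = Lift _ ⊤
SystemOfLiftings 𝕜 K (step _ V L) s T =
  Lifting × SystemOfLiftings 𝕜 (CompleteDVRIn.𝜿 V) L (Step.residueStructure V L s) topology𝜿
  where open Lift₁ V L s T

module _ {K : CRing ℓ} (V : CompleteDVRIn K) where
  open CompleteDVRIn V

  record Lattice (M : Mod K) : Set (lsuc ℓ) where
    field
      submodule : Submodule (M ↾ inclusion)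
      finite    : FinitelyGenerated (raw (asModule (restrict inclusion M) submodule))
      generates : ∀ x → x ∈ InSpan (raw M) (Member submodule)

  -- L / L′, for L′ ⊆ L
  latticeQuotient : {M : Mod K} → Lattice M → Lattice M → Mod 𝒪
  latticeQuotient {M} L L′ = asModule M𝒪 (submodule L) / within M𝒪 (submodule L) (submodule L′)
    where
    open Lattice
    M𝒪 = restrict inclusion M

module Refine {𝕜 K : CRing ℓ} {isField : IsField K} (V : CompleteDVRIn K)
              (L : LocalField n (CompleteDVRIn.𝜿 V)) (s : StructureMap 𝕜 K (step isField V L))
              (M₁ M₂ : Mod K) (φ : Linear (M₁ ↾ StructureMap.ι s) (M₂ ↾ StructureMap.ι s)) where
  open Step V L s

  infix 4 _∈ᴸ_
  _∈ᴸ_ : {M : Mod K} → LeftModule.Carrierᴹ M → Lattice V M → Set ℓ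
  x ∈ᴸ L = x ∈ Member (Lattice.submodule L)

  -- (L₁′ , L₂′) is a φ-refinement of (L₁ , L₂)
  record Refinement (L₁ : Lattice V M₁) (L₂ : Lattice V M₂)
                    (L₁′ : Lattice V M₁) (L₂′ : Lattice V M₂) : Set ℓ where
    field
      L₁′⊆L₁  : ∀ {x} → _∈ᴸ_ {M₁} x L₁′ → _∈ᴸ_ {M₁} x L₁
      L₂⊆L₂′  : ∀ {x} → _∈ᴸ_ {M₂} x L₂ → _∈ᴸ_ {M₂} x L₂′
      φL₁′⊆L₂ : ∀ {x} → _∈ᴸ_ {M₁} x L₁′ → _∈ᴸ_ {M₂} (fun φ x) L₂
      φL₁⊆L₂′ : ∀ {x} → _∈ᴸ_ {M₁} x L₁ → _∈ᴸ_ {M₂} (fun φ x) L₂′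

  module _ (T : LinearTopology (unit K ↾ ι)) (lifting : Lift₁.Lifting V L s T) where
    open Lift₁.Lifting lifting
    private
      module K  = CommutativeRing K
      module 𝒪  = CommutativeRing 𝒪
      module M₁ = LeftModule M₁
      module M₂ = LeftModule M₂
      module φ  = Linear φ

    rest : {M : Mod K} → Lattice V M → Lattice V M → Mod 𝜿
    rest {M} L L′ = restrict σ (latticeQuotient V {M} L L′)

    induced : ∀ {L₁ L₂ L₁′ L₂′} → Refinement L₁ L₂ L₁′ L₂′ →
              Linear (rest {M₁} L₁ L₁′ ↾ ι𝜿) (rest {M₂} L₂′ L₂ ↾ ι𝜿)
    induced {L₁} {L₂} {L₁′} {L₂′} r =
      mkLinear {M = restrict ι𝜿 (rest {M₁} L₁ L₁′)} {restrict ι𝜿 (rest {M₂} L₂′ L₂)}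
        (λ x → fun φ (proj₁ x) , φL₁⊆L₂′ (proj₂ x))
        (λ {x} {y} p → resp₂ (φ-sub (proj₁ x) (proj₁ y)) (φL₁′⊆L₂ p))
        (λ x y → ⌊ φ.+ᴹ-homo (proj₁ x) (proj₁ y) ⌋)
        (λ c x → ⌊ M₂.≈ᴹ-trans (φ.⟦⟧-cong (M₁.*ₗ-congʳ (isAlgHom c)))
                    (M₂.≈ᴹ-trans (φ.*ₗ-homo c (proj₁ x)) (M₂.*ₗ-congʳ (K.sym (isAlgHom c)))) ⌋)
      where
      open Refinement r
      module L₂ = Submodule (Lattice.submodule L₂)
      resp₂ : ∀ {x y} → x M₂.≈ᴹ y → L₂.Member x → L₂.Member y
      resp₂ = L₂.resp
      φ-sub : ∀ x y → fun φ (x M₁.+ᴹ (M₁.-ᴹ y)) M₂.≈ᴹ fun φ x M₂.+ᴹ (M₂.-ᴹ fun φ y)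
      φ-sub x y = M₂.≈ᴹ-trans (φ.+ᴹ-homo x _) (M₂.+ᴹ-congˡ (φ.-ᴹ-homo y))
      ⌊_⌋ : ∀ {x y} → x M₂.≈ᴹ y → L₂.Member (x M₂.+ᴹ (M₂.-ᴹ y))
      ⌊_⌋ {x} {y} p = resp₂ (M₂.≈ᴹ-sym (M₂.≈ᴹ-trans (M₂.+ᴹ-congʳ p) (proj₂ M₂.-ᴹ‿inverse y))) L₂.0-closed

IsBT : (𝕜 K : CRing ℓ) (L : LocalField n K) (s : StructureMap 𝕜 K L)
       (T : LinearTopology (unit K ↾ StructureMap.ι s)) → SystemOfLiftings 𝕜 K L s T →
       (M₁ M₂ : Mod K) → Pred (Linear (M₁ ↾ StructureMap.ι s) (M₂ ↾ StructureMap.ι s)) (lsuc ℓ)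
IsBT 𝕜 K (dim0 _) s T σ M₁ M₂ φ = Lift _ ⊤
IsBT 𝕜 K (step _ V L) s T (σ₁ , dσ) M₁ M₂ φ =
  (∀ L₁ L₂ → ∃₂ λ L₁′ L₂′ → Refinement L₁ L₂ L₁′ L₂′) ×
  (∀ L₁ L₂ L₁′ L₂′ (r : Refinement L₁ L₂ L₁′ L₂′) →
     IsBT 𝕜 𝜿 L residueStructure (Lift₁.topology𝜿 V L s T) dσ
          (rest T σ₁ {M₁} L₁ L₁′) (rest T σ₁ {M₂} L₂′ L₂) (induced T σ₁ r))
  where
  open Step V L s
  open Refine V L s M₁ M₂ φ

-- E(M₁,M₂)ᵢⱼ; the indices i ∈ {1,…,n} and j ∈ {1,2} are numbered from zero
IsBTᵢⱼ : (𝕜 K : CRing ℓ) (L : LocalField n K) (s : StructureMap 𝕜 K L)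
         (T : LinearTopology (unit K ↾ StructureMap.ι s)) → SystemOfLiftings 𝕜 K L s T →
         (M₁ M₂ : Mod K) → Fin n → Fin 2 →
         Pred (Linear (M₁ ↾ StructureMap.ι s) (M₂ ↾ StructureMap.ι s)) (lsuc ℓ)
IsBTᵢⱼ 𝕜 K L₀@(step _ V L) s T σ M₁ M₂ zero zero φ =
  IsBT 𝕜 K L₀ s T σ M₁ M₂ φ ×
  ∃ λ (L₂ : Lattice V M₂) → ∀ x → fun φ x ∈ Member (Lattice.submodule L₂)
IsBTᵢⱼ 𝕜 K L₀@(step _ V L) s T σ M₁ M₂ zero (suc zero) φ =
  IsBT 𝕜 K L₀ s T σ M₁ M₂ φ ×
  ∃ λ (L₁ : Lattice V M₁) → ∀ x → x ∈ Member (Lattice.submodule L₁) → fun φ x M₂.≈ᴹ M₂.0ᴹ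
  where module M₂ = LeftModule M₂
IsBTᵢⱼ 𝕜 K L₀@(step _ V L) s T σ@(σ₁ , dσ) M₁ M₂ (suc i) j φ =
  IsBT 𝕜 K L₀ s T σ M₁ M₂ φ ×
  (∀ L₁ L₂ L₁′ L₂′ (r : Refinement L₁ L₂ L₁′ L₂′) →
     IsBTᵢⱼ 𝕜 𝜿 L residueStructure (Lift₁.topology𝜿 V L s T) dσ
          (rest T σ₁ {M₁} L₁ L₁′) (rest T σ₁ {M₂} L₂′ L₂) i j (induced T σ₁ r))
  where
  open Step V L s
  open Refine V L s M₁ M₂ φ

module _ {R : Ring ℓ ℓ} (M : LMod R) where
  private
    open LeftModule M
    open SetoidReasoning ≈ᴹ-setoid
    open GroupProperties +ᴹ-group using (inverseˡ-unique; ⁻¹-anti-homo-∙; ε⁻¹≈ε)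

    Op : Set ℓ
    Op = Linear (raw M) (raw M)

    linear : (f : Carrierᴹ → Carrierᴹ) → (∀ {x y} → x ≈ᴹ y → f x ≈ᴹ f y) →
             (∀ x y → f (x +ᴹ y) ≈ᴹ f x +ᴹ f y) → (∀ r x → f (r *ₗ x) ≈ᴹ r *ₗ f x) → Op
    linear = mkLinear {M = M} {M}

    interchange : ∀ a b c d → (a +ᴹ b) +ᴹ (c +ᴹ d) ≈ᴹ (a +ᴹ c) +ᴹ (b +ᴹ d)
    interchange a b c d = begin
      (a +ᴹ b) +ᴹ (c +ᴹ d)  ≈⟨ +ᴹ-assoc a b _ ⟩
      a +ᴹ (b +ᴹ (c +ᴹ d))  ≈⟨ +ᴹ-congˡ (+ᴹ-assoc b c d) ⟨
      a +ᴹ ((b +ᴹ c) +ᴹ d)  ≈⟨ +ᴹ-congˡ (+ᴹ-congʳ (+ᴹ-comm b c)) ⟩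
      a +ᴹ ((c +ᴹ b) +ᴹ d)  ≈⟨ +ᴹ-congˡ (+ᴹ-assoc c b d) ⟩
      a +ᴹ (c +ᴹ (b +ᴹ d))  ≈⟨ +ᴹ-assoc a c _ ⟨
      (a +ᴹ c) +ᴹ (b +ᴹ d)  ∎

    neg-+ : ∀ x y → -ᴹ (x +ᴹ y) ≈ᴹ (-ᴹ x) +ᴹ (-ᴹ y)
    neg-+ x y = ≈ᴹ-trans (⁻¹-anti-homo-∙ x y) (+ᴹ-comm _ _)

    neg-* : ∀ r y → -ᴹ (r *ₗ y) ≈ᴹ r *ₗ (-ᴹ y)
    neg-* r y = ≈ᴹ-sym (inverseˡ-unique (r *ₗ (-ᴹ y)) (r *ₗ y) (≈ᴹ-trans (≈ᴹ-sym (*ₗ-distribˡ r _ y))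
                  (≈ᴹ-trans (*ₗ-congˡ (proj₁ -ᴹ‿inverse y)) (*ₗ-zeroʳ r))))

    _⊕_ _⊙_ : Op₂ Op
    f ⊕ g = linear (λ x → f.fun x +ᴹ g.fun x)
      (λ p → +ᴹ-cong (f.⟦⟧-cong p) (g.⟦⟧-cong p))
      (λ x y → ≈ᴹ-trans (+ᴹ-cong (f.+ᴹ-homo x y) (g.+ᴹ-homo x y)) (interchange _ _ _ _))
      (λ r x → ≈ᴹ-trans (+ᴹ-cong (f.*ₗ-homo r x) (g.*ₗ-homo r x)) (≈ᴹ-sym (*ₗ-distribˡ r _ _)))
      where module f = Linear f
            module g = Linear g
    f ⊙ g = linear (f.fun ∘ g.fun)
      (λ p → f.⟦⟧-cong (g.⟦⟧-cong p))
      (λ x y → ≈ᴹ-trans (f.⟦⟧-cong (g.+ᴹ-homo x y)) (f.+ᴹ-homo _ _))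
      (λ r x → ≈ᴹ-trans (f.⟦⟧-cong (g.*ₗ-homo r x)) (f.*ₗ-homo r _))
      where module f = Linear f
            module g = Linear g

    ⊖_ : Op₁ Op
    ⊖ f = linear (λ x → -ᴹ f.fun x)
      (λ p → -ᴹ‿cong (f.⟦⟧-cong p))
      (λ x y → ≈ᴹ-trans (-ᴹ‿cong (f.+ᴹ-homo x y)) (neg-+ _ _))
      (λ r x → ≈ᴹ-trans (-ᴹ‿cong (f.*ₗ-homo r x)) (neg-* r _))
      where module f = Linear f

    0op 1op : Op
    0op = linear (λ _ → 0ᴹ) (λ _ → ≈ᴹ-refl) (λ _ _ → ≈ᴹ-sym (+ᴹ-identityˡ 0ᴹ))
            (λ r _ → ≈ᴹ-sym (*ₗ-zeroʳ r))
    1op = linear id id (λ _ _ → ≈ᴹ-refl) (λ _ _ → ≈ᴹ-refl)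

  End : Ring ℓ ℓ
  End .Ring.Carrier = Op
  End .Ring._≈_ = λ f g → ∀ x → fun f x ≈ᴹ fun g x
  End .Ring._+_ = _⊕_
  End .Ring._*_ = _⊙_
  End .Ring.-_ = ⊖_
  End .Ring.0# = 0op
  End .Ring.1# = 1op
  End .Ring.isRing = record
    { +-isAbelianGroup = record
      { isGroup = record
        { isMonoid = record
          { isSemigroup = record
            { isMagma = record
              { isEquivalence = record
                { refl  = λ _ → ≈ᴹ-refl
                ; sym   = λ p x → ≈ᴹ-sym (p x)
                ; trans = λ p q x → ≈ᴹ-trans (p x) (q x) }
              ; ∙-cong = λ p q x → +ᴹ-cong (p x) (q x) }
            ; assoc = λ _ _ _ _ → +ᴹ-assoc _ _ _ }
          ; identity = (λ _ _ → +ᴹ-identityˡ _) , (λ _ _ → +ᴹ-identityʳ _) }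
        ; inverse = (λ _ _ → proj₁ -ᴹ‿inverse _) , (λ _ _ → proj₂ -ᴹ‿inverse _)
        ; ⁻¹-cong = λ p x → -ᴹ‿cong (p x) }
      ; comm = λ _ _ _ → +ᴹ-comm _ _ }
    ; *-cong     = λ {f} {g} p q x → ≈ᴹ-trans (Linear.⟦⟧-cong f (q x)) (p _)
    ; *-assoc    = λ _ _ _ _ → ≈ᴹ-refl
    ; *-identity = (λ _ _ → ≈ᴹ-refl) , (λ _ _ → ≈ᴹ-refl)
    ; distrib    = (λ f _ _ _ → Linear.+ᴹ-homo f _ _) , (λ _ _ _ _ → ≈ᴹ-refl) }

  HasFiniteRank : Pred Op ℓ
  HasFiniteRank φ = FinitelyGenerated (raw (asModule M (image M M φ (whole (raw M)))))

  IsFinitePotent : Pred Op ℓ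
  IsFinitePotent φ = ∃ λ q → HasFiniteRank (φ ^ suc q)
    where open SemiringOps (RawRing.rawSemiring (Ring.rawRing End)) using (_^_)

module _ {𝕜 : CRing ℓ} (A : Alg 𝕜) where
  open Alg A
  private
    module A = CommutativeRing ring
    module End = Ring (End ↓)

  multiplication : A.Carrier → End.Carrier
  multiplication a = mkLinear {M = ↓} {↓} (a A.*_) A.*-congˡ (A.distribˡ a)
    (λ c x → A.trans (A.sym (A.*-assoc a _ x))
               (A.trans (A.*-congʳ (A.*-comm a _)) (A.*-assoc _ a x)))

  -- E is a 𝕜-subring: it contains the image of 𝕜 because it contains that of A.
  record IsCubicallyDecomposed (n : ℕ) (E : Pred End.Carrier p)
                               (Eᵢⱼ : Fin n → Fin 2 → Pred End.Carrier p) : Set (ℓ ⊔ p) where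
    field
      isSubring    : IsSubring (End ↓) E
      contains-A   : ∀ a → multiplication a ∈ E
      isIdeal      : ∀ i j → IsTwoSidedIdeal (End ↓) E (Eᵢⱼ i j)
      decomposes   : ∀ i {φ} → φ ∈ E → ∃₂ λ φ₁ φ₂ →
                     φ₁ ∈ Eᵢⱼ i zero × φ₂ ∈ Eᵢⱼ i (suc zero) × φ End.≈ (φ₁ End.+ φ₂)
      finitePotent : ∀ {φ} → φ ∈ E → (∀ i j → φ ∈ Eᵢⱼ i j) → IsFinitePotent ↓ φ

module _ {𝕜 : CRing ℓ} {n : ℕ} (F : TopologicalLocalField 𝕜 n) where
  open TopologicalLocalField F

  LiftingsOf : Set (lsuc ℓ)
  LiftingsOf = SystemOfLiftings 𝕜 K localField structure topology

  module _ (σ : LiftingsOf) where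

    -- E(K) and E(K)ᵢⱼ, computed with the system of liftings σ
    E : Pred (Ring.Carrier (End (Alg.↓ algebra))) (lsuc ℓ)
    E = IsBT 𝕜 K localField structure topology σ (unit K) (unit K)

    Eᵢⱼ : Fin n → Fin 2 → Pred (Ring.Carrier (End (Alg.↓ algebra))) (lsuc ℓ)
    Eᵢⱼ = IsBTᵢⱼ 𝕜 K localField structure topology σ (unit K) (unit K)

{-# OPTIONS --safe #-}
module Submission where

-- The topology of K plays no role once the liftings σᵢ are fixed.  Over the residue
-- field 𝜿 of 𝒪₁, finite modules are vector spaces: inclusions of subquotients split
-- 𝜿-linearly, so the operator induced on a subquotient is recovered from the one induced
-- on a larger subquotient.  Hence membership in E and Eᵢⱼ may be tested on fine enough
-- refinements, which gives closure under sums and composition by induction on n.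
--
-- Through σ₁ every x ∈ K has an expansion Σᵢ σ₁(aᵢ) tⁱ.  For i = 1 the identity is the sum
-- of x ↦ Σ_{i≥0} σ₁(aᵢ) tⁱ and x ↦ Σ_{i<0} σ₁(aᵢ) tⁱ; for i ≥ 2 a decomposition 1 = e₁ + e₂ over 𝜿 is applied
-- coefficientwise.  Composing with these operators decomposes all of E.
--
-- If φ(K) ⊆ L₂ and φ(L₁) = 0 with L₁ ⊆ L₂, then φ² factors through the operator φ̄ on
-- L₂ / L₁, which is finite potent by induction.

open import Defs
open import Algebra.Bundles using (AbelianGroup; Ring; RawRing; CommutativeRing)
import Algebra.Definitions.RawMonoid as MonoidOps
import Algebra.Definitions.RawSemiring as SemiringOps
open import Algebra.Module.Bundles using (LeftModule)
import Algebra.Properties.AbelianGroup as AbelianGroupProperties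
import Algebra.Properties.CommutativeSemigroup as SemigroupProperties
import Algebra.Properties.Ring as RingProperties
import Algebra.Properties.Semiring.Exp as SemiringExp
import Algebra.Solver.Ring.NaturalCoefficients.Default as Solver
open import Axiom.ExcludedMiddle using (ExcludedMiddle)
open import Data.Fin.Base using (Fin; zero; suc)
open import Data.Nat.Base as ℕ using (ℕ; zero; suc)
import Data.Nat.Properties as ℕ
open import Data.Product.Base using (Σ; ∃; ∃₂; _×_; _,_; proj₁; proj₂)
open import Data.Sum.Base using (inj₁; inj₂)
open import Function.Base using (_∘_; id)
open import Level using (Level) renaming (suc to lsuc)
open import Relation.Binary.PropositionalEquality.Core using (subst)
import Relation.Binary.Reasoning.Setoid as SetoidReasoning
open import Relation.Nullary.Decidable.Core using (Dec; yes; no; decidable-stable)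
open import Relation.Nullary.Negation.Core using (¬_; contradiction)
open import Relation.Unary using (Pred)

open RingHom using (⟦_⟧)
open Linear using (fun)
open Submodule using (Member)

-- The recursion for E passes from K to subquotients of lattices, which are arbitrary
-- finite-dimensional 𝜿-spaces. So closure is proved for families of operators between all finite
-- modules, and only the final theorem specialises to K.
--
-- The obstacle is the quantifier over all refinements: a refinement for φ + ψ or for ψφ does not
-- supply one for φ or for ψ. Passing to a finer refinement is harmless because the maps comparing
-- the two induced operators are 𝜿-linear, hence lie in E over 𝜿; a merely 𝕜-linear splitting might
-- not. Subquotients need not split over 𝒪₁, whence the restriction along σ₁.
--
-- A coefficientwise operator built from a 𝕜-linear e need not be 𝜿-linear, so its induced maps
-- require another argument: on 𝒪₁ / tᵐ it is a finite sum of composites of e with 𝜿-linear maps,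
-- hence lies in the ideal containing e. Completeness of 𝒪₁ serves to assemble these truncations
-- into an operator on K.
--
-- The recursion for finite potency ends at 𝒌ₙ(K), which is finite over 𝕜, so every operator on a
-- finite module there has finite rank.

private
  variable
    ℓ : Level

-- Linear maps, spans and finite generation over a ring.

module _ {R : Ring ℓ ℓ} where

  module AdditiveGroup (M : LMod R) where
    open LeftModule M
    open AbelianGroupProperties +ᴹ-abelianGroup public
    open SemigroupProperties (AbelianGroup.commutativeSemigroup +ᴹ-abelianGroup) public
      using (interchange)

  FG : LMod R → Set ℓ
  FG M = FinitelyGenerated (raw M)

  identityMap : (M : LMod R) → Linear (raw M) (raw M)
  identityMap M = mkLinear {M = M} {M} id id (λ _ _ → ≈ᴹ-refl) (λ _ _ → ≈ᴹ-refl)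
    where open LeftModule M

  zeroMap : (M N : LMod R) → Linear (raw M) (raw N)
  zeroMap M N = mkLinear {M = M} {N} (λ _ → 0ᴹ) (λ _ → ≈ᴹ-refl)
    (λ _ _ → ≈ᴹ-sym (+ᴹ-identityˡ 0ᴹ)) (λ r _ → ≈ᴹ-sym (*ₗ-zeroʳ r))
    where open LeftModule N

  composite : (M N P : LMod R) → Linear (raw N) (raw P) → Linear (raw M) (raw N) →
              Linear (raw M) (raw P)
  composite M N P g f = mkLinear {M = M} {P} (g.fun ∘ f.fun) (g.⟦⟧-cong ∘ f.⟦⟧-cong)
    (λ x y → ≈ᴹ-trans (g.⟦⟧-cong (f.+ᴹ-homo x y)) (g.+ᴹ-homo _ _))
    (λ r x → ≈ᴹ-trans (g.⟦⟧-cong (f.*ₗ-homo r x)) (g.*ₗ-homo r _))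
    where
    open LeftModule P
    module f = Linear f
    module g = Linear g

  sumMap : (M N : LMod R) → Linear (raw M) (raw N) → Linear (raw M) (raw N) →
           Linear (raw M) (raw N)
  sumMap M N f g = mkLinear {M = M} {N} (λ x → f.fun x +ᴹ g.fun x)
    (λ p → +ᴹ-cong (f.⟦⟧-cong p) (g.⟦⟧-cong p))
    (λ x y → ≈ᴹ-trans (+ᴹ-cong (f.+ᴹ-homo x y) (g.+ᴹ-homo x y)) (interchange _ _ _ _))
    (λ r x → ≈ᴹ-trans (+ᴹ-cong (f.*ₗ-homo r x) (g.*ₗ-homo r x)) (≈ᴹ-sym (*ₗ-distribˡ r _ _)))
    where
    open LeftModule N
    open AdditiveGroup N
    module f = Linear f
    module g = Linear g

  module _ (M : LMod R) where
    open LeftModule M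
    open AdditiveGroup M

    *ₗ-neg : ∀ r x → r *ₗ (-ᴹ x) ≈ᴹ -ᴹ (r *ₗ x)
    *ₗ-neg r x = inverseˡ-unique _ _ (≈ᴹ-trans (≈ᴹ-sym (*ₗ-distribˡ r _ _))
      (≈ᴹ-trans (*ₗ-congˡ (proj₁ -ᴹ‿inverse x)) (*ₗ-zeroʳ r)))

    negation : Linear (raw M) (raw M)
    negation = mkLinear {M = M} {M} -ᴹ_ -ᴹ‿cong (λ x y → ≈ᴹ-sym (⁻¹-∙-comm x y))
      (λ r x → ≈ᴹ-sym (*ₗ-neg r x))

    module _ (N : Submodule (raw M)) where

      ≈⇒≈/ : ∀ {x y} → x ≈ᴹ y → LeftModule._≈ᴹ_ (M / N) x y
      ≈⇒≈/ p = Submodule.resp N (≈ᴹ-sym (x≈y⇒x∙y⁻¹≈ε p)) (Submodule.0-closed N)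

      quotientMap : Linear (raw M) (raw (M / N))
      quotientMap = mkLinear {M = M} {M / N} id ≈⇒≈/ (λ _ _ → ≈⇒≈/ ≈ᴹ-refl) (λ _ _ → ≈⇒≈/ ≈ᴹ-refl)

      ∈⇒≈/0 : ∀ {x} → Member N x → LeftModule._≈ᴹ_ (M / N) x 0ᴹ
      ∈⇒≈/0 = Submodule.resp N (≈ᴹ-sym (≈ᴹ-trans (+ᴹ-congˡ ε⁻¹≈ε) (+ᴹ-identityʳ _)))

    combination : ∀ {r} → (Fin r → Ring.Carrier R) → (Fin r → Carrierᴹ) → Carrierᴹ
    combination c g = MonoidOps.sum +ᴹ-rawMonoid (λ i → c i *ₗ g i)

    combination-zero : ∀ {r} (g : Fin r → Carrierᴹ) → combination (λ _ → Ring.0# R) g ≈ᴹ 0ᴹ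
    combination-zero {zero}  g = ≈ᴹ-refl
    combination-zero {suc r} g = ≈ᴹ-trans
      (+ᴹ-cong (*ₗ-zeroˡ _) (combination-zero (g ∘ suc))) (+ᴹ-identityˡ 0ᴹ)

    combination-+ : ∀ {r} (c d : Fin r → Ring.Carrier R) g →
      combination (λ i → Ring._+_ R (c i) (d i)) g ≈ᴹ combination c g +ᴹ combination d g
    combination-+ {zero}  c d g = ≈ᴹ-sym (+ᴹ-identityˡ 0ᴹ)
    combination-+ {suc r} c d g = ≈ᴹ-trans
      (+ᴹ-cong (*ₗ-distribʳ _ _ _) (combination-+ (c ∘ suc) (d ∘ suc) (g ∘ suc)))
      (interchange _ _ _ _)

    combination-* : ∀ {r} a (c : Fin r → Ring.Carrier R) g →
      combination (λ i → Ring._*_ R a (c i)) g ≈ᴹ a *ₗ combination c g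
    combination-* {zero}  a c g = ≈ᴹ-sym (*ₗ-zeroʳ a)
    combination-* {suc r} a c g = ≈ᴹ-trans
      (+ᴹ-cong (*ₗ-assoc _ _ _) (combination-* a (c ∘ suc) (g ∘ suc))) (≈ᴹ-sym (*ₗ-distribˡ a _ _))

    combination-∈ : ∀ (N : Submodule (raw M)) {r} c {g : Fin r → Carrierᴹ} →
                    (∀ i → Member N (g i)) → Member N (combination c g)
    combination-∈ N {zero}  c p = Submodule.0-closed N
    combination-∈ N {suc r} c p =
      Submodule.+-closed N (Submodule.*-closed N _ (p zero)) (combination-∈ N (c ∘ suc) (p ∘ suc))

    neg-1* : ∀ x → Ring.-_ R (Ring.1# R) *ₗ x ≈ᴹ -ᴹ x
    neg-1* x = inverseˡ-unique _ _ (≈ᴹ-trans (+ᴹ-congˡ (≈ᴹ-sym (*ₗ-identityˡ x)))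
      (≈ᴹ-trans (≈ᴹ-sym (*ₗ-distribʳ x _ _))
        (≈ᴹ-trans (*ₗ-congʳ (Ring.-‿inverseˡ R _)) (*ₗ-zeroˡ x))))

    mkSubmodule : (P : Pred Carrierᴹ ℓ) → (∀ {x y} → x ≈ᴹ y → P x → P y) → P 0ᴹ →
                  (∀ {x y} → P x → P y → P (x +ᴹ y)) → (∀ r {x} → P x → P (r *ₗ x)) →
                  Submodule (raw M)
    mkSubmodule P resp 0-closed +-closed *-closed = record
      { Member = P ; resp = resp ; 0-closed = 0-closed ; +-closed = +-closed
      ; -‿closed = λ p → resp (neg-1* _) (*-closed _ p) ; *-closed = *-closed }

    Span : ∀ {r} → (Fin r → Carrierᴹ) → Submodule (raw M)
    Span g = mkSubmodule (λ x → ∃ λ c → x ≈ᴹ combination c g)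
      (λ { p (c , q) → c , ≈ᴹ-trans (≈ᴹ-sym p) q })
      ((λ _ → Ring.0# R) , ≈ᴹ-sym (combination-zero g))
      (λ { (c , p) (d , q) → _ , ≈ᴹ-trans (+ᴹ-cong p q) (≈ᴹ-sym (combination-+ c d g)) })
      (λ { a (c , p) → _ , ≈ᴹ-trans (*ₗ-congˡ p) (≈ᴹ-sym (combination-* a c g)) })

    Multiples : Carrierᴹ → Submodule (raw M)
    Multiples g = mkSubmodule (λ x → ∃ λ c → x ≈ᴹ c *ₗ g)
      (λ { p (c , q) → c , ≈ᴹ-trans (≈ᴹ-sym p) q })
      (Ring.0# R , ≈ᴹ-sym (*ₗ-zeroˡ g))
      (λ { (c , p) (d , q) → _ , ≈ᴹ-trans (+ᴹ-cong p q) (≈ᴹ-sym (*ₗ-distribʳ g c d)) })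
      (λ { a (c , p) → _ , ≈ᴹ-trans (*ₗ-congˡ p) (≈ᴹ-sym (*ₗ-assoc a c g)) })

    -- Weaker than finite generation, since the spanning vectors need not satisfy `P`. Over a field
    -- the two agree for submodules, by `subspace-FG`.
    Bounded : Pred Carrierᴹ ℓ → Set ℓ
    Bounded P = ∃ λ r → Σ (Fin r → Carrierᴹ) λ g → ∀ {x} → P x → Member (Span g) x

    bounded-+ : ∀ {P Q} → Bounded P → Bounded Q →
                Bounded (λ x → ∃₂ λ y z → P y × Q z × x ≈ᴹ y +ᴹ z)
    bounded-+ (r , g , p) (s , h , q) = r ℕ.+ s , append g h ,
      λ { (y , z , y∈ , z∈ , e) → let c , yc = p y∈ ; d , zd = q z∈ in
          append c d , ≈ᴹ-trans e (≈ᴹ-trans (+ᴹ-cong yc zd) (≈ᴹ-sym (combination-append c d g h))) }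
      where
      append : ∀ {a} {A : Set a} {r s} → (Fin r → A) → (Fin s → A) → Fin (r ℕ.+ s) → A
      append {r = zero}  g h i       = h i
      append {r = suc r} g h zero    = g zero
      append {r = suc r} g h (suc i) = append (g ∘ suc) h i
      combination-append : ∀ {r s} c d (g : Fin r → Carrierᴹ) (h : Fin s → Carrierᴹ) →
        combination (append c d) (append g h) ≈ᴹ combination c g +ᴹ combination d h
      combination-append {zero}  c d g h = ≈ᴹ-sym (+ᴹ-identityˡ _)
      combination-append {suc r} c d g h = ≈ᴹ-trans
        (+ᴹ-congˡ (combination-append (c ∘ suc) d (g ∘ suc) h)) (≈ᴹ-sym (+ᴹ-assoc _ _ _))

  module _ (M N : LMod R) (f : Linear (raw M) (raw N)) where
    private
      module N = LeftModule N
      module f = Linear f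

    map-combination : ∀ {r} c (g : Fin r → LeftModule.Carrierᴹ M) →
                      f.fun (combination M c g) N.≈ᴹ combination N c (f.fun ∘ g)
    map-combination {zero}  c g = f.0ᴹ-homo
    map-combination {suc r} c g = N.≈ᴹ-trans (f.+ᴹ-homo _ _)
      (N.+ᴹ-cong (f.*ₗ-homo _ _) (map-combination (c ∘ suc) (g ∘ suc)))

    map-span : ∀ {r} {g : Fin r → LeftModule.Carrierᴹ M} {x} →
               Member (Span M g) x → Member (Span N (f.fun ∘ g)) (f.fun x)
    map-span {g = g} (c , p) = c , N.≈ᴹ-trans (f.⟦⟧-cong p) (map-combination c g)

    map-sub : ∀ x y → f.fun (_-ᴹ′_ (raw M) x y) N.≈ᴹ _-ᴹ′_ (raw N) (f.fun x) (f.fun y)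
    map-sub x y = N.≈ᴹ-trans (f.+ᴹ-homo x _) (N.+ᴹ-congˡ (f.-ᴹ-homo y))

    surjective-FG : (∀ y → ∃ λ x → f.fun x N.≈ᴹ y) → FG M → FG N
    surjective-FG surj (r , g , gen) = r , f.fun ∘ g , λ y → let x , e = surj y in
      Submodule.resp (Span N (f.fun ∘ g)) e (map-span (gen x))

  asModule-combination : (M : LMod R) (N : Submodule (raw M)) → ∀ {r} c (g : Fin r → ∃ (Member N)) →
    LeftModule._≈ᴹ_ M (proj₁ (combination (asModule M N) c g)) (combination M c (proj₁ ∘ g))
  asModule-combination M N = map-combination (asModule M N) M
    (mkLinear {M = asModule M N} {M} proj₁ id (λ _ _ → ≈ᴹ-refl) (λ _ _ → ≈ᴹ-refl))
    where open LeftModule M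

  Section : (W V : LMod R) → Linear (raw W) (raw V) → Set ℓ
  Section W V q = Σ (Linear (raw V) (raw W)) λ s → ∀ v → LeftModule._≈ᴹ_ V (fun q (fun s v)) v

  module _ (M : LMod R) where
    open LeftModule M

    generator∈Span : ∀ {r} (g : Fin r → Carrierᴹ) i → Member (Span M g) (g i)
    generator∈Span g i = δ i , δ-combination i g
      where
      δ : ∀ {r} → Fin r → Fin r → Ring.Carrier R
      δ zero    zero    = Ring.1# R
      δ zero    (suc _) = Ring.0# R
      δ (suc _) zero    = Ring.0# R
      δ (suc i) (suc j) = δ i j
      δ-combination : ∀ {r} i (g : Fin r → Carrierᴹ) → g i ≈ᴹ combination M (δ i) g
      δ-combination zero g = ≈ᴹ-sym (≈ᴹ-trans
        (+ᴹ-cong (*ₗ-identityˡ _) (combination-zero M (g ∘ suc))) (+ᴹ-identityʳ _))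
      δ-combination (suc i) g = ≈ᴹ-sym (≈ᴹ-trans
        (+ᴹ-cong (*ₗ-zeroˡ _) (≈ᴹ-sym (δ-combination i (g ∘ suc)))) (+ᴹ-identityˡ _))

    span-FG : ∀ {r} (g : Fin r → Carrierᴹ) → FG (asModule M (Span M g))
    span-FG g = _ , (λ i → g i , generator∈Span g i) ,
      λ { (x , c , e) → c , ≈ᴹ-trans e (≈ᴹ-sym (asModule-combination M (Span M g) c _)) }

unit-FG : (R : CRing ℓ) → FG (unit R)
unit-FG R = 1 , (λ _ → 1#) , λ x → (λ _ → x) , sym (trans (+-identityʳ _) (*-identityʳ x))
  where open CommutativeRing R

multiply : (R : CRing ℓ) (M : Mod R) → ∣ R ∣ → Linear (raw M) (raw M)
multiply R M d = mkLinear {M = M} {M} (d *ₗ_) *ₗ-congˡ (*ₗ-distribˡ d)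
  (λ r x → ≈ᴹ-trans (≈ᴹ-sym (*ₗ-assoc d r x)) (≈ᴹ-trans (*ₗ-congʳ (CommutativeRing.*-comm R d r)) (*ₗ-assoc r d x)))
  where open LeftModule M

-- A combination of generators is a sum of multiples of single generators, so it suffices to bound
-- each cyclic submodule over `S`. This serves both for torsion modules along σ and for a finite
-- extension of 𝕜.
restrict-FG : {S R : CRing ℓ} (f : RingHom S R) (M : Mod R) →
              (∀ g → Bounded (restrict f M) (Member (Multiples M g))) → FG M → FG (restrict f M)
restrict-FG {ℓ} {S = S} {R} f M cyclic (r , g , gen) =
  let s , h , p = spanned r g in s , h , λ x → p (gen x)
  where
  open LeftModule M
  spanned : ∀ r (g : Fin r → Carrierᴹ) → Bounded (restrict f M) (Member (Span M g))
  spanned zero    g = zero , (λ ()) , λ { (c , e) → (λ ()) , e }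
  spanned (suc r) g =
    let s , h , p = bounded-+ (restrict f M) (cyclic (g zero)) (spanned r (g ∘ suc)) in
    s , h , λ { (c , e) → p (_ , _ , (c zero , ≈ᴹ-refl) , (c ∘ suc , ≈ᴹ-refl) , e) }

-- A record, because conversion checking would otherwise unfold the powers in IsFinitePotent.
record FinitePotent (F : CRing ℓ) (M : Mod F) (φ : Linear (raw M) (raw M)) : Set ℓ where
  constructor potent
  field
    isFinitePotent : IsFinitePotent M φ

-- Vector spaces: splittings and the transfer of finite potency.

module _ {F : CRing ℓ} (isField : IsField F) (em : ExcludedMiddle ℓ) where
  private
    module F = CommutativeRing F

  module _ (M : Mod F) where
    open LeftModule M
    open AdditiveGroup M

    *ₗ-cancelʳ : ∀ {g} → ¬ (g ≈ᴹ 0ᴹ) → ∀ c d → c *ₗ g ≈ᴹ d *ₗ g → c F.≈ d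
    *ₗ-cancelʳ {g} g≉0 c d e with em {c F.- d F.≈ F.0#}
    ... | yes p = RingProperties.x∙y⁻¹≈ε⇒x≈y F.ring c d p
    ... | no ¬p = let u , v = proj₂ isField _ ¬p in contradiction
      (≈ᴹ-trans (≈ᴹ-sym (*ₗ-identityˡ g)) (≈ᴹ-trans (*ₗ-congʳ (F.trans (F.sym v) (F.*-comm _ u)))
        (≈ᴹ-trans (*ₗ-assoc u _ g) (≈ᴹ-trans (*ₗ-congˡ d-zero) (*ₗ-zeroʳ u))))) g≉0
      where
      d-zero : (c F.- d) *ₗ g ≈ᴹ 0ᴹ
      d-zero = ≈ᴹ-trans (*ₗ-distribʳ g c _) (≈ᴹ-trans (+ᴹ-congʳ e)
        (≈ᴹ-trans (≈ᴹ-sym (*ₗ-distribʳ g d _)) (≈ᴹ-trans (*ₗ-congʳ (F.-‿inverseʳ d)) (*ₗ-zeroˡ g))))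

    coefficient : (N : Mod F) (d : Linear (raw N) (raw M)) {g : Carrierᴹ} → ¬ (g ≈ᴹ 0ᴹ) →
                  (∀ x → Member (Multiples M g) (fun d x)) → Linear (raw N) (raw (unit F))
    coefficient N d {g} g≉0 mult = mkLinear {M = N} {unit F} (λ x → proj₁ (mult x))
      (λ {x} {y} p → cancel (≈ᴹ-trans (≈ᴹ-sym (eq x)) (≈ᴹ-trans (d.⟦⟧-cong p) (eq y))))
      (λ x y → cancel (≈ᴹ-trans (≈ᴹ-sym (eq _)) (≈ᴹ-trans (d.+ᴹ-homo x y)
        (≈ᴹ-trans (+ᴹ-cong (eq x) (eq y)) (≈ᴹ-sym (*ₗ-distribʳ g _ _))))))
      (λ r x → cancel (≈ᴹ-trans (≈ᴹ-sym (eq _)) (≈ᴹ-trans (d.*ₗ-homo r x)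
        (≈ᴹ-trans (*ₗ-congˡ (eq x)) (≈ᴹ-sym (*ₗ-assoc r _ g))))))
      where
      module d = Linear d
      eq : ∀ x → d.fun x ≈ᴹ proj₁ (mult x) *ₗ g
      eq x = proj₂ (mult x)
      cancel : ∀ {c d} → c *ₗ g ≈ᴹ d *ₗ g → c F.≈ d
      cancel = *ₗ-cancelʳ g≉0 _ _

  module _ (W : Mod F) where
    private
      module W = LeftModule W

    -- Split modulo the first generator g₀; the defect of the section is a multiple of g₀,
    -- with a coefficient that is unique, hence linear, when g₀ ≠ 0.
    section-span : ∀ r (V : Mod F) (g : Fin r → LeftModule.Carrierᴹ V) → (∀ v → Member (Span V g) v) →
      (q : Linear (raw W) (raw V)) → (∀ v → ∃ λ w → LeftModule._≈ᴹ_ V (fun q w) v) → Section W V q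
    section-span zero V g gen q surj = zeroMap V W , λ v →
      V.≈ᴹ-trans (Linear.0ᴹ-homo q) (V.≈ᴹ-sym (proj₂ (gen v)))
      where module V = LeftModule V
    section-span (suc r) V g gen q surj = adjust (em {g₀ V.≈ᴹ V.0ᴹ})
      where
      module V = LeftModule V
      module VG = AdditiveGroup V
      g₀ = g zero
      V′ = V / Multiples V g₀
      q′ = composite W V V′ (quotientMap V (Multiples V g₀)) q
      s₀ : Section W V′ q′
      s₀ = section-span r V′ (g ∘ suc)
        (λ v → let c , e = gen v in c ∘ suc , c zero ,
          V.≈ᴹ-trans (V.+ᴹ-congʳ (V.≈ᴹ-trans e (V.+ᴹ-comm _ _)))
            (V.≈ᴹ-trans (V.+ᴹ-assoc _ _ _) (V.≈ᴹ-trans (V.≈ᴹ-sym (V.+ᴹ-assoc _ _ _)) (VG.xyx⁻¹≈y _ _))))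
        q′ (λ v → let w , e = surj v in w , ≈⇒≈/ V (Multiples V g₀) e)
      s′ : Linear (raw V) (raw W)
      s′ = composite V V′ W (proj₁ s₀) (quotientMap V (Multiples V g₀))
      d : Linear (raw V) (raw V)
      d = sumMap V V (composite V W V q s′) (negation V)
      w₀ = proj₁ (surj g₀)
      adjust : Dec (g₀ V.≈ᴹ V.0ᴹ) → Section W V q
      adjust (yes g₀≈0) = s′ , λ v → let c , e = proj₂ s₀ v in VG.x∙y⁻¹≈ε⇒x≈y _ _
        (V.≈ᴹ-trans e (V.≈ᴹ-trans (V.*ₗ-congˡ g₀≈0) (V.*ₗ-zeroʳ c)))
      adjust (no g₀≉0) = sumMap V W s′ (composite V W W (negation W) (composite V (unit F) W ·w₀ λᵛ)) , λ v →
        let open V; c , e = proj₂ s₀ v in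
        ≈ᴹ-trans (map-sub W V q _ _) (≈ᴹ-trans (+ᴹ-congˡ (-ᴹ‿cong
          (≈ᴹ-trans (Linear.*ₗ-homo q c w₀) (≈ᴹ-trans (*ₗ-congˡ (proj₂ (surj g₀))) (≈ᴹ-sym e)))))
          (a-[a-b] _ v))
        where
        λᵛ = coefficient V V d g₀≉0 (proj₂ s₀)
        ·w₀ : Linear (raw (unit F)) (raw W)
        ·w₀ = mkLinear {M = unit F} {W} (W._*ₗ w₀) W.*ₗ-congʳ (W.*ₗ-distribʳ w₀) (λ r c → W.*ₗ-assoc r c w₀)
        a-[a-b] : ∀ a b → _-ᴹ′_ (raw V) a (_-ᴹ′_ (raw V) a b) V.≈ᴹ b
        a-[a-b] a b = V.≈ᴹ-trans (V.+ᴹ-congˡ (VG.⁻¹-anti-homo‿- a b))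
          (V.≈ᴹ-trans (V.≈ᴹ-sym (V.+ᴹ-assoc a b _)) (VG.xyx⁻¹≈y a b))

    abstract
      section : (V : Mod F) → FG V → (q : Linear (raw W) (raw V)) →
                (∀ v → ∃ λ w → LeftModule._≈ᴹ_ V (fun q w) v) → Section W V q
      section V (r , g , gen) = section-span r V g gen

  -- w ↦ w − s(w̄), for a section s of W → W / U
  abstract
    retraction : (W : Mod F) → FG W → (U : Submodule (raw W)) →
      Σ (Linear (raw W) (raw W)) λ ρ → (∀ w → Member U (fun ρ w)) ×
        (∀ {w} → Member U w → LeftModule._≈ᴹ_ W (fun ρ w) w)
    retraction W fg U =
      let s , split = section W (W / U) fg/ (quotientMap W U) (λ w → w , ≈⇒≈/ W U ≈ᴹ-refl)
          s′ = composite W (W / U) W s (quotientMap W U)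
      in sumMap W W (identityMap W) (composite W W W (negation W) s′)
       , (λ w → U.resp (⁻¹-anti-homo‿- _ _) (U.-‿closed (split w)))
       , λ w∈ → ≈ᴹ-trans (+ᴹ-congˡ (≈ᴹ-trans (-ᴹ‿cong (≈ᴹ-trans
           (Linear.⟦⟧-cong s (∈⇒≈/0 W U w∈)) (Linear.0ᴹ-homo s))) ε⁻¹≈ε)) (+ᴹ-identityʳ _)
      where
      open LeftModule W
      open AdditiveGroup W
      module U = Submodule U
      fg/ : FG (W / U)
      fg/ = surjective-FG W (W / U) (quotientMap W U) (λ w → w , ≈⇒≈/ W U ≈ᴹ-refl) fg

  -- The retraction of the ambient span onto `U` is surjective, so the images of the spanning
  -- vectors generate `U`. No basis has to be extracted.
  subspace-FG : (M : Mod F) (U : Submodule (raw M)) → Bounded M (Member U) → FG (asModule M U)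
  subspace-FG M U (r , g , U⊆) = surjective-FG W (asModule M U) toU
    (λ { (u , u∈) → (u , U⊆ u∈) , proj₂ (proj₂ ret) u∈ }) (span-FG M g)
    where
    open LeftModule M
    W = asModule M (Span M g)
    ret = retraction W (span-FG M g) (within M (Span M g) U)
    toU : Linear (raw W) (raw (asModule M U))
    toU = mkLinear {M = W} {asModule M U} (λ w → proj₁ (fun (proj₁ ret) w) , proj₁ (proj₂ ret) w)
      ρ.⟦⟧-cong ρ.+ᴹ-homo ρ.*ₗ-homo
      where module ρ = Linear (proj₁ ret)

  -- If φ² = ψ δ and ψ intertwines φ̄ with φ, then φ ^ (q + 2) = ψ φ̄ ^ q δ.
  finitePotent-transfer : (M W : Mod F) (φ : Linear (raw M) (raw M)) (φ̄ : Linear (raw W) (raw W))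
    (ψ : Linear (raw W) (raw M)) (δ : LeftModule.Carrierᴹ M → LeftModule.Carrierᴹ W) →
    (∀ x → LeftModule._≈ᴹ_ M (fun ψ (δ x)) (fun φ (fun φ x))) →
    (∀ w → LeftModule._≈ᴹ_ M (fun ψ (fun φ̄ w)) (fun φ (fun ψ w))) →
    FinitePotent F W φ̄ → FinitePotent F M φ
  -- `IsFinitePotent` stores the exponent minus one, so the power of φ used here is the (q + 3)-rd.
  -- Its image is only placed inside the span of the vectors ψ(gᵢ), which suffices over a field.
  finitePotent-transfer M W φ φ̄ ψ δ ψδ≈φφ ψφ̄≈φψ (potent (q , r , g , gen)) = potent (suc (suc q) , subspace-FG M
    (image M M (φ ^ᴹ suc (suc (suc q))) (whole (raw M)))
    (r , (λ i → fun ψ (proj₁ (g i))) , λ { (x , _ , e) →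
      Submodule.resp (Span M (λ i → fun ψ (proj₁ (g i))))
        (≈ᴹ-trans (intertwine (suc q) (δ x)) (≈ᴹ-trans (^-cong (suc q) (ψδ≈φφ x)) (≈ᴹ-trans (^-φφ (suc q) x) e)))
        (spanned (δ x)) }))
    where
    open LeftModule M
    open SemiringOps (RawRing.rawSemiring (Ring.rawRing (End M))) using () renaming (_^_ to _^ᴹ_)
    open SemiringOps (RawRing.rawSemiring (Ring.rawRing (End W))) using () renaming (_^_ to _^ᵂ_)
    ^-cong : ∀ k {x y} → x ≈ᴹ y → fun (φ ^ᴹ k) x ≈ᴹ fun (φ ^ᴹ k) y
    ^-cong k = Linear.⟦⟧-cong (φ ^ᴹ k)
    intertwine : ∀ k w → fun ψ (fun (φ̄ ^ᵂ k) w) ≈ᴹ fun (φ ^ᴹ k) (fun ψ w)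
    intertwine zero    w = ≈ᴹ-refl
    intertwine (suc k) w = ≈ᴹ-trans (ψφ̄≈φψ (fun (φ̄ ^ᵂ k) w)) (Linear.⟦⟧-cong φ (intertwine k w))
    ^-φφ : ∀ k x → fun (φ ^ᴹ k) (fun φ (fun φ x)) ≈ᴹ fun (φ ^ᴹ suc (suc k)) x
    ^-φφ zero    x = ≈ᴹ-refl
    ^-φφ (suc k) x = Linear.⟦⟧-cong φ (^-φφ k x)
    Im : Submodule (raw W)
    Im = image W W (φ̄ ^ᵂ suc q) (whole (raw W))
    spanned : ∀ w → Member (Span M (λ i → fun ψ (proj₁ (g i)))) (fun ψ (fun (φ̄ ^ᵂ suc q) w))
    spanned w = let c , e = gen (fun (φ̄ ^ᵂ suc q) w , w , _ , LeftModule.≈ᴹ-refl W) in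
      map-span W M ψ {g = λ i → proj₁ (g i)} (c , LeftModule.≈ᴹ-trans W e (asModule-combination W Im c g))

-- Rings of 𝕜-linear operators and their two-sided ideals, over all pairs of modules.

module _ {𝕜 R : CRing ℓ} (ι : RingHom 𝕜 R) where

  Op : Mod R → Mod R → Set ℓ
  Op M N = Linear (M ↾ ι) (N ↾ ι)

  -- A condition for every pair of modules at once, because the recursive definition of E leaves the
  -- module K for varying subquotients.
  OpFamily : Set (lsuc (lsuc ℓ))
  OpFamily = ∀ M N → Pred (Op M N) (lsuc ℓ)

  scalarOp : ∀ M N → Linear (raw M) (raw N) → Op M N
  scalarOp M N f = mkLinear {M = restrict ι M} {restrict ι N} f.fun f.⟦⟧-cong f.+ᴹ-homo (λ r → f.*ₗ-homo _)
    where module f = Linear f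

  -- Sums and composites enter through pointwise equations, so that in the proofs operators stay variables.
  record IsOperatorIdeal (E I : OpFamily) : Set (lsuc ℓ) where
    field
      resp  : ∀ M N {f g : Op M N} → (∀ x → LeftModule._≈ᴹ_ N (fun f x) (fun g x)) → I M N f → I M N g
      zero∈ : ∀ M N {f : Op M N} → FG M → FG N → (∀ x → LeftModule._≈ᴹ_ N (fun f x) (LeftModule.0ᴹ N)) → I M N f
      add∈  : ∀ M N {f g h : Op M N} →
              (∀ x → LeftModule._≈ᴹ_ N (LeftModule._+ᴹ_ N (fun f x) (fun g x)) (fun h x)) →
              I M N f → I M N g → I M N h
      ∘∈ˡ   : ∀ M N P {f : Op M N} {g : Op N P} {h : Op M P} → FG M → FG N → FG P →
              (∀ x → LeftModule._≈ᴹ_ P (fun g (fun f x)) (fun h x)) → E N P g → I M N f → I M P h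
      ∘∈ʳ   : ∀ M N P {f : Op M N} {g : Op N P} {h : Op M P} → FG M → FG N → FG P →
              (∀ x → LeftModule._≈ᴹ_ P (fun g (fun f x)) (fun h x)) → I N P g → E M N f → I M P h

  -- Containing every `R`-linear map provides the identity and the multiplications and, one level
  -- up, the splittings of subquotients. Closure under sums and composition is the ideal property of
  -- `E` in itself.
  record IsOperatorRing (E : OpFamily) : Set (lsuc ℓ) where
    field
      linear∈ : ∀ M N (f : Linear (raw M) (raw N)) {g : Op M N} →
                (∀ x → LeftModule._≈ᴹ_ N (fun f x) (fun g x)) → E M N g
      isIdeal : IsOperatorIdeal E E

  module _ {E I : OpFamily} (isRing : IsOperatorRing E) (isIdeal : IsOperatorIdeal E I) where
    open IsOperatorRing isRing using (linear∈)
    open IsOperatorIdeal isIdeal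

    -- This moves membership from one pair of modules to another: linear maps lie in `E`, and `I`
    -- absorbs `E` on both sides.
    sandwich : ∀ M M′ N N′ → FG M → FG M′ → FG N → FG N′ →
        (u : Linear (raw M′) (raw M)) (v : Linear (raw N) (raw N′)) →
               ∀ {f g} → (∀ x → LeftModule._≈ᴹ_ N′ (fun v (fun f (fun u x))) (fun g x)) →
               I M N f → I M′ N′ g
    sandwich M M′ N N′ fgM fgM′ fgN fgN′ u v {f} {g} p f∈ =
      ∘∈ˡ M′ N N′ {fu} {scalarOp N N′ v} {g} fgM′ fgN fgN′ p (linear∈ N N′ v {scalarOp N N′ v} (λ _ → ≈ᴹ-refl N′))
        (∘∈ʳ M′ M N {scalarOp M′ M u} {f} {fu} fgM′ fgM fgN (λ _ → ≈ᴹ-refl N) f∈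
          (linear∈ M′ M u {scalarOp M′ M u} (λ _ → ≈ᴹ-refl M)))
      where
      open LeftModule using (≈ᴹ-refl)
      fu : Op M′ N
      fu = composite (restrict ι M′) (restrict ι M) (restrict ι N) f (scalarOp M′ M u)

-- Complete discrete valuation rings: powers of a uniformizer, congruences and limits.

module DVR {O : CRing ℓ} (isCompleteDVR : IsCompleteDVR O) (em : ExcludedMiddle ℓ) where
  open CommutativeRing O
  open IsCompleteDVR isCompleteDVR
  open SemiringOps (RawRing.rawSemiring rawRing) using (_^_) public
  open RingProperties ring
  open Solver commutativeSemiring using (solve; _:=_; _:+_; _:*_)

  t : Carrier
  t = proj₁ (principal 𝔪)

  t∈𝔪 : Member 𝔪 t
  t∈𝔪 = proj₁ (proj₂ (principal 𝔪))

  𝔪⇒t∣ : ∀ {x} → Member 𝔪 x → ∃ λ r → x ≈ r * t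
  𝔪⇒t∣ = proj₂ (proj₂ (principal 𝔪)) _

  t∣⇒𝔪 : ∀ r → Member 𝔪 (r * t)
  t∣⇒𝔪 r = Submodule.*-closed 𝔪 r t∈𝔪

  t≉0 : ¬ (t ≈ 0#)
  t≉0 t≈0 = let x , x∈𝔪 , x≉0 = notField ; r , e = 𝔪⇒t∣ x∈𝔪 in
    x≉0 (trans e (trans (*-congˡ t≈0) (zeroʳ r)))

  t-cancel : ∀ x y → x * t ≈ y * t → x ≈ y
  t-cancel x y e with proj₂ isDomain (x - y) t
                        (trans ([y-z]x≈yx-zx t x y) (x≈y⇒x∙y⁻¹≈ε e))
  ... | inj₁ p = x∙y⁻¹≈ε⇒x≈y x y p
  ... | inj₂ p = contradiction p t≉0

  ⟨t^_⟩ : ℕ → Ideal O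
  ⟨t^ m ⟩ = Multiples (unit O) (t ^ m)

  Power⇒t^∣ : ∀ i {x} → Power O 𝔪 i x → Member ⟨t^ i ⟩ x
  Power⇒t^∣ zero    {x} _ = x , sym (*-identityʳ x)
  Power⇒t^∣ (suc i) (r , g , g∈ , c , e) = Submodule.resp ⟨t^ suc i ⟩ (sym e)
    (combination-∈ (unit O) ⟨t^ suc i ⟩ c λ j →
      let a , b , a∈ , b∈ , g≈ab = g∈ j
          x , a≈ = 𝔪⇒t∣ a∈
          y , b≈ = Power⇒t^∣ i b∈
      in x * y , trans g≈ab (trans (*-cong a≈ b≈)
           (solve 4 (λ x t y u → (x :* t) :* (y :* u) := (x :* y) :* (t :* u)) refl x t y (t ^ i))))

  t^∣⇒Power : ∀ i {x} → Member ⟨t^ i ⟩ x → Power O 𝔪 i x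
  t^∣⇒Power zero    _       = _
  t^∣⇒Power (suc i) (r , e) = 1 , (λ _ → t * t ^ i)
    , (λ _ → t , t ^ i , t∈𝔪 , t^∣⇒Power i (1# , sym (*-identityˡ _)) , refl)
    , (λ _ → r) , trans e (sym (+-identityʳ _))

  abstract
    -- The powers of 𝔪 intersect in 0, so a nonzero `x` lies outside some ⟨tⁱ⟩; dividing by `t`
    -- fewer than i times then leaves a unit.
    nonzero⇒∣t^ : ∀ {x} → ¬ (x ≈ 0#) → ∃₂ λ m r → t ^ m ≈ r * x
    nonzero⇒∣t^ {x} x≉0 with em {∃ λ i → ¬ Member ⟨t^ i ⟩ x}
    ... | no ¬p = contradiction
      (proj₁ complete x (λ i → t^∣⇒Power i (decidable-stable em (λ q → ¬p (i , q))))) x≉0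
    ... | yes (i , p) = bounded i p
      where
      bounded : ∀ i {x} → ¬ Member ⟨t^ i ⟩ x → ∃₂ λ m r → t ^ m ≈ r * x
      bounded zero    {x} p = contradiction (x , sym (*-identityʳ x)) p
      bounded (suc i) {x} p with em {IsUnit O x}
      ... | yes (y , e) = 0 , y , trans (sym e) (*-comm x y)
      ... | no ¬unit =
        let x′ , x≈x′t = 𝔪⇒t∣ (nonunit⇒𝔪 x ¬unit)
            m , r , e = bounded i (λ { (s , q) → p (s , trans x≈x′t (trans (*-congʳ q)
              (solve 3 (λ s u t → (s :* u) :* t := s :* (t :* u)) refl s (t ^ i) t))) })
        in suc m , r , trans (*-congˡ e) (trans
             (solve 3 (λ t r x → t :* (r :* x) := r :* (x :* t)) refl t r x′) (*-congˡ (sym x≈x′t)))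

  module Mod^ (m : ℕ) = CommutativeRing (O /ʳ ⟨t^ m ⟩)

  infix 4 _≡_[_]
  _≡_[_] : Carrier → Carrier → ℕ → Set ℓ
  x ≡ y [ m ] = Mod^._≈_ m x y

  ≡-reflexive : ∀ m {x y} → x ≈ y → x ≡ y [ m ]
  ≡-reflexive m = ≈⇒≈/ (unit O) ⟨t^ m ⟩

  ≡-zero : ∀ x y → x ≡ y [ 0 ]
  ≡-zero x y = x - y , sym (*-identityʳ _)

  ≡-*t : ∀ m {x y} → x ≡ y [ m ] → x * t ≡ y * t [ suc m ]
  ≡-*t m {x} {y} (r , e) = r , trans (sym ([y-z]x≈yx-zx t x y)) (trans (*-congʳ e)
    (solve 3 (λ r u t → (r :* u) :* t := r :* (t :* u)) refl r (t ^ m) t))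

  separated : ∀ {x y} → (∀ m → x ≡ y [ m ]) → x ≈ y
  separated p = x∙y⁻¹≈ε⇒x≈y _ _ (proj₁ complete _ (λ i → t^∣⇒Power i (p i)))

  abstract
    limit : (a : ℕ → Carrier) → (∀ m → a (suc m) ≡ a m [ m ]) → ∃ λ x → ∀ m → x ≡ a m [ m ]
    limit a p = let x , q = proj₂ complete a (λ i → t^∣⇒Power i (p i)) in x , λ m → Power⇒t^∣ m (q m)

  -- Expansions Σ σ(aᵢ) tⁱ and operators acting on their digits.

  module Digits (σ : RingHom (O /ʳ 𝔪) O)
                (splits : ∀ x → CommutativeRing._≈_ (O /ʳ 𝔪) (⟦ σ ⟧ x) x) where
    private
      𝜿 : CRing _
      𝜿 = O /ʳ 𝔪
      module 𝜿 = CommutativeRing 𝜿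
      module σ = RingHom σ
      -- A residue class is represented by an element of the ring itself, so σ becomes a map of the
      -- carrier to itself, constant on classes modulo 𝔪. In the same way digits are ring elements
      -- below.
      s : Carrier → Carrier
      s = ⟦ σ ⟧

    x-σx∈𝔪 : ∀ x → Member 𝔪 (x - s x)
    x-σx∈𝔪 x = 𝜿.sym {s x} {x} (splits x)

    shift : Carrier → Carrier
    shift x = proj₁ (𝔪⇒t∣ (x-σx∈𝔪 x))

    expand : ∀ x → x ≈ s x + shift x * t
    expand x = trans (sym (trans (+-comm _ _) (//-rightDividesˡ (s x) x)))
      (+-congˡ (proj₂ (𝔪⇒t∣ (x-σx∈𝔪 x))))

    residue-unique : ∀ {x} c y → x ≈ s c + y * t → x 𝜿.≈ c
    residue-unique {x} c y e = 𝜿.trans {x} {s c + y * t} {c} (≈⇒≈/ (unit O) 𝔪 e)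
      (𝜿.trans {s c + y * t} {c + 0#} {c}
        (𝜿.+-cong {s c} {c} {y * t} {0#} (splits c) (∈⇒≈/0 (unit O) 𝔪 (t∣⇒𝔪 y))) (𝜿.+-identityʳ c))

    -- Such an `x` has residue `c`, so the constant terms agree and `t` cancels. The rules for
    -- `shift` that follow are obtained by exhibiting an expansion.
    shift-unique : ∀ {x} c y → x ≈ s c + y * t → shift x ≈ y
    shift-unique {x} c y e = t-cancel _ _ (+-cancelˡ (s c) _ _
      (trans (+-congʳ (σ.⟦⟧-cong (𝜿.sym {x} {c} (residue-unique c y e)))) (trans (sym (expand x)) e)))

    shift-cong : ∀ {x y} → x ≈ y → shift x ≈ shift y
    shift-cong {x} {y} e = shift-unique y (shift y) (trans e (expand y))

    shift-+ : ∀ x y → shift (x + y) ≈ shift x + shift y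
    shift-+ x y = shift-unique (x + y) _ (trans (+-cong (expand x) (expand y)) (trans
      (solve 5 (λ a b c d t → (a :+ b :* t) :+ (c :+ d :* t) := (a :+ c) :+ (b :+ d) :* t) refl
        (s x) (shift x) (s y) (shift y) t)
      (+-congʳ (sym (σ.+-homo x y)))))

    shift-σ* : ∀ c x → shift (s c * x) ≈ s c * shift x
    shift-σ* c x = shift-unique (c * x) _ (trans (*-congˡ (expand x)) (trans
      (solve 4 (λ a b c t → a :* (b :+ c :* t) := a :* b :+ (a :* c) :* t) refl (s c) (s x) (shift x) t)
      (+-congʳ (sym (σ.*-homo c x)))))

    σ0+ : ∀ y → y ≈ s 0# + y
    σ0+ y = sym (trans (+-congʳ σ.0#-homo) (+-identityˡ y))

    shift-*t : ∀ x → shift (x * t) ≈ x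
    shift-*t x = shift-unique 0# x (σ0+ _)

    module _ (e : Carrier → Carrier) where

      -- Σᵢ σ(aᵢ) tⁱ ↦ Σ σ(e(aᵢ)) tⁱ, summed over i < m
      apply : ℕ → Carrier → Carrier
      apply zero    x = 0#
      apply (suc m) x = s (e x) + apply m (shift x) * t

      module _ (e-cong : ∀ {x y} → x 𝜿.≈ y → e x 𝜿.≈ e y)
               (e-+ : ∀ x y → e (x + y) 𝜿.≈ e x + e y) where

        apply-cong : ∀ m {x y} → x ≈ y → apply m x ≈ apply m y
        apply-cong zero    p = refl
        apply-cong (suc m) p = +-cong (σ.⟦⟧-cong (e-cong (≈⇒≈/ (unit O) 𝔪 p)))
          (*-congʳ (apply-cong m (shift-cong p)))

        apply-+ : ∀ m x y → apply m (x + y) ≈ apply m x + apply m y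
        apply-+ zero    x y = sym (+-identityˡ 0#)
        apply-+ (suc m) x y = trans
          (+-cong (trans (σ.⟦⟧-cong (e-+ x y)) (σ.+-homo _ _))
            (*-congʳ (trans (apply-cong m (shift-+ x y)) (apply-+ m _ _))))
          (solve 5 (λ a b c d t → (a :+ b) :+ (c :+ d) :* t := (a :+ c :* t) :+ (b :+ d :* t)) refl
            (s (e x)) (s (e y)) (apply m (shift x)) (apply m (shift y)) t)

        -- The hypothesis concerns one scalar at a time: for a 𝕜-linear `e` it holds for scalars
        -- from 𝕜, for the identity it holds for all of 𝜿.
        apply-σ* : ∀ c → (∀ x → e (c * x) 𝜿.≈ c * e x) → ∀ m x → apply m (s c * x) ≈ s c * apply m x
        apply-σ* c e-* zero    x = sym (zeroʳ _)
        apply-σ* c e-* (suc m) x = trans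
          (+-cong (trans (σ.⟦⟧-cong (𝜿.trans {e (s c * x)} {e (c * x)} {c * e x}
                    (e-cong (𝜿.*-congʳ {x} {s c} {c} (splits c))) (e-* x))) (σ.*-homo c (e x)))
            (*-congʳ (trans (apply-cong m (shift-σ* c x)) (apply-σ* c e-* m _))))
          (solve 4 (λ a b c t → a :* b :+ (a :* c) :* t := a :* (b :+ c :* t)) refl
            (s c) (s (e x)) (apply m (shift x)) t)

        e0≈0 : e 0# 𝜿.≈ 0#
        e0≈0 = RingProperties.x+x≈x⇒x≈0 𝜿.ring (e 0#)
          (𝜿.trans {e 0# + e 0#} {e (0# + 0#)} {e 0#} (𝜿.sym {e (0# + 0#)} {e 0# + e 0#} (e-+ 0# 0#))
            (e-cong {0# + 0#} {0#} (𝜿.+-identityˡ 0#)))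

        -- The constant digit of x t is 0 and `e` preserves 0, so one digit more on the left matches
        -- the digits of `x`.
        apply-*t : ∀ m x → apply (suc m) (x * t) ≈ apply m x * t
        apply-*t m x = trans (+-cong
            (trans (σ.⟦⟧-cong {e (x * t)} {0#} (𝜿.trans {e (x * t)} {e 0#} {0#}
              (e-cong (∈⇒≈/0 (unit O) 𝔪 (t∣⇒𝔪 x))) e0≈0)) σ.0#-homo)
            (*-congʳ (apply-cong m (shift-*t x))))
          (+-identityˡ _)

        -- The additional digit stands in degree m, so the truncations converge.
        apply-suc : ∀ m x → apply (suc m) x ≡ apply m x [ m ]
        apply-suc zero    x = ≡-zero _ _
        apply-suc (suc m) x = Mod^.+-congˡ (suc m) {s (e x)} {apply (suc m) (shift x) * t} {apply m (shift x) * t}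
          (≡-*t m (apply-suc m (shift x)))

        -- Σᵢ σ(aᵢ) tⁱ ↦ Σᵢ σ(e(aᵢ)) tⁱ
        lifted : Carrier → Carrier
        lifted x = proj₁ (limit (λ m → apply m x) (λ m → apply-suc m x))

        lift-≡ : ∀ m x → lifted x ≡ apply m x [ m ]
        lift-≡ m x = proj₂ (limit (λ m → apply m x) (λ m → apply-suc m x)) m

        lift-cong : ∀ {x y} → x ≈ y → lifted x ≈ lifted y
        lift-cong {x} {y} p = separated λ m → Mod^.trans m {lifted x} {apply m x} {lifted y} (lift-≡ m x)
          (Mod^.trans m {apply m x} {apply m y} {lifted y} (≡-reflexive m (apply-cong m p))
            (Mod^.sym m {lifted y} {apply m y} (lift-≡ m y)))

        lift-unique : ∀ {x y} → (∀ m → apply m x ≡ y [ m ]) → lifted x ≈ y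
        lift-unique {x} {y} p = separated λ m → Mod^.trans m {lifted x} {apply m x} {y} (lift-≡ m x) (p m)

        lift-+ : ∀ x y → lifted (x + y) ≈ lifted x + lifted y
        lift-+ x y = lift-unique λ m → Mod^.trans m {apply m (x + y)} {apply m x + apply m y} {lifted x + lifted y}
          (≡-reflexive m (apply-+ m x y))
          (Mod^.sym m {lifted x + lifted y} {apply m x + apply m y}
            (Mod^.+-cong m {lifted x} {apply m x} {lifted y} {apply m y} (lift-≡ m x) (lift-≡ m y)))

        lift-σ* : ∀ c → (∀ x → e (c * x) 𝜿.≈ c * e x) → ∀ x → lifted (s c * x) ≈ s c * lifted x
        lift-σ* c e-* x = lift-unique λ m → Mod^.trans m {apply m (s c * x)} {s c * apply m x} {s c * lifted x}
          (≡-reflexive m (apply-σ* c e-* m x))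
          (Mod^.sym m {s c * lifted x} {s c * apply m x}
            (Mod^.*-congˡ m {s c} {lifted x} {apply m x} (lift-≡ m x)))

        lift-*t : ∀ x → lifted (x * t) ≈ lifted x * t
        lift-*t x = lift-unique λ where
          zero    → ≡-zero _ _
          (suc m) → Mod^.trans (suc m) {apply (suc m) (x * t)} {apply m x * t} {lifted x * t}
            (≡-reflexive (suc m) (apply-*t m x))
            (Mod^.sym (suc m) {lifted x * t} {apply m x * t} (≡-*t m (lift-≡ m x)))

        lift-*t^ : ∀ m x → lifted (t ^ m * x) ≈ t ^ m * lifted x
        lift-*t^ zero    x = trans (lift-cong (*-identityˡ x)) (sym (*-identityˡ _))
        lift-*t^ (suc m) x = trans (lift-cong (solve 3 (λ t u x → (t :* u) :* x := (u :* x) :* t) refl t (t ^ m) x))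
          (trans (lift-*t _) (trans (*-congʳ (lift-*t^ m x))
            (solve 3 (λ t u y → (u :* y) :* t := (t :* u) :* y) refl t (t ^ m) (lifted x))))

    apply-id : ∀ m x → apply id m x ≡ x [ m ]
    apply-id zero    x = ≡-zero _ _
    apply-id (suc m) x = Mod^.trans (suc m) {apply id (suc m) x} {s x + shift x * t} {x}
      (Mod^.+-congˡ (suc m) {s x} {apply id m (shift x) * t} {shift x * t} (≡-*t m (apply-id m (shift x))))
      (≡-reflexive (suc m) (sym (expand x)))

    apply-partition : ∀ e₁ e₂ → (∀ x → e₁ x + e₂ x 𝜿.≈ x) → ∀ m x → apply e₁ m x + apply e₂ m x ≡ x [ m ]
    apply-partition e₁ e₂ p zero    x = ≡-zero _ _
    apply-partition e₁ e₂ p (suc m) x = Mod^.trans (suc m)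
      {apply e₁ (suc m) x + apply e₂ (suc m) x} {s x + (a₁ + a₂) * t} {x}
      (≡-reflexive (suc m) (trans
        (solve 5 (λ a b c d t → (a :+ c :* t) :+ (b :+ d :* t) := (a :+ b) :+ (c :+ d) :* t) refl
          (s (e₁ x)) (s (e₂ x)) a₁ a₂ t)
        (+-congʳ (trans (sym (σ.+-homo _ _)) (σ.⟦⟧-cong {e₁ x + e₂ x} {x} (p x))))))
      (Mod^.trans (suc m) {s x + (a₁ + a₂) * t} {s x + shift x * t} {x}
        (Mod^.+-congˡ (suc m) {s x} {(a₁ + a₂) * t} {shift x * t} (≡-*t m (apply-partition e₁ e₂ p m (shift x))))
        (≡-reflexive (suc m) (sym (expand x))))
      where
      a₁ a₂ : Carrier
      a₁ = apply e₁ m (shift x)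
      a₂ = apply e₂ m (shift x)

    lift-partition : ∀ e₁ (c₁ : ∀ {x y} → x 𝜿.≈ y → e₁ x 𝜿.≈ e₁ y) (a₁ : ∀ x y → e₁ (x + y) 𝜿.≈ e₁ x + e₁ y)
                       e₂ (c₂ : ∀ {x y} → x 𝜿.≈ y → e₂ x 𝜿.≈ e₂ y) (a₂ : ∀ x y → e₂ (x + y) 𝜿.≈ e₂ x + e₂ y) →
                     (∀ x → e₁ x + e₂ x 𝜿.≈ x) → ∀ x → lifted e₁ c₁ a₁ x + lifted e₂ c₂ a₂ x ≈ x
    lift-partition e₁ c₁ a₁ e₂ c₂ a₂ p x = separated λ m →
      Mod^.trans m {lifted e₁ c₁ a₁ x + lifted e₂ c₂ a₂ x} {apply e₁ m x + apply e₂ m x} {x}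
        (Mod^.+-cong m {lifted e₁ c₁ a₁ x} {apply e₁ m x} {lifted e₂ c₂ a₂ x} {apply e₂ m x}
          (lift-≡ e₁ c₁ a₁ m x) (lift-≡ e₂ c₂ a₂ m x))
        (apply-partition e₁ e₂ p m x)

    abstract
      -- Since c g = σ(c) g + shift(c) (t g), the cyclic module on `g` is spanned over 𝜿 by g, t g,
      -- ..., tᵐ⁻¹ g.
      torsion-FG : (N : Mod O) → ∀ m → (∀ x → LeftModule._≈ᴹ_ N (LeftModule._*ₗ_ N (t ^ m) x) (LeftModule.0ᴹ N)) →
                   FG N → FG (restrict σ N)
      torsion-FG N m killed = restrict-FG σ N (λ g → cyclic m g (killed g))
        where
        open LeftModule N
        cyclic : ∀ m g → t ^ m *ₗ g ≈ᴹ 0ᴹ → Bounded (restrict σ N) (Member (Multiples N g))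
        cyclic zero g p = 0 , (λ ()) , λ { (c , e) → (λ ()) , ≈ᴹ-trans e (≈ᴹ-trans
          (*ₗ-congˡ (≈ᴹ-trans (≈ᴹ-sym (*ₗ-identityˡ g)) p)) (*ₗ-zeroʳ c)) }
        cyclic (suc m) g p =
          let r , h , q = bounded-+ (restrict σ N) (single g)
                (cyclic m (t *ₗ g) (≈ᴹ-trans (≈ᴹ-sym (*ₗ-assoc _ _ g)) (≈ᴹ-trans (*ₗ-congʳ (*-comm _ t)) p)))
          in r , h , λ { (c , e) → q (_ , _ , (c , ≈ᴹ-refl) , (shift c , ≈ᴹ-refl) ,
               ≈ᴹ-trans e (≈ᴹ-trans (*ₗ-congʳ (expand c)) (≈ᴹ-trans (*ₗ-distribʳ g _ _)
                 (+ᴹ-congˡ (*ₗ-assoc _ t g))))) }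
          where
          single : ∀ g → Bounded (restrict σ N) (Member (Multiples (restrict σ N) g))
          single g = 1 , (λ _ → g) , λ { (c , e) → (λ _ → c) , ≈ᴹ-trans e (≈ᴹ-sym (+ᴹ-identityʳ _)) }

    -- The model for the standard subquotients of K: multiplication by tᵃ identifies t⁻ᵃ𝒪 / tᵃ𝒪 with
    -- `Residues (a + a)`.
    Residues : ℕ → Mod 𝜿
    Residues m = restrict σ (unit O / ⟨t^ m ⟩)

    Residues-FG : ∀ m → FG (Residues m)
    Residues-FG m = torsion-FG (unit O / ⟨t^ m ⟩) m
      (λ x → ∈⇒≈/0 (unit O) ⟨t^ m ⟩ (x , *-comm _ x))
      (1 , (λ _ → 1#) , λ x → (λ _ → x) , ≡-reflexive m (sym (trans (+-identityʳ _) (*-identityʳ x))))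

    module _ {𝕜 : CRing ℓ} (ι𝜿 : RingHom 𝕜 𝜿) where
      module _ (e : Op ι𝜿 (unit 𝜿) (unit 𝜿)) where
        private
          module _ (m : ℕ) where

            digit₀ : Linear (raw (Residues (suc m))) (raw (unit 𝜿))
            digit₀ = mkLinear {M = Residues (suc m)} {unit 𝜿} id
              (λ { (r , p) → Submodule.resp 𝔪 (trans (solve 3 (λ r t u → (r :* u) :* t := r :* (t :* u)) refl r t
                  (t ^ m)) (sym p))
                               (t∣⇒𝔪 (r * t ^ m)) })
              (λ x y → 𝜿.refl {x + y}) (λ c x → 𝜿.*-congʳ {x} {s c} {c} (splits c))

            constant₀ : Linear (raw (unit 𝜿)) (raw (Residues (suc m)))
            constant₀ = mkLinear {M = unit 𝜿} {Residues (suc m)} s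
              (λ p → ≡-reflexive (suc m) (σ.⟦⟧-cong p)) (λ x y → ≡-reflexive (suc m) (σ.+-homo x y))
              (λ c x → ≡-reflexive (suc m) (σ.*-homo c x))

            shift′ : Linear (raw (Residues (suc m))) (raw (Residues m))
            shift′ = mkLinear {M = Residues (suc m)} {Residues m} shift shift-≡
              (λ x y → ≡-reflexive m (shift-+ x y)) (λ c x → ≡-reflexive m (shift-σ* c x))
              where
              shift-≡ : ∀ {x y} → x ≡ y [ suc m ] → shift x ≡ shift y [ m ]
              shift-≡ {x} {y} (r , p) = r , trans (+-congʳ (shift-unique {x} y (shift y + r * t ^ m) (begin
                x                                    ≈⟨ //-rightDividesˡ y x ⟨
                (x - y) + y                          ≈⟨ +-cong p (expand y) ⟩
                r * (t * t ^ m) + (s y + shift y * t) ≈⟨ solve 5 (λ r t u a b → r :* (t :* u) :+ (a :+ b :* t)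
                                                         := a :+ (b :+ r :* u) :* t) refl r t (t ^ m) (s y) (shift y) ⟩
                s y + (shift y + r * t ^ m) * t      ∎))) (xyx⁻¹≈y _ _)
                where open SetoidReasoning setoid

            timesT : Linear (raw (Residues m)) (raw (Residues (suc m)))
            timesT = mkLinear {M = Residues m} {Residues (suc m)} (_* t) (≡-*t m)
              (λ x y → ≡-reflexive (suc m) (distribʳ t x y)) (λ c x → ≡-reflexive (suc m) (*-assoc _ x t))

            viaDigit : Op ι𝜿 (Residues (suc m)) (Residues (suc m))
            viaDigit = composite (restrict ι𝜿 (Residues (suc m))) (restrict ι𝜿 (unit 𝜿))
                (restrict ι𝜿 (Residues (suc m)))
              (scalarOp ι𝜿 (unit 𝜿) (Residues (suc m)) constant₀)
              (composite (restrict ι𝜿 (Residues (suc m))) (restrict ι𝜿 (unit 𝜿)) (restrict ι𝜿 (unit 𝜿)) e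
                (scalarOp ι𝜿 (Residues (suc m)) (unit 𝜿) digit₀))

            viaShift : Op ι𝜿 (Residues m) (Residues m) → Op ι𝜿 (Residues (suc m)) (Residues (suc m))
            viaShift f = composite (restrict ι𝜿 (Residues (suc m))) (restrict ι𝜿 (Residues m))
                (restrict ι𝜿 (Residues (suc m)))
              (scalarOp ι𝜿 (Residues m) (Residues (suc m)) timesT)
              (composite (restrict ι𝜿 (Residues (suc m))) (restrict ι𝜿 (Residues m)) (restrict ι𝜿 (Residues m)) f
                (scalarOp ι𝜿 (Residues (suc m)) (Residues m) shift′))

        -- The same values as `apply`, but assembled from `e` by sums and by composition with the
        -- 𝜿-linear maps `digit₀`, `constant₀`, `shift′` and `timesT`. In this form membership in an
        -- ideal is inherited from `e`.
        applyOp : ∀ m → Op ι𝜿 (Residues m) (Residues m)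
        applyOp zero    = zeroMap (restrict ι𝜿 (Residues 0)) (restrict ι𝜿 (Residues 0))
        applyOp (suc m) = sumMap (restrict ι𝜿 (Residues (suc m))) (restrict ι𝜿 (Residues (suc m)))
          (viaDigit m) (viaShift m (applyOp m))

        applyOp-≡ : ∀ m x → fun (applyOp m) x ≡ apply (fun e) m x [ m ]
        applyOp-≡ zero    x = ≡-zero _ _
        applyOp-≡ (suc m) x = Mod^.+-congˡ (suc m) {s (fun e x)} {fun (applyOp m) (shift x) * t}
          {apply (fun e) m (shift x) * t} (≡-*t m (applyOp-≡ m (shift x)))

        module _ {E I : OpFamily ι𝜿} (isRing : IsOperatorRing ι𝜿 E) (isIdeal : IsOperatorIdeal ι𝜿 E I)
                 (e∈ : I (unit 𝜿) (unit 𝜿) e) where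
          open IsOperatorIdeal isIdeal

          applyOp-∈ : ∀ m → I (Residues m) (Residues m) (applyOp m)
          applyOp-∈ zero    = zero∈ (Residues 0) (Residues 0) {applyOp 0} (Residues-FG 0) (Residues-FG 0)
              (λ _ → ≡-zero _ _)
          applyOp-∈ (suc m) = add∈ (Residues (suc m)) (Residues (suc m)) {viaDigit m} {viaShift m (applyOp m)}
              {applyOp (suc m)}
            (λ x → ≡-reflexive (suc m) refl)
            (sandwich ι𝜿 isRing isIdeal (unit 𝜿) (Residues (suc m)) (unit 𝜿) (Residues (suc m)) (unit-FG 𝜿)
                (Residues-FG (suc m)) (unit-FG 𝜿) (Residues-FG (suc m))
              (digit₀ m) (constant₀ m) {e} {viaDigit m} (λ x → ≡-reflexive (suc m) refl) e∈)
            (sandwich ι𝜿 isRing isIdeal (Residues m) (Residues (suc m)) (Residues m) (Residues (suc m))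
              (Residues-FG m) (Residues-FG (suc m)) (Residues-FG m) (Residues-FG (suc m)) (shift′ m) (timesT m)
                  {applyOp m} {viaShift m (applyOp m)}
              (λ x → ≡-reflexive (suc m) refl) (applyOp-∈ m))

fieldOf : ∀ {n} {K : CRing ℓ} → LocalField n K → IsField K
fieldOf (dim0 p)     = p
fieldOf (step p _ _) = p

-- From the residue field 𝜿 up to K: lattices and their subquotients.

module StepTheory (em : ExcludedMiddle ℓ) {𝕜 K : CRing ℓ} {isField : IsField K} {n : ℕ}
                  (V : CompleteDVRIn K) (L : LocalField n (CompleteDVRIn.𝜿 V))
                  (s : StructureMap 𝕜 K (step isField V L))
                  (T : LinearTopology (unit K ↾ StructureMap.ι s))
                  (lifting : Lift₁.Lifting V L s T) where
  open Step V L s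
  open Lift₁.Lifting lifting using (σ; isAlgHom; splits)
  module D = DVR {O = 𝒪} isCompleteDVR em
  module K = CommutativeRing K
  module 𝜿 = CommutativeRing 𝜿
  module 𝒪 = CommutativeRing 𝒪
  module Dig = D.Digits σ splits
  open D using (_^_; t)


  σK : RingHom 𝜿 K
  σK = inclusion ∘ʳ σ

  over𝒪 : Mod K → Mod 𝒪
  over𝒪 = restrict inclusion

  infix 4 _∈ᴸ_ _⊆ᴸ_
  _∈ᴸ_ : {M : Mod K} → LeftModule.Carrierᴹ M → Lattice V M → Set ℓ
  x ∈ᴸ A = Member (Lattice.submodule A) x

  _⊆ᴸ_ : {M : Mod K} → Lattice V M → Lattice V M → Set ℓ
  _⊆ᴸ_ {M} A B = ∀ {x} → _∈ᴸ_ {M} x A → _∈ᴸ_ {M} x B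

  t^_ : ℕ → K.Carrier
  t^ m = proj₁ (t ^ m)

  t^-+ : ∀ m k → t ^ (m ℕ.+ k) 𝒪.≈ (t ^ m) 𝒪.* (t ^ k)
  t^-+ = ^-homo-* t
    where open SemiringExp 𝒪.semiring using (^-homo-*)

  abstract
    -- Write x = a / b; the denominator divides some tᵐ, say tᵐ = r b, and then tᵐ x = r a.
    clearDenominator : ∀ x → ∃ λ m → Contains (t^ m K.* x)
    clearDenominator x =
      let a , b , a∈ , b∈ , b≉0 , xb≈a = fraction x
          m , (r , r∈) , e = D.nonzero⇒∣t^ {b , b∈} b≉0
      in m , Subring.resp subring
        (K.trans (K.*-congˡ (K.sym xb≈a)) (K.trans (solve 3 (λ r x b → r :* (x :* b) := (r :* b) :* x) K.refl r x b)
          (K.*-congʳ (K.sym e))))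
        (Subring.*-closed subring r∈ a∈)
      where open Solver K.commutativeSemiring using (solve; _:=_; _:*_)

  module _ (M : Mod K) (B : Lattice V M) where
    private
      module B = Submodule (Lattice.submodule B)
    open LeftModule (over𝒪 M)

    raise : ∀ k m {x} → B.Member ((t ^ m) *ₗ x) → B.Member ((t ^ (k ℕ.+ m)) *ₗ x)
    raise k m {x} p = B.resp (≈ᴹ-trans (≈ᴹ-sym (*ₗ-assoc (t ^ k) (t ^ m) x))
        (LeftModule.*ₗ-congʳ M (K.sym (t^-+ k m))))
      (B.*-closed (t ^ k) p)

    raiseʳ : ∀ m k {x} → B.Member ((t ^ m) *ₗ x) → B.Member ((t ^ (m ℕ.+ k)) *ₗ x)
    raiseʳ m k {x} p = subst (λ j → B.Member ((t ^ j) *ₗ x)) (ℕ.+-comm k m) (raise k m p)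

    eventually∈ : ∀ x → ∃ λ m → B.Member ((t ^ m) *ₗ x)
    eventually∈ x = let r , g , g∈ , c , e = Lattice.generates B x ; m , p = go r c g g∈ in
      m , B.resp (*ₗ-congˡ {t ^ m} (≈ᴹ-sym e)) p
      where
      go : ∀ r c (g : Fin r → Carrierᴹ) → (∀ i → B.Member (g i)) →
           ∃ λ m → B.Member ((t ^ m) *ₗ combination M c g)
      go zero    c g g∈ = 0 , B.resp (≈ᴹ-sym (*ₗ-zeroʳ (t ^ 0))) B.0-closed
      go (suc r) c g g∈ =
        let m , p = clearDenominator (c zero)
            k , q = go r (c ∘ suc) (g ∘ suc) (g∈ ∘ suc)
        in m ℕ.+ k , B.resp (≈ᴹ-sym (*ₗ-distribˡ (t ^ (m ℕ.+ k)) _ _)) (B.+-closed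
             (raiseʳ m k (B.resp (LeftModule.*ₗ-assoc M (t^ m) (c zero) (g zero)) (B.*-closed (_ , p) (g∈ zero))))
             (raise m k q))

  abstract
    -- `A` has finitely many generators and `B` spans `N` over K, so one power of `t` brings the
    -- images of all generators into `B`. With `f` the identity this is the commensurability of
    -- lattices.
    absorb : ∀ (M N : Mod K) (f : Linear (raw (over𝒪 M)) (raw (over𝒪 N))) (A : Lattice V M) (B : Lattice V N) →
      ∃ λ m → ∀ {x} → _∈ᴸ_ {M} x A → _∈ᴸ_ {N} (LeftModule._*ₗ_ (over𝒪 N) (t ^ m) (fun f x)) B
    absorb M N f A B =
      let r , g , gen = Lattice.finite A ; m , p = go r (proj₁ ∘ g) in
      m , λ {x} x∈ → let c , e = gen (x , x∈) in
        B.resp (*ₗ-congˡ {t ^ m} (f.⟦⟧-cong (M.≈ᴹ-sym (M.≈ᴹ-trans e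
          (asModule-combination (over𝒪 M) (Lattice.submodule A) c g))))) (p c)
      where
      module B = Submodule (Lattice.submodule B)
      module M = LeftModule (over𝒪 M)
      module f = Linear f
      open LeftModule (over𝒪 N)
      go : ∀ r (g : Fin r → M.Carrierᴹ) →
           ∃ λ m → ∀ c → B.Member ((t ^ m) *ₗ fun f (combination (over𝒪 M) c g))
      go zero    g = 0 , λ c → B.resp (≈ᴹ-sym (≈ᴹ-trans (*ₗ-congˡ {t ^ 0} f.0ᴹ-homo) (*ₗ-zeroʳ (t ^ 0)))) B.0-closed
      go (suc r) g =
        let m , p = eventually∈ N B (fun f (g zero))
            k , q = go r (g ∘ suc)
        in m ℕ.+ k , λ c → B.resp
          (≈ᴹ-sym (≈ᴹ-trans (*ₗ-congˡ {t ^ (m ℕ.+ k)} (f.+ᴹ-homo _ _)) (*ₗ-distribˡ (t ^ (m ℕ.+ k)) _ _)))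
          (B.+-closed
            (raiseʳ N B m k (B.resp
              (≈ᴹ-trans (≈ᴹ-sym (*ₗ-assoc (c zero) (t ^ m) _))
                  (≈ᴹ-trans (LeftModule.*ₗ-congʳ N (𝒪.*-comm (c zero) (t ^ m)))
                (≈ᴹ-trans (*ₗ-assoc (t ^ m) (c zero) _) (*ₗ-congˡ {t ^ m} (≈ᴹ-sym (f.*ₗ-homo (c zero) _))))))
              (B.*-closed (c zero) p)))
            (raise N B m k (q (c ∘ suc))))

  as𝒪 : ∀ M N → Linear (raw M) (raw N) → Linear (raw (over𝒪 M)) (raw (over𝒪 N))
  as𝒪 = scalarOp inclusion

  as𝜿 : ∀ M N → Linear (raw M) (raw N) → Linear (M ↾ σK) (N ↾ σK)
  as𝜿 = scalarOp σK

  -- c⁻¹ A, where d = c⁻¹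
  scale : (M : Mod K) (c d : K.Carrier) → c K.* d K.≈ K.1# → Lattice V M → Lattice V M
  scale M c d cd≈1 A = record
    { submodule = preimage (over𝒪 M) (over𝒪 M) (as𝒪 M M (multiply K M c)) (submodule A)
    ; finite = let r , g , gen = finite A in
        r , (λ i → d *ₗ proj₁ (g i) , A.resp (≈ᴹ-sym (cd* (proj₁ (g i)))) (proj₂ (g i))) ,
        λ { (x , cx∈) → let a , e = gen (_ , cx∈) in a ,
          ≈ᴹ-trans (≈ᴹ-sym (dc* x)) (≈ᴹ-trans (*ₗ-congˡ (≈ᴹ-trans e
            (asModule-combination (over𝒪 M) (submodule A) a g)))
            (≈ᴹ-trans (map-combination (over𝒪 M) (over𝒪 M) (as𝒪 M M (multiply K M d)) a (proj₁ ∘ g))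
              (≈ᴹ-sym (asModule-combination (over𝒪 M)
                (preimage (over𝒪 M) (over𝒪 M) (as𝒪 M M (multiply K M c)) (submodule A)) a _)))) }
    ; generates = λ x → let r , g , g∈ , a , e = generates A (c *ₗ x) in
        r , (λ i → d *ₗ g i) , (λ i → A.resp (≈ᴹ-sym (cd* (g i))) (g∈ i)) , a ,
        ≈ᴹ-trans (≈ᴹ-sym (dc* x)) (≈ᴹ-trans (*ₗ-congˡ e) (map-combination M M (multiply K M d) a g)) }
    where
    open LeftModule M
    open Lattice
    module A = Submodule (submodule A)
    cd* : ∀ x → c *ₗ (d *ₗ x) ≈ᴹ x
    cd* x = ≈ᴹ-trans (≈ᴹ-sym (*ₗ-assoc c d x)) (≈ᴹ-trans (*ₗ-congʳ cd≈1) (*ₗ-identityˡ x))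
    dc* : ∀ x → d *ₗ (c *ₗ x) ≈ᴹ x
    dc* x = ≈ᴹ-trans (≈ᴹ-sym (*ₗ-assoc d c x)) (≈ᴹ-trans (*ₗ-congʳ (K.trans (K.*-comm d c) cd≈1)) (*ₗ-identityˡ x))

  someLattice : (M : Mod K) → FG M → Lattice V M
  someLattice M (r , g , gen) = record
    { submodule = Span (over𝒪 M) g
    ; finite    = span-FG (over𝒪 M) g
    ; generates = λ x → let c , e = gen x in r , g , generator∈Span (over𝒪 M) g , c , e }

  unitLattice : Lattice V (unit K)
  unitLattice = record
    { submodule = mkSubmodule (over𝒪 (unit K)) Contains (Subring.resp subring) (Subring.0-closed subring)
        (Subring.+-closed subring) (λ r → Subring.*-closed subring (proj₂ r))
    ; finite    = 1 , (λ _ → K.1# , Subring.1-closed subring) , λ x → (λ _ → x) ,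
        K.sym (K.trans (K.+-identityʳ _) (K.*-identityʳ _))
    ; generates = λ x → 1 , (λ _ → K.1#) , (λ _ → Subring.1-closed subring) , (λ _ → x) ,
        K.sym (K.trans (K.+-identityʳ _) (K.*-identityʳ _)) }

  t⁻¹ : K.Carrier
  t⁻¹ = proj₁ (proj₂ isField (proj₁ t) D.t≉0)

  t^-_ : ℕ → K.Carrier
  t^- zero  = K.1#
  t^- suc m = t⁻¹ K.* t^- m

  t^*t^- : ∀ m → (t^ m) K.* (t^- m) K.≈ K.1#
  t^*t^- zero    = K.*-identityˡ K.1#
  t^*t^- (suc m) = K.trans
    (solve 4 (λ t u v w → (t :* u) :* (v :* w) := (t :* v) :* (u :* w)) K.refl (proj₁ t) (t^ m) t⁻¹ (t^- m))
    (K.trans (K.*-cong (proj₂ (proj₂ isField (proj₁ t) D.t≉0)) (t^*t^- m)) (K.*-identityˡ K.1#))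
    where open Solver K.commutativeSemiring using (solve; _:=_; _:*_)

  t^-*t^ : ∀ m → (t^- m) K.* (t^ m) K.≈ K.1#
  t^-*t^ m = K.trans (K.*-comm _ _) (t^*t^- m)

  -- enlarge M m A is t⁻ᵐ A, and shrink M m A is tᵐ A
  enlarge shrink : (M : Mod K) → ℕ → Lattice V M → Lattice V M
  enlarge M m = scale M (t^ m) (t^- m) (t^*t^- m)
  shrink  M m = scale M (t^- m) (t^ m) (t^-*t^ m)

  module _ (M : Mod K) (m : ℕ) (A : Lattice V M) where
    private
      module A = Submodule (Lattice.submodule A)
    open LeftModule M

    enlarge-⊇ : _⊆ᴸ_ {M} A (enlarge M m A)
    enlarge-⊇ = A.*-closed (t ^ m)

    shrink-witness : ∀ {x} → x ∈ᴸ shrink M m A → x ≈ᴹ (t^ m) *ₗ ((t^- m) *ₗ x)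
    shrink-witness {x} _ = ≈ᴹ-sym (≈ᴹ-trans (≈ᴹ-sym (*ₗ-assoc (t^ m) (t^- m) x))
      (≈ᴹ-trans (*ₗ-congʳ (t^*t^- m)) (*ₗ-identityˡ x)))

    shrink-⊆ : _⊆ᴸ_ {M} (shrink M m A) A
    shrink-⊆ p = A.resp (≈ᴹ-sym (shrink-witness p)) (A.*-closed (t ^ m) p)

  module _ (M : Mod K) (A B : Lattice V M) where
    private
      identity𝒪 = identityMap (over𝒪 M)
      m = proj₁ (absorb M M identity𝒪 A B)

    -- Any lattice inside both serves. The multiple tᵐA is finitely generated because `A` is,
    -- whereas the intersection would call for a noetherian argument.
    meet : ∃ λ (C : Lattice V M) → _⊆ᴸ_ {M} C A × _⊆ᴸ_ {M} C B
    meet = shrink M m A , shrink-⊆ M m A , λ p → Submodule.resp (Lattice.submodule B)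
      (LeftModule.≈ᴹ-sym M (shrink-witness M m A p)) (proj₂ (absorb M M identity𝒪 A B) p)

    join : ∃ λ (C : Lattice V M) → _⊆ᴸ_ {M} A C × _⊆ᴸ_ {M} B C
    join = enlarge M m B , proj₂ (absorb M M identity𝒪 A B) , enlarge-⊇ M m B

  Rest : (M : Mod K) → Lattice V M → Lattice V M → Mod 𝜿
  Rest M A A′ = restrict σ (latticeQuotient V {M} A A′)

  abstract
    -- Some tᵐ carries `A` into `A′`, so the quotient is a finitely generated torsion module.
    Rest-FG : ∀ M A A′ → FG (Rest M A A′)
    Rest-FG M A A′ = Dig.torsion-FG (latticeQuotient V {M} A A′) (proj₁ ab)
      (λ { (x , x∈) → ∈⇒≈/0 MA A′in {_ , Submodule.*-closed (Lattice.submodule A) (t ^ proj₁ ab) x∈} (proj₂ ab x∈) })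
      (surjective-FG MA (MA / A′in) (quotientMap MA A′in) (λ x → x , ≈⇒≈/ MA A′in {x} {x} (LeftModule.≈ᴹ-refl M))
          (Lattice.finite A))
      where
      MA : Mod 𝒪
      MA = asModule (over𝒪 M) (Lattice.submodule A)
      A′in : Submodule (raw MA)
      A′in = within (over𝒪 M) (Lattice.submodule A) (Lattice.submodule A′)
      ab : ∃ λ m → ∀ {x} → _∈ᴸ_ {M} x A → _∈ᴸ_ {M} (LeftModule._*ₗ_ (over𝒪 M) (t ^ m) x) A′
      ab = absorb M M (identityMap (over𝒪 M)) A A′

  -- Linearity of `h` over 𝜿, through σ, is enough; this covers `polar`, which is not K-linear.
  restMap : ∀ M N (h : Linear (M ↾ σK) (N ↾ σK)) A A′ B B′ →
            (∀ {x} → _∈ᴸ_ {M} x A → _∈ᴸ_ {N} (fun h x) B) →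
            (∀ {x} → _∈ᴸ_ {M} x A′ → _∈ᴸ_ {N} (fun h x) B′) →
            Linear (raw (Rest M A A′)) (raw (Rest N B B′))
  restMap M N h A A′ B B′ p p′ = mkLinear {M = Rest M A A′} {Rest N B B′}
    (λ { (x , x∈) → fun h x , p x∈ })
    (λ {x} {y} e → Submodule.resp (Lattice.submodule B′)
        (map-sub (restrict σK M) (restrict σK N) h (proj₁ x) (proj₁ y)) (p′ e))
    (λ x y → lift≈ (h.+ᴹ-homo (proj₁ x) (proj₁ y))) (λ c x → lift≈ (h.*ₗ-homo c (proj₁ x)))
    where
    module h = Linear h
    lift≈ : ∀ {x y} → LeftModule._≈ᴹ_ N x y → _∈ᴸ_ {N} (_-ᴹ′_ (raw N) x y) B′
    lift≈ = ≈⇒≈/ (over𝒪 N) (Lattice.submodule B′)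

  open Refine V L s using (Refinement)

  module _ (M N : Mod K) (φ : Op ι M N) where

    HasRefinements : Set (lsuc ℓ)
    HasRefinements = ∀ L₁ L₂ → ∃₂ λ L₁′ L₂′ → Refinement M N φ L₁ L₂ L₁′ L₂′

    bar : ∀ {L₁ L₂ L₁′ L₂′} → Refinement M N φ L₁ L₂ L₁′ L₂′ → Op ι𝜿 (Rest M L₁ L₁′) (Rest N L₂′ L₂)
    bar = Refine.induced V L s M N φ T lifting

    InducedIn : OpFamily ι𝜿 → Set (lsuc ℓ)
    InducedIn I = ∀ L₁ L₂ L₁′ L₂′ (r : Refinement M N φ L₁ L₂ L₁′ L₂′) →
      I (Rest M L₁ L₁′) (Rest N L₂′ L₂) (bar r)

    refineˡ : HasRefinements → ∀ A B → ∃ λ A′ →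
      _⊆ᴸ_ {M} A′ A × (∀ {x} → _∈ᴸ_ {M} x A′ → _∈ᴸ_ {N} (fun φ x) B)
    refineˡ ref A B = let A′ , _ , r = ref A B in A′ , Refinement.L₁′⊆L₁ r , Refinement.φL₁′⊆L₂ r

    refineʳ : HasRefinements → ∀ A B → ∃ λ B′ →
      _⊆ᴸ_ {N} B B′ × (∀ {x} → _∈ᴸ_ {M} x A → _∈ᴸ_ {N} (fun φ x) B′)
    refineʳ ref A B = let _ , B′ , r = ref A B in B′ , Refinement.L₂⊆L₂′ r , Refinement.φL₁⊆L₂′ r

    -- The requirements on `A′` and on `B′` are independent of each other, so a refinement can be
    -- put together from a lower and an upper half.
    mkRefinements :
      (∀ A B → ∃ λ A′ → _⊆ᴸ_ {M} A′ A × (∀ {x} → _∈ᴸ_ {M} x A′ → _∈ᴸ_ {N} (fun φ x) B)) →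
      (∀ A B → ∃ λ B′ → _⊆ᴸ_ {N} B B′ × (∀ {x} → _∈ᴸ_ {M} x A → _∈ᴸ_ {N} (fun φ x) B′)) →
      HasRefinements
    mkRefinements low up A B = let A′ , p , q = low A B ; B′ , u , v = up A B in
      A′ , B′ , record { L₁′⊆L₁ = p ; L₂⊆L₂′ = u ; φL₁′⊆L₂ = q ; φL₁⊆L₂′ = v }

  identity𝜿 : ∀ M → Linear (M ↾ σK) (M ↾ σK)
  identity𝜿 M = identityMap (restrict σK M)

  inclusionMap : ∀ M A A′ B B′ → _⊆ᴸ_ {M} A B → _⊆ᴸ_ {M} A′ B′ →
                 Linear (raw (Rest M A A′)) (raw (Rest M B B′))
  inclusionMap M = restMap M M (identity𝜿 M)

  abstract
    -- Over 𝜿 the subspace B / A of C / A is a direct summand. Over 𝒪 it need not be one: t𝒪 / t²𝒪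
    -- is not a summand of 𝒪 / t²𝒪.
    restrictTo : ∀ N (C B A : Lattice V N) → _⊆ᴸ_ {N} A B → _⊆ᴸ_ {N} B C →
      Σ (Linear (raw (Rest N C A)) (raw (Rest N B A))) λ ρ →
        ∀ {x} → _∈ᴸ_ {N} (proj₁ x) B → _∈ᴸ_ {N} (_-ᴹ′_ (raw N) (proj₁ (fun ρ x)) (proj₁ x)) A
    restrictTo N C B A A⊆B B⊆C =
      let ρ , ρ∈ , fix = retraction {F = 𝜿} (fieldOf L) em W (Rest-FG N C A) B∩C in
      mkLinear {M = W} {Rest N B A} (λ w → proj₁ (fun ρ w) , ρ∈ w)
        (λ {x} {y} → Linear.⟦⟧-cong ρ {x} {y}) (Linear.+ᴹ-homo ρ) (Linear.*ₗ-homo ρ) , λ {x} → fix {x}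
      where
      W : Mod 𝜿
      W = Rest N C A
      module B = Submodule (Lattice.submodule B)
      open LeftModule N
      open AdditiveGroup N
      B∩C : Submodule (raw W)
      B∩C = mkSubmodule W (λ w → B.Member (proj₁ w))
        (λ {x} {y} p x∈ → B.resp (≈ᴹ-trans (+ᴹ-congˡ (⁻¹-anti-homo‿- _ _)) (≈ᴹ-trans
            (≈ᴹ-sym (+ᴹ-assoc _ _ _)) (xyx⁻¹≈y _ _)))
          (B.+-closed x∈ (B.-‿closed (A⊆B p))))
        B.0-closed B.+-closed (λ r → B.*-closed (⟦ σ ⟧ r))

  module _ {E I : OpFamily ι𝜿} (isRing : IsOperatorRing ι𝜿 E) (isIdeal : IsOperatorIdeal ι𝜿 E I) where

    -- The operator induced on the smaller subquotients is recovered from the one on the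
    -- larger subquotients by a 𝜿-linear section and a 𝜿-linear retraction.
    descend : ∀ M N (φ : Op ι M N) {L₁ L₂ L₁′ L₂′ N₁ N₂ N₁′ N₂′}
      (r : Refinement M N φ L₁ L₂ L₁′ L₂′) (r′ : Refinement M N φ N₁ N₂ N₁′ N₂′) →
      _⊆ᴸ_ {M} N₁′ L₁′ → _⊆ᴸ_ {M} L₁ N₁ → _⊆ᴸ_ {N} N₂ L₂ → _⊆ᴸ_ {N} L₂′ N₂′ →
      I (Rest M N₁ N₁′) (Rest N N₂′ N₂) (bar M N φ r′) → I (Rest M L₁ L₁′) (Rest N L₂′ L₂) (bar M N φ r)
    descend M N φ {L₁} {L₂} {L₁′} {L₂′} {N₁} {N₂} {N₁′} {N₂′} r r′ N₁′⊆L₁′ L₁⊆N₁ N₂⊆L₂ L₂′⊆N₂′ =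
      sandwich ι𝜿 isRing isIdeal X X′ Y Y′ (Rest-FG M N₁ N₁′) (Rest-FG M L₁ L₁′)
        (Rest-FG N N₂′ N₂) (Rest-FG N L₂′ L₂) u v
        {bar M N φ r′} {bar M N φ r} eq
      where
      open LeftModule N
      open AdditiveGroup N
      module φ = Linear φ
      X = Rest M N₁ N₁′
      X′ = Rest M L₁ L₁′
      Y = Rest N N₂′ N₂
      Y′ = Rest N L₂′ L₂
      -- `S` embeds in `X` and maps onto `X′`; `W` is a quotient of `Y` and contains `Y′`. So `u` is
      -- a section of S → X′ followed by the embedding, and `v` is the projection Y → W followed by
      -- a retraction onto `Y′`.
      S = Rest M L₁ N₁′
      W = Rest N N₂′ L₂
      module W = LeftModule W
      q : Linear (raw S) (raw X′)
      q = inclusionMap M L₁ N₁′ L₁ L₁′ id N₁′⊆L₁′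
      sec : Section S X′ q
      sec = section {F = 𝜿} (fieldOf L) em S X′ (Rest-FG M L₁ L₁′) q
        (λ x → x , LeftModule.≈ᴹ-refl X′ {x})
      u : Linear (raw X′) (raw X)
      u = composite X′ S X (inclusionMap M L₁ N₁′ N₁ N₁′ L₁⊆N₁ id) (proj₁ sec)
      ret = restrictTo N N₂′ L₂′ L₂ (Refinement.L₂⊆L₂′ r) L₂′⊆N₂′
      v : Linear (raw Y) (raw Y′)
      v = composite Y W Y′ (proj₁ ret) (inclusionMap N N₂′ N₂ N₂′ L₂ id N₂⊆L₂)
      eq : ∀ x → LeftModule._≈ᴹ_ Y′ (fun v (fun (bar M N φ r′) (fun u x))) (fun (bar M N φ r) x)
      eq x = LeftModule.≈ᴹ-trans Y′ {fun v φy} {fun (proj₁ ret) φx} {fun (bar M N φ r) x}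
        -- The section changes the representative of `x` by an element of L₁′, which φ sends into
        -- L₂, and L₂ is zero in `W`.
        (Linear.⟦⟧-cong (proj₁ ret) {φy} {φx}
          (Submodule.resp (Lattice.submodule L₂)
            (map-sub (restrict ι M) (restrict ι N) φ (proj₁ (fun u x)) (proj₁ x))
                (Refinement.φL₁′⊆L₂ r (proj₂ sec x))))
        (proj₂ ret {φx} (Refinement.φL₁⊆L₂′ r (proj₂ x)))
        where
        φy φx : W.Carrierᴹ
        φy = fun (bar M N φ r′) (fun u x)
        φx = fun φ (proj₁ x) , L₂′⊆N₂′ (Refinement.φL₁⊆L₂′ r (proj₂ x))

  transport : ∀ M N {φ ψ : Op ι M N} → (∀ x → LeftModule._≈ᴹ_ N (fun φ x) (fun ψ x)) →
    ∀ {L₁ L₂ L₁′ L₂′} → Refinement M N φ L₁ L₂ L₁′ L₂′ → Refinement M N ψ L₁ L₂ L₁′ L₂′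
  transport M N e {L₂ = L₂} {L₂′ = L₂′} r = record
    { L₁′⊆L₁  = Refinement.L₁′⊆L₁ r
    ; L₂⊆L₂′  = Refinement.L₂⊆L₂′ r
    ; φL₁′⊆L₂ = λ p → Submodule.resp (Lattice.submodule L₂) (e _) (Refinement.φL₁′⊆L₂ r p)
    ; φL₁⊆L₂′ = λ p → Submodule.resp (Lattice.submodule L₂′) (e _) (Refinement.φL₁⊆L₂′ r p) }

  refinements-resp : ∀ M N {φ ψ : Op ι M N} → (∀ x → LeftModule._≈ᴹ_ N (fun φ x) (fun ψ x)) →
                     HasRefinements M N φ → HasRefinements M N ψ
  refinements-resp M N {φ} {ψ} e ref L₁ L₂ = let L₁′ , L₂′ , r = ref L₁ L₂ in
    L₁′ , L₂′ , transport M N {φ} {ψ} e r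

  IsSum : ∀ M N → Op ι M N → Op ι M N → Op ι M N → Set ℓ
  IsSum M N φ ψ χ = ∀ x → fun φ x +ᴹ fun ψ x ≈ᴹ fun χ x
    where open LeftModule N

  IsComposite : ∀ M N P → Op ι M N → Op ι N P → Op ι M P → Set ℓ
  IsComposite M N P φ ψ χ = ∀ x → LeftModule._≈ᴹ_ P (fun ψ (fun φ x)) (fun χ x)

  refinements-add : ∀ M N {φ ψ χ} → IsSum M N φ ψ χ → HasRefinements M N φ → HasRefinements M N ψ →
                    HasRefinements M N χ
  refinements-add M N {φ} {ψ} {χ} e refφ refψ = mkRefinements M N χ
    (λ A B → let A₁ , A₁⊆A , φA₁⊆B = refineˡ M N φ refφ A B ; A₂ , A₂⊆A₁ , ψA₂⊆B = refineˡ M N ψ refψ A₁ B in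
      A₂ , (A₁⊆A ∘ A₂⊆A₁) , λ p → Submodule.resp (Lattice.submodule B) (e _)
        (Submodule.+-closed (Lattice.submodule B) (φA₁⊆B (A₂⊆A₁ p)) (ψA₂⊆B p)))
    (λ A B → let B₁ , B⊆B₁ , φA⊆B₁ = refineʳ M N φ refφ A B ; B₂ , B₁⊆B₂ , ψA⊆B₂ = refineʳ M N ψ refψ A B₁ in
      B₂ , (B₁⊆B₂ ∘ B⊆B₁) , λ p → Submodule.resp (Lattice.submodule B₂) (e _)
        (Submodule.+-closed (Lattice.submodule B₂) (B₁⊆B₂ (φA⊆B₁ p)) (ψA⊆B₂ p)))

  -- Refinements start from given lattices, and the middle module comes with none. Its finite
  -- generation provides one.
  refinements-comp : ∀ M N P {φ ψ χ} → IsComposite M N P φ ψ χ → FG N →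
                     HasRefinements M N φ → HasRefinements N P ψ → HasRefinements M P χ
  refinements-comp M N P {φ} {ψ} {χ} e fg refφ refψ = mkRefinements M P χ
    (λ A C → let B , _ , ψB⊆C = refineˡ N P ψ refψ (someLattice N fg) C ; A′ , A′⊆A , φA′⊆B = refineˡ M N φ refφ A B in
      A′ , A′⊆A , λ p → Submodule.resp (Lattice.submodule C) (e _) (ψB⊆C (φA′⊆B p)))
    (λ A C → let B , _ , φA⊆B = refineʳ M N φ refφ A (someLattice N fg) ; C′ , C⊆C′ , ψB⊆C′ = refineʳ N P ψ refψ B C in
      C′ , C⊆C′ , λ p → Submodule.resp (Lattice.submodule C′) (e _) (ψB⊆C′ (φA⊆B p)))

  -- As `f` commutes with tᵐ, the single inclusion tᵐ f(A) ⊆ B yields both f(tᵐA) ⊆ B and f(A) ⊆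
  -- t⁻ᵐB.
  refinements-linear : ∀ M N f → HasRefinements M N (scalarOp ι M N f)
  refinements-linear M N f A B = shrink M m A , enlarge N m B , record
    { L₁′⊆L₁  = shrink-⊆ M m A
    ; L₂⊆L₂′  = enlarge-⊇ N m B
    ; φL₁′⊆L₂ = λ p → Submodule.resp (Lattice.submodule B)
        (LeftModule.≈ᴹ-sym N (LeftModule.≈ᴹ-trans N (f.⟦⟧-cong (shrink-witness M m A p)) (f.*ₗ-homo (t^ m) _)))
        (proj₂ small p)
    ; φL₁⊆L₂′ = proj₂ small }
    where
    module f = Linear f
    small = absorb M N (as𝒪 M N f) A B
    m = proj₁ small

  -- Closure of the recursive conditions under sums and composition.

  module Induced {E I : OpFamily ι𝜿} (isRing : IsOperatorRing ι𝜿 E) (isIdeal : IsOperatorIdeal ι𝜿 E I) where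
    open IsOperatorIdeal isIdeal

    induced-resp : ∀ M N {φ ψ : Op ι M N} → (∀ x → LeftModule._≈ᴹ_ N (fun φ x) (fun ψ x)) →
                   InducedIn M N φ I → InducedIn M N ψ I
    induced-resp M N {φ} {ψ} e p L₁ L₂ L₁′ L₂′ r = resp (Rest M L₁ L₁′) (Rest N L₂′ L₂)
      {bar M N φ r′} {bar M N ψ r} (λ x → ≈⇒≈/ (over𝒪 N) (Lattice.submodule L₂) (e (proj₁ x))) (p L₁ L₂ L₁′ L₂′ r′)
      where
      r′ : Refinement M N φ L₁ L₂ L₁′ L₂′
      r′ = transport M N {ψ} {φ} (λ x → LeftModule.≈ᴹ-sym N (e x)) r

    induced-zero : ∀ M N {φ : Op ι M N} → (∀ x → LeftModule._≈ᴹ_ N (fun φ x) (LeftModule.0ᴹ N)) → InducedIn M N φ I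
    induced-zero M N {φ} e L₁ L₂ L₁′ L₂′ r = zero∈ (Rest M L₁ L₁′) (Rest N L₂′ L₂) {bar M N φ r}
      (Rest-FG M L₁ L₁′) (Rest-FG N L₂′ L₂) (λ x → ≈⇒≈/ (over𝒪 N) (Lattice.submodule L₂) (e (proj₁ x)))

    -- Keep L₁ and L₂, shrink L₁′ and enlarge L₂′ until the pair refines for φ, ψ and χ alike. There
    -- the induced operators add up, and `descend` returns to the given refinement.
    induced-add : ∀ M N {φ ψ χ} → IsSum M N φ ψ χ → HasRefinements M N φ → HasRefinements M N ψ →
                  InducedIn M N φ I → InducedIn M N ψ I → InducedIn M N χ I
    induced-add M N {φ} {ψ} {χ} e refφ refψ φ∈ ψ∈ L₁ L₂ L₁′ L₂′ r =
      descend isRing isIdeal M N χ r rχ (λ p → A⊆L₁′ (B⊆A p)) id id (λ p → C⊆D (L₂′⊆C p))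
        (add∈ (Rest M L₁ B) (Rest N D L₂) {bar M N φ rφ} {bar M N ψ rψ} {bar M N χ rχ}
          (λ x → ≈⇒≈/ (over𝒪 N) (Lattice.submodule L₂) (e (proj₁ x)))
          (φ∈ L₁ L₂ B D rφ) (ψ∈ L₁ L₂ B D rψ))
      where
      lowφ = refineˡ M N φ refφ L₁′ L₂
      A = proj₁ lowφ
      A⊆L₁′ = proj₁ (proj₂ lowφ)
      lowψ = refineˡ M N ψ refψ A L₂
      B = proj₁ lowψ
      B⊆A = proj₁ (proj₂ lowψ)
      highφ = refineʳ M N φ refφ L₁ L₂′
      C = proj₁ highφ
      L₂′⊆C = proj₁ (proj₂ highφ)
      highψ = refineʳ M N ψ refψ L₁ C
      D = proj₁ highψ
      C⊆D = proj₁ (proj₂ highψ)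
      B⊆L₁ : _⊆ᴸ_ {M} B L₁
      B⊆L₁ p = Refinement.L₁′⊆L₁ r (A⊆L₁′ (B⊆A p))
      L₂⊆D : _⊆ᴸ_ {N} L₂ D
      L₂⊆D p = C⊆D (L₂′⊆C (Refinement.L₂⊆L₂′ r p))
      rφ : Refinement M N φ L₁ L₂ B D
      rφ = record { L₁′⊆L₁ = B⊆L₁ ; L₂⊆L₂′ = L₂⊆D
                  ; φL₁′⊆L₂ = λ p → proj₂ (proj₂ lowφ) (B⊆A p) ; φL₁⊆L₂′ = λ p → C⊆D (proj₂ (proj₂ highφ) p) }
      rψ : Refinement M N ψ L₁ L₂ B D
      rψ = record { L₁′⊆L₁ = B⊆L₁ ; L₂⊆L₂′ = L₂⊆D
                  ; φL₁′⊆L₂ = proj₂ (proj₂ lowψ) ; φL₁⊆L₂′ = proj₂ (proj₂ highψ) }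
      rχ : Refinement M N χ L₁ L₂ B D
      rχ = record
        { L₁′⊆L₁ = B⊆L₁ ; L₂⊆L₂′ = L₂⊆D
        ; φL₁′⊆L₂ = λ p → Submodule.resp (Lattice.submodule L₂) (e _)
            (Submodule.+-closed (Lattice.submodule L₂) (Refinement.φL₁′⊆L₂ rφ p) (Refinement.φL₁′⊆L₂ rψ p))
        ; φL₁⊆L₂′ = λ p → Submodule.resp (Lattice.submodule D) (e _)
            (Submodule.+-closed (Lattice.submodule D) (Refinement.φL₁⊆L₂′ rφ p) (Refinement.φL₁⊆L₂′ rψ p)) }

    -- With lattices A ⊆ C in `N` such that φB ⊆ A, φL₁ ⊆ C, ψA ⊆ L₃ and ψC ⊆ D, the operator
    -- induced by χ factors as L₁/B → C/A → D/L₃. Two families `I₁`, `I₂` allow the ideal to sit on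
    -- either side of the composite.
    induced-comp : ∀ {I₁ I₂ : OpFamily ι𝜿} →
      (∀ X Y Z {f : Op ι𝜿 X Y} {g : Op ι𝜿 Y Z} {h : Op ι𝜿 X Z} → FG X → FG Y → FG Z →
         (∀ x → LeftModule._≈ᴹ_ Z (fun g (fun f x)) (fun h x)) → I₂ Y Z g → I₁ X Y f → I X Z h) →
      ∀ M N P {φ ψ χ} → IsComposite M N P φ ψ χ → FG N → HasRefinements M N φ → HasRefinements N P ψ →
      InducedIn M N φ I₁ → InducedIn N P ψ I₂ → InducedIn M P χ I
    induced-comp comp∈ M N P {φ} {ψ} {χ} e fg refφ refψ φ∈ ψ∈ L₁ L₃ L₁′ L₃′ r =
      descend isRing isIdeal M P χ r rχ B⊆L₁′ id id L₃′⊆D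
        (comp∈ (Rest M L₁ B) (Rest N C A) (Rest P D L₃) {bar M N φ rφ} {bar N P ψ rψ} {bar M P χ rχ}
          (Rest-FG M L₁ B) (Rest-FG N C A) (Rest-FG P D L₃)
          (λ x → ≈⇒≈/ (over𝒪 P) (Lattice.submodule L₃) (e (proj₁ x)))
          (ψ∈ C L₃ A D rψ) (φ∈ L₁ A B C rφ))
      where
      lowψ = refineˡ N P ψ refψ (someLattice N fg) L₃
      A = proj₁ lowψ
      lowφ = refineˡ M N φ refφ L₁′ A
      B = proj₁ lowφ
      B⊆L₁′ = proj₁ (proj₂ lowφ)
      highφ = refineʳ M N φ refφ L₁ A
      C = proj₁ highφ
      highψ = refineʳ N P ψ refψ C L₃′
      D = proj₁ highψ
      L₃′⊆D = proj₁ (proj₂ highψ)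
      B⊆L₁ : _⊆ᴸ_ {M} B L₁
      B⊆L₁ p = Refinement.L₁′⊆L₁ r (B⊆L₁′ p)
      L₃⊆D : _⊆ᴸ_ {P} L₃ D
      L₃⊆D p = L₃′⊆D (Refinement.L₂⊆L₂′ r p)
      rφ : Refinement M N φ L₁ A B C
      rφ = record { L₁′⊆L₁ = B⊆L₁ ; L₂⊆L₂′ = proj₁ (proj₂ highφ)
                  ; φL₁′⊆L₂ = proj₂ (proj₂ lowφ) ; φL₁⊆L₂′ = proj₂ (proj₂ highφ) }
      rψ : Refinement N P ψ C L₃ A D
      rψ = record { L₁′⊆L₁ = proj₁ (proj₂ highφ) ; L₂⊆L₂′ = L₃⊆D
                  ; φL₁′⊆L₂ = proj₂ (proj₂ lowψ) ; φL₁⊆L₂′ = proj₂ (proj₂ highψ) }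
      rχ : Refinement M P χ L₁ L₃ B D
      rχ = record
        { L₁′⊆L₁ = B⊆L₁ ; L₂⊆L₂′ = L₃⊆D
        ; φL₁′⊆L₂ = λ p → Submodule.resp (Lattice.submodule L₃) (e _)
            (Refinement.φL₁′⊆L₂ rψ (Refinement.φL₁′⊆L₂ rφ p))
        ; φL₁⊆L₂′ = λ p → Submodule.resp (Lattice.submodule D) (e _)
            (Refinement.φL₁⊆L₂′ rψ (Refinement.φL₁⊆L₂′ rφ p)) }

  module _ {E : OpFamily ι𝜿} (isRing : IsOperatorRing ι𝜿 E) where
    open IsOperatorRing isRing
    private
      module EE = Induced isRing isIdeal
      module E = IsOperatorIdeal isIdeal

    -- The induced maps are again 𝜿-linear, so they satisfy all remaining levels of the recursion at
    -- once.
    induced-𝜿linear : ∀ M N (h : Linear (M ↾ σK) (N ↾ σK)) (φ : Op ι M N) →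
      (∀ x → LeftModule._≈ᴹ_ N (fun h x) (fun φ x)) → InducedIn M N φ E
    induced-𝜿linear M N h φ e L₁ L₂ L₁′ L₂′ r = linear∈ (Rest M L₁ L₁′) (Rest N L₂′ L₂) h̄ {bar M N φ r}
      (λ x → ≈⇒≈/ (over𝒪 N) (Lattice.submodule L₂) (e (proj₁ x)))
      where
      h̄ : Linear (raw (Rest M L₁ L₁′)) (raw (Rest N L₂′ L₂))
      h̄ = restMap M N h L₁ L₁′ L₂′ L₂
        (λ p → Submodule.resp (Lattice.submodule L₂′) (LeftModule.≈ᴹ-sym N (e _)) (Refinement.φL₁⊆L₂′ r p))
        (λ p → Submodule.resp (Lattice.submodule L₂) (LeftModule.≈ᴹ-sym N (e _)) (Refinement.φL₁′⊆L₂ r p))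

    -- When `E` and `I` are the families over the residue field, `Step` unfolds to the recursive
    -- clause of `IsBT`, and `Bounding`, `Vanishing` and `StepI` unfold to the three clauses of
    -- `IsBTᵢⱼ`.
    Step : OpFamily ι
    Step M N φ = HasRefinements M N φ × InducedIn M N φ E

    Step-isRing : IsOperatorRing ι Step
    Step-isRing = record
      { linear∈ = λ M N f {g} e →
          refinements-resp M N {scalarOp ι M N f} {g} e (refinements-linear M N f)
        , induced-𝜿linear M N (as𝜿 M N f) g e
      ; isIdeal = record
        { resp  = λ M N {φ} {ψ} e (ref , φ∈) → refinements-resp M N {φ} {ψ} e ref , EE.induced-resp M N {φ} {ψ} e φ∈
        ; zero∈ = λ M N {φ} _ _ e →
            refinements-resp M N {scalarOp ι M N (zeroMap M N)} {φ}
              (λ x → LeftModule.≈ᴹ-sym N (e x)) (refinements-linear M N (zeroMap M N))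
          , EE.induced-zero M N {φ} e
        ; add∈  = λ M N {φ} {ψ} {χ} e (refφ , φ∈) (refψ , ψ∈) →
            refinements-add M N {φ} {ψ} {χ} e refφ refψ , EE.induced-add M N {φ} {ψ} {χ} e refφ refψ φ∈ ψ∈
        ; ∘∈ˡ   = λ M N P {φ} {ψ} {χ} → comp-step M N P {φ} {ψ} {χ}
        ; ∘∈ʳ   = λ M N P {φ} {ψ} {χ} → comp-step M N P {φ} {ψ} {χ} } }
      where
      comp-step : ∀ M N P {φ ψ χ} → FG M → FG N → FG P → IsComposite M N P φ ψ χ →
                  Step N P ψ → Step M N φ → Step M P χ
      comp-step M N P {φ} {ψ} {χ} _ fg _ e (refψ , ψ∈) (refφ , φ∈) =
        refinements-comp M N P {φ} {ψ} {χ} e fg refφ refψ ,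
        EE.induced-comp {E} {E} E.∘∈ˡ M N P {φ} {ψ} {χ} e fg refφ refψ φ∈ ψ∈

    StepI : OpFamily ι𝜿 → OpFamily ι
    StepI I M N φ = Step M N φ × InducedIn M N φ I

    private
      module S = IsOperatorRing Step-isRing
      module SI = IsOperatorIdeal S.isIdeal

    StepI-isIdeal : ∀ {I} → IsOperatorIdeal ι𝜿 E I → IsOperatorIdeal ι Step (StepI I)
    StepI-isIdeal {I} isIdealI = record
      { resp  = λ M N {φ} {ψ} e (φ∈ , φ∈I) → SI.resp M N {φ} {ψ} e φ∈ , EI.induced-resp M N {φ} {ψ} e φ∈I
      ; zero∈ = λ M N {φ} p q e → SI.zero∈ M N {φ} p q e , EI.induced-zero M N {φ} e
      ; add∈  = λ M N {φ} {ψ} {χ} e (φ∈ , φ∈I) (ψ∈ , ψ∈I) → SI.add∈ M N {φ} {ψ} {χ} e φ∈ ψ∈ ,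
          EI.induced-add M N {φ} {ψ} {χ} e (proj₁ φ∈) (proj₁ ψ∈) φ∈I ψ∈I
      ; ∘∈ˡ   = λ M N P {φ} {ψ} {χ} fgM fg fgP e ψ∈ (φ∈ , φ∈I) → SI.∘∈ˡ M N P {φ} {ψ} {χ} fgM fg fgP e ψ∈ φ∈ ,
          EI.induced-comp {I} {E} (IsOperatorIdeal.∘∈ˡ isIdealI) M N P {φ} {ψ} {χ} e fg
            (proj₁ φ∈) (proj₁ ψ∈) φ∈I (proj₂ ψ∈)
      ; ∘∈ʳ   = λ M N P {φ} {ψ} {χ} fgM fg fgP e (ψ∈ , ψ∈I) φ∈ → SI.∘∈ʳ M N P {φ} {ψ} {χ} fgM fg fgP e ψ∈ φ∈ ,
          EI.induced-comp {E} {I} (IsOperatorIdeal.∘∈ʳ isIdealI) M N P {φ} {ψ} {χ} e fg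
            (proj₁ φ∈) (proj₁ ψ∈) (proj₂ φ∈) ψ∈I }
      where module EI = Induced isRing isIdealI

    Bounding Vanishing : OpFamily ι
    Bounding  M N φ = Step M N φ × ∃ λ (B : Lattice V N) → ∀ x → Member (Lattice.submodule B) (fun φ x)
    Vanishing M N φ = Step M N φ ×
      ∃ λ (A : Lattice V M) → ∀ x → Member (Lattice.submodule A) x → LeftModule._≈ᴹ_ N (fun φ x) (LeftModule.0ᴹ N)

    -- Composing on the left with ψ replaces the bounding lattice by one that contains its image,
    -- from an upper half of a refinement for ψ. For `Vanishing` the lower half plays this part in
    -- composition on the right.
    Bounding-isIdeal : IsOperatorIdeal ι Step Bounding
    Bounding-isIdeal = record
      { resp  = λ M N {φ} {ψ} e (φ∈ , B , p) → SI.resp M N {φ} {ψ} e φ∈ ,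
          B , λ x → Submodule.resp (Lattice.submodule B) (e x) (p x)
      ; zero∈ = λ M N {φ} p q e → SI.zero∈ M N {φ} p q e , someLattice N q , λ x →
          Submodule.resp (Lattice.submodule (someLattice N q)) (LeftModule.≈ᴹ-sym N (e x))
            (Submodule.0-closed (Lattice.submodule (someLattice N q)))
      ; add∈  = λ M N {φ} {ψ} {χ} e (φ∈ , A , p) (ψ∈ , B , q) → let C , A⊆C , B⊆C = join N A B in
          SI.add∈ M N {φ} {ψ} {χ} e φ∈ ψ∈ , C , λ x → Submodule.resp (Lattice.submodule C) (e x)
            (Submodule.+-closed (Lattice.submodule C) (A⊆C (p x)) (B⊆C (q x)))
      ; ∘∈ˡ   = λ M N P {φ} {ψ} {χ} fgM fgN fgP e ψ∈ (φ∈ , B , p) →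
          let C , _ , q = refineʳ N P ψ (proj₁ ψ∈) B (someLattice P fgP) in
          SI.∘∈ˡ M N P {φ} {ψ} {χ} fgM fgN fgP e ψ∈ φ∈ , C , λ x →
            Submodule.resp (Lattice.submodule C) (e x) (q (p x))
      ; ∘∈ʳ   = λ M N P {φ} {ψ} {χ} fgM fgN fgP e (ψ∈ , B , p) φ∈ →
          SI.∘∈ʳ M N P {φ} {ψ} {χ} fgM fgN fgP e ψ∈ φ∈ , B , λ x →
            Submodule.resp (Lattice.submodule B) (e x) (p (fun φ x)) }

    Vanishing-isIdeal : IsOperatorIdeal ι Step Vanishing
    Vanishing-isIdeal = record
      { resp  = λ M N {φ} {ψ} e (φ∈ , A , p) → SI.resp M N {φ} {ψ} e φ∈ ,
          A , λ x x∈ → LeftModule.≈ᴹ-trans N (LeftModule.≈ᴹ-sym N (e x)) (p x x∈)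
      ; zero∈ = λ M N {φ} p q e → SI.zero∈ M N {φ} p q e , someLattice M p , λ x _ → e x
      ; add∈  = λ M N {φ} {ψ} {χ} e (φ∈ , A , p) (ψ∈ , B , q) → let C , C⊆A , C⊆B = meet M A B in
          SI.add∈ M N {φ} {ψ} {χ} e φ∈ ψ∈ , C , λ x x∈ → LeftModule.≈ᴹ-trans N (LeftModule.≈ᴹ-sym N (e x))
            (LeftModule.≈ᴹ-trans N (LeftModule.+ᴹ-cong N (p x (C⊆A x∈)) (q x (C⊆B x∈))) (LeftModule.+ᴹ-identityˡ N _))
      ; ∘∈ˡ   = λ M N P {φ} {ψ} {χ} fgM fgN fgP e ψ∈ (φ∈ , A , p) →
          SI.∘∈ˡ M N P {φ} {ψ} {χ} fgM fgN fgP e ψ∈ φ∈ , A , λ x x∈ →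
            LeftModule.≈ᴹ-trans P (LeftModule.≈ᴹ-sym P (e x))
              (LeftModule.≈ᴹ-trans P (Linear.⟦⟧-cong ψ (p x x∈)) (Linear.0ᴹ-homo ψ))
      ; ∘∈ʳ   = λ M N P {φ} {ψ} {χ} fgM fgN fgP e (ψ∈ , A , p) φ∈ →
          let C , _ , q = refineˡ M N φ (proj₁ φ∈) (someLattice M fgM) A in
          SI.∘∈ʳ M N P {φ} {ψ} {χ} fgM fgN fgP e ψ∈ φ∈ , C , λ x x∈ →
            LeftModule.≈ᴹ-trans P (LeftModule.≈ᴹ-sym P (e x)) (p (fun φ x) (q x∈)) }

  -- Operators on K defined through digits: the polar part and coefficientwise operators.

  -- x ↦ t⁻ᵐ Fₘ(tᵐ x), for any m with tᵐ x ∈ 𝒪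
  module Extension (F : ℕ → 𝒪.Carrier → 𝒪.Carrier)
                   (F-cong : ∀ m {x y} → x 𝒪.≈ y → F m x 𝒪.≈ F m y)
                   (F-+ : ∀ m x y → F m (x 𝒪.+ y) 𝒪.≈ F m x 𝒪.+ F m y)
                   (F-*t : ∀ m x → F (suc m) (x 𝒪.* t) 𝒪.≈ F m x 𝒪.* t) where
    open Solver K.commutativeSemiring using (solve; _:=_; _:*_)

    value : ∀ m x → Contains (t^ m K.* x) → K.Carrier
    value m x p = t^- m K.* proj₁ (F m (t^ m K.* x , p))

    private
      -- Independence of the exponent is exactly what `F-*t` provides: passing from tᵐ x to tᵐ⁺¹ x
      -- contributes a factor `t`, which t⁻¹ cancels.
      value-suc : ∀ m x p p′ → value (suc m) x p′ K.≈ value m x p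
      value-suc m x p p′ = K.trans (K.*-congˡ (K.trans
          (F-cong (suc m) {t^ suc m K.* x , p′} {(t^ m K.* x , p) 𝒪.* t}
            (solve 3 (λ t u x → (t :* u) :* x := (u :* x) :* t) K.refl (proj₁ t) (t^ m) x))
          (F-*t m (t^ m K.* x , p))))
        (K.trans (solve 4 (λ v w f t → (v :* w) :* (f :* t) := (t :* v) :* (w :* f)) K.refl
            t⁻¹ (t^- m) (proj₁ (F m (t^ m K.* x , p))) (proj₁ t))
          (K.trans (K.*-congʳ (proj₂ (proj₂ isField (proj₁ t) D.t≉0))) (K.*-identityˡ _)))

      value-+ : ∀ k m x p p′ → value (k ℕ.+ m) x p′ K.≈ value m x p
      value-+ zero    m x p p′ = K.*-congˡ (F-cong m {_ , p′} {_ , p} K.refl)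
      value-+ (suc k) m x p p′ = let q = raise (unit K) unitLattice k m p in
        K.trans (value-suc (k ℕ.+ m) x q p′) (value-+ k m x p q)

    extend : K.Carrier → K.Carrier
    extend x = let m , p = clearDenominator x in value m x p

    extend-value : ∀ m x p → extend x K.≈ value m x p
    extend-value m x p = let k , q = clearDenominator x in
      K.trans (K.sym (value-+ m k x q (raise (unit K) unitLattice m k q)))
        (subst (λ j → ∀ r → value j x r K.≈ value m x p) (ℕ.+-comm k m) (value-+ k m x p)
          (raise (unit K) unitLattice m k q))

    extend-cong : ∀ {x y} → x K.≈ y → extend x K.≈ extend y
    extend-cong {x} {y} e = let m , p = clearDenominator x ; q = Subring.resp subring (K.*-congˡ e) p in
      K.trans (K.*-congˡ (F-cong m {_ , p} {_ , q} (K.*-congˡ e))) (K.sym (extend-value m y q))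

    extend-+ : ∀ x y → extend (x K.+ y) K.≈ extend x K.+ extend y
    extend-+ x y =
      let m , p = clearDenominator x ; k , q = clearDenominator y
          p′ = raiseʳ (unit K) unitLattice m k p ; q′ = raise (unit K) unitLattice m k q
          r = Subring.resp subring (K.sym (K.distribˡ (t^ (m ℕ.+ k)) x y)) (Subring.+-closed subring p′ q′)
      in K.trans (extend-value (m ℕ.+ k) (x K.+ y) r)
        (K.trans (K.*-congˡ (K.trans
            (F-cong (m ℕ.+ k) {_ , r} {(_ , p′) 𝒪.+ (_ , q′)} (K.distribˡ (t^ (m ℕ.+ k)) x y))
            (F-+ (m ℕ.+ k) (_ , p′) (_ , q′))))
          (K.trans (K.distribˡ _ _ _)
            (K.+-cong (K.sym (extend-value (m ℕ.+ k) x p′)) (K.sym (extend-value (m ℕ.+ k) y q′)))))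

    extend-* : ∀ o → (∀ m x → F m (o 𝒪.* x) 𝒪.≈ o 𝒪.* F m x) → ∀ x →
               extend (proj₁ o K.* x) K.≈ proj₁ o K.* extend x
    extend-* o F-* x =
      let m , p = clearDenominator x
          shuffle = solve 3 (λ u o x → o :* (u :* x) := u :* (o :* x)) K.refl (t^ m) (proj₁ o) x
          q = Subring.resp subring shuffle (Subring.*-closed subring (proj₂ o) p)
      in K.trans (extend-value m (proj₁ o K.* x) q)
        (K.trans (K.*-congˡ (K.trans (F-cong m {_ , q} {o 𝒪.* (_ , p)} (K.sym shuffle)) (F-* m (_ , p))))
          (solve 3 (λ u o f → u :* (o :* f) := o :* (u :* f)) K.refl (t^- m) (proj₁ o) (proj₁ (F m (_ , p)))))

  private
    _⊆K_ : Lattice V (unit K) → Lattice V (unit K) → Set ℓ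
    A ⊆K B = _⊆ᴸ_ {unit K} A B

  private
    -- The first m digits of tᵐ x are the digits of `x` in negative degrees, so the truncation
    -- length has to follow the exponent.
    module Polar = Extension (λ m → Dig.apply id m)
      (λ m → Dig.apply-cong id (λ {x} {y} → id) (λ x y → 𝜿.refl {x 𝒪.+ y}) m)
      (λ m → Dig.apply-+ id (λ {x} {y} → id) (λ x y → 𝜿.refl {x 𝒪.+ y}) m)
      (λ m → Dig.apply-*t id (λ {x} {y} → id) (λ x y → 𝜿.refl {x 𝒪.+ y}) m)

  -- Σᵢ σ(aᵢ) tⁱ ↦ Σ σ(aᵢ) tⁱ, summed over i < 0
  polar : Linear (unit K ↾ σK) (unit K ↾ σK)
  polar = mkLinear {M = restrict σK (unit K)} {restrict σK (unit K)} Polar.extend Polar.extend-cong Polar.extend-+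
    (λ c → Polar.extend-* (⟦ σ ⟧ c)
      (λ m → Dig.apply-σ* id (λ {x} {y} → id) (λ x y → 𝜿.refl {x 𝒪.+ y}) c (λ x → 𝜿.refl {c 𝒪.* x}) m))

  polar-integral : ∀ {x} → Contains x → fun polar x K.≈ K.0#
  polar-integral {x} p = K.trans
    (Polar.extend-value 0 x (Subring.resp subring (K.sym (K.*-identityˡ x)) p)) (K.zeroʳ _)

  -- Keeping m digits alters tᵐ x by a multiple of tᵐ, and division by tᵐ leaves an integral
  -- difference.
  polar-difference : ∀ x → Contains (fun polar x K.- x)
  polar-difference x =
    let m , p = clearDenominator x
        (r , r∈) , e = Dig.apply-id m (t^ m K.* x , p)
    in Subring.resp subring (begin
         r                                             ≈⟨ K.*-identityʳ r ⟨
         r K.* K.1#                                    ≈⟨ K.*-congˡ (t^*t^- m) ⟨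
         r K.* ((t^ m) K.* (t^- m))                    ≈⟨ K.*-assoc r _ _ ⟨
         (r K.* (t^ m)) K.* (t^- m)                    ≈⟨ K.*-congʳ e ⟨
         (apply m p K.- (t^ m K.* x)) K.* (t^- m)      ≈⟨ K.*-comm _ _ ⟩
         (t^- m) K.* (apply m p K.- (t^ m K.* x))      ≈⟨ x[y-z]≈xy-xz _ _ _ ⟩
         fun polar x K.- (t^- m) K.* ((t^ m) K.* x)    ≈⟨ K.+-congˡ (K.-‿cong (K.trans (K.sym (K.*-assoc _ _ x))
                                                            (K.trans (K.*-congʳ (t^-*t^ m)) (K.*-identityˡ x)))) ⟩
         fun polar x K.- x                             ∎) r∈
    where
    open SetoidReasoning K.setoid
    open RingProperties K.ring using (x[y-z]≈xy-xz)
    apply : ∀ m → Contains (t^ m K.* x) → K.Carrier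
    apply m p = proj₁ (Dig.apply id m (t^ m K.* x , p))

  σι : ∀ c → proj₁ (⟦ σ ⟧ (⟦ ι𝜿 ⟧ c)) K.≈ ⟦ ι ⟧ c
  σι = isAlgHom

  polarPart integralPart : Op ι (unit K) (unit K)
  polarPart = mkLinear {M = restrict ι (unit K)} {restrict ι (unit K)} (fun polar) Polar.extend-cong Polar.extend-+
    (λ c x → K.trans (Polar.extend-cong (K.*-congʳ (K.sym (σι c))))
      (K.trans (Linear.*ₗ-homo polar (⟦ ι𝜿 ⟧ c) x) (K.*-congʳ (σι c))))
  integralPart = sumMap (restrict ι (unit K)) (restrict ι (unit K)) (identityMap (restrict ι (unit K)))
    (composite (restrict ι (unit K)) (restrict ι (unit K)) (restrict ι (unit K))
      (negation (restrict ι (unit K))) polarPart)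

  integralPart∈ : ∀ x → Contains (fun integralPart x)
  integralPart∈ x = Subring.resp subring (⁻¹-anti-homo‿- _ x) (Subring.-‿closed subring (polar-difference x))
    where open AdditiveGroup (unit K)

  integral+polar : ∀ x → fun integralPart x K.+ fun polarPart x K.≈ x
  integral+polar x = //-rightDividesˡ _ x
    where open AdditiveGroup (unit K)

  -- The polar part vanishes on 𝒪, which gives the lower half; it differs from the identity by
  -- integral elements, so any lattice containing 𝒪 is preserved, which gives the upper half.
  polarPart-refinements : HasRefinements (unit K) (unit K) polarPart
  polarPart-refinements = mkRefinements (unit K) (unit K) polarPart
    (λ A B → let C , C⊆A , C⊆𝒪 = meet (unit K) A unitLattice in
      C , C⊆A , λ p → Submodule.resp (Lattice.submodule B) (K.sym (polar-integral (C⊆𝒪 p)))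
        (Submodule.0-closed (Lattice.submodule B)))
    (λ A B → let C , A⊆C , 𝒪⊆C = join (unit K) A unitLattice ; D , C⊆D , B⊆D = join (unit K) C B in
      D , B⊆D , λ {x} p → C⊆D (Submodule.resp (Lattice.submodule C) (//-rightDividesˡ x _)
        (Submodule.+-closed (Lattice.submodule C) (𝒪⊆C (polar-difference x)) (A⊆C p))))
    where open AdditiveGroup (unit K)

  module _ {E : OpFamily ι𝜿} (isRing : IsOperatorRing ι𝜿 E) where
    private
      module S = IsOperatorRing (Step-isRing isRing)
      module SI = IsOperatorIdeal S.isIdeal

    polarPart-Vanishing : Vanishing isRing (unit K) (unit K) polarPart
    polarPart-Vanishing =
      (polarPart-refinements , induced-𝜿linear isRing (unit K) (unit K) polar polarPart (λ _ → K.refl)) ,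
      unitLattice , λ _ → polar-integral

    integralPart-Bounding : Bounding isRing (unit K) (unit K) integralPart
    integralPart-Bounding =
      SI.add∈ (unit K) (unit K) {identity} {minus} {integralPart} (λ _ → K.refl)
        (S.linear∈ (unit K) (unit K) (identityMap (unit K)) {identity} (λ _ → K.refl))
        (SI.∘∈ˡ (unit K) (unit K) (unit K) {polarPart} {negative} {minus} (unit-FG K) (unit-FG K) (unit-FG K)
            (λ _ → K.refl)
          (S.linear∈ (unit K) (unit K) (negation (unit K)) {negative} (λ _ → K.refl)) (proj₁ polarPart-Vanishing))
      , unitLattice , integralPart∈
      where
      identity negative minus : Op ι (unit K) (unit K)
      identity = identityMap (restrict ι (unit K))
      negative = negation (restrict ι (unit K))
      minus = composite (restrict ι (unit K)) (restrict ι (unit K)) (restrict ι (unit K)) negative polarPart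

  private
    big small : ℕ → Lattice V (unit K)
    big   a = enlarge (unit K) a unitLattice
    small a = shrink (unit K) a unitLattice

  module Lifted (e : Op ι𝜿 (unit 𝜿) (unit 𝜿)) where
    private
      module e = Linear e

    lifted : 𝒪.Carrier → 𝒪.Carrier
    lifted = Dig.lifted (fun e) e.⟦⟧-cong e.+ᴹ-homo
    private
      lifted-cong : ∀ {x y} → x 𝒪.≈ y → lifted x 𝒪.≈ lifted y
      lifted-cong {x} {y} = Dig.lift-cong (fun e) e.⟦⟧-cong e.+ᴹ-homo {x} {y}
      module X = Extension (λ _ → lifted) (λ _ {x} {y} → lifted-cong {x} {y})
        (λ _ → Dig.lift-+ (fun e) e.⟦⟧-cong e.+ᴹ-homo) (λ _ → Dig.lift-*t (fun e) e.⟦⟧-cong e.+ᴹ-homo)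

    extend-value : ∀ m x p → X.extend x K.≈ t^- m K.* proj₁ (lifted (t^ m K.* x , p))
    extend-value = X.extend-value

    lift-σι : ∀ c x → lifted (⟦ ι𝒪 ⟧ c 𝒪.* x) 𝒪.≈ ⟦ ι𝒪 ⟧ c 𝒪.* lifted x
    lift-σι c x = K.trans
      (lifted-cong {⟦ ι𝒪 ⟧ c 𝒪.* x} {⟦ σ ⟧ (⟦ ι𝜿 ⟧ c) 𝒪.* x} (K.*-congʳ (K.sym (σι c))))
      (K.trans (Dig.lift-σ* (fun e) e.⟦⟧-cong e.+ᴹ-homo (⟦ ι𝜿 ⟧ c) (e.*ₗ-homo c) x) (K.*-congʳ (σι c)))

    coefficientwise : Op ι (unit K) (unit K)
    coefficientwise = mkLinear {M = restrict ι (unit K)} {restrict ι (unit K)} X.extend X.extend-cong X.extend-+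
      (λ c → X.extend-* (⟦ ι𝒪 ⟧ c) (λ _ → lift-σι c))

    -- Together with `shrink-stable`: every fractional ideal tᵐ𝒪, with m of either sign, is
    -- preserved, because no digit changes its degree. Hence refinements can be chosen among these
    -- ideals.
    enlarge-stable : ∀ m {x} → Contains (t^ m K.* x) → Contains (t^ m K.* fun coefficientwise x)
    enlarge-stable m {x} p = Subring.resp subring (K.sym (K.trans (K.*-congˡ (extend-value m x p))
      (K.trans (K.sym (K.*-assoc _ _ _)) (K.trans (K.*-congʳ (t^*t^- m)) (K.*-identityˡ _)))))
      (proj₂ (lifted (t^ m K.* x , p)))

    shrink-stable : ∀ m {x} → Contains (t^- m K.* x) → Contains (t^- m K.* fun coefficientwise x)
    shrink-stable m {x} p = Subring.resp subring (K.sym (begin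
        t^- m K.* X.extend x                             ≈⟨ K.*-congˡ (X.extend-cong (shrink-witness (unit K) m unitLattice p)) ⟩
        t^- m K.* X.extend (t^ m K.* (t^- m K.* x))
          ≈⟨ K.*-congˡ (X.extend-* (t ^ m) (λ _ → Dig.lift-*t^ (fun e) e.⟦⟧-cong e.+ᴹ-homo m) (t^- m K.* x)) ⟩
        t^- m K.* (t^ m K.* X.extend (t^- m K.* x))      ≈⟨ K.*-assoc _ _ _ ⟨
        (t^- m K.* t^ m) K.* X.extend (t^- m K.* x)      ≈⟨ K.*-congʳ (t^-*t^ m) ⟩
        K.1# K.* X.extend (t^- m K.* x)                  ≈⟨ K.*-identityˡ _ ⟩
        X.extend (t^- m K.* x)                           ≈⟨ extend-value 0 (t^- m K.* x) p′ ⟩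
        K.1# K.* proj₁ (lifted (K.1# K.* (t^- m K.* x) , p′)) ≈⟨ K.*-identityˡ _ ⟩
        proj₁ (lifted (K.1# K.* (t^- m K.* x) , p′))     ∎))
      (proj₂ (lifted (K.1# K.* (t^- m K.* x) , p′)))
      where
      open SetoidReasoning K.setoid
      p′ : Contains (K.1# K.* (t^- m K.* x))
      p′ = Subring.resp subring (K.sym (K.*-identityˡ _)) p

    private
      identity𝒪 : Linear (raw (over𝒪 (unit K))) (raw (over𝒪 (unit K)))
      identity𝒪 = identityMap (over𝒪 (unit K))

      -- Exponents i and o with tⁱ𝒪 ⊆ A ⊆ t⁻ᵒ𝒪. The slack `k` in the two inclusions below lets one
      -- exponent serve both.
      inside outside : Lattice V (unit K) → ℕ
      inside  A = proj₁ (absorb (unit K) (unit K) identity𝒪 unitLattice A)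
      outside A = proj₁ (absorb (unit K) (unit K) identity𝒪 A unitLattice)

      inside-⊆ : ∀ A k {x} → Contains (t^- (k ℕ.+ inside A) K.* x) → Member (Lattice.submodule A) x
      inside-⊆ A k {x} p = Submodule.resp (Lattice.submodule A)
        (K.sym (shrink-witness (unit K) (k ℕ.+ inside A) unitLattice p))
        (raise (unit K) A k (inside A) (proj₂ (absorb (unit K) (unit K) identity𝒪 unitLattice A) p))

      outside-⊇ : ∀ A k {x} → Member (Lattice.submodule A) x → Contains (t^ (k ℕ.+ outside A) K.* x)
      outside-⊇ A k p = raise (unit K) unitLattice k (outside A)
          (proj₂ (absorb (unit K) (unit K) identity𝒪 A unitLattice) p)

    refinements : HasRefinements (unit K) (unit K) coefficientwise
    refinements = mkRefinements (unit K) (unit K) coefficientwise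
      (λ A B → let C , C⊆A , C⊆B = meet (unit K) A B in
        shrink (unit K) (inside C) unitLattice , (λ p → C⊆A (inside-⊆ C 0 p)) ,
        λ p → C⊆B (inside-⊆ C 0 (shrink-stable (inside C) p)))
      (λ A B → let C , A⊆C , B⊆C = join (unit K) A B in
        enlarge (unit K) (outside C) unitLattice , (λ p → outside-⊇ C 0 (B⊆C p)) ,
        λ p → enlarge-stable (outside C) (outside-⊇ C 0 (A⊆C p)))

    module _ {E I : OpFamily ι𝜿} (isRing : IsOperatorRing ι𝜿 E) (isIdeal : IsOperatorIdeal ι𝜿 E I)
             (e∈ : I (unit 𝜿) (unit 𝜿) e) where

      module _ (a : ℕ) where
        private
          X₂ₐ : Mod 𝜿
          X₂ₐ = Dig.Residues (a ℕ.+ a)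

          open Solver K.commutativeSemiring using (solve; _:=_; _:*_)
          open RingProperties K.ring using (x[y-z]≈xy-xz)
          open SetoidReasoning K.setoid

          -- `u` and `v` are the mutually inverse multiplications by tᵃ and t⁻ᵃ between t⁻ᵃ𝒪 / tᵃ𝒪
          -- and 𝒪 / t²ᵃ. Both are 𝜿-linear, so the model operator can be sandwiched between them.
          u₀ : LeftModule.Carrierᴹ (Rest (unit K) (big a) (small a)) → 𝒪.Carrier
          u₀ (x , p) = t^ a K.* x , p

          u : Linear (raw (Rest (unit K) (big a) (small a))) (raw X₂ₐ)
          u = mkLinear {M = Rest (unit K) (big a) (small a)} {X₂ₐ} u₀
            (λ { {x , _} {y , _} p → (_ , p) , (begin
              (t^ a K.* x) K.- (t^ a K.* y)                                ≈⟨ x[y-z]≈xy-xz _ _ _ ⟨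
              t^ a K.* (x K.- y)                                           ≈⟨ K.*-congˡ (shrink-witness (unit K) a unitLattice p) ⟩
              t^ a K.* (t^ a K.* (t^- a K.* (x K.- y)))
                ≈⟨ solve 2 (λ u v → u :* (u :* v) := v :* (u :* u)) K.refl (t^ a) (t^- a K.* (x K.- y)) ⟩
              (t^- a K.* (x K.- y)) K.* (t^ a K.* t^ a)                    ≈⟨ K.*-congˡ (t^-+ a a) ⟨
              (t^- a K.* (x K.- y)) K.* t^ (a ℕ.+ a)                       ∎) })
            (λ x y → D.≡-reflexive (a ℕ.+ a) {u₀ (x B.+ᴹ y)} {u₀ x 𝒪.+ u₀ y} (K.distribˡ (t^ a) (proj₁ x) (proj₁ y)))
            (λ c x → D.≡-reflexive (a ℕ.+ a) {u₀ (c B.*ₗ x)} {⟦ σ ⟧ c 𝒪.* u₀ x}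
              (solve 3 (λ u c x → u :* (c :* x) := c :* (u :* x)) K.refl (t^ a) (proj₁ (⟦ σ ⟧ c)) (proj₁ x)))
            where module B = LeftModule (Rest (unit K) (big a) (small a))

          v : Linear (raw X₂ₐ) (raw (Rest (unit K) (big a) (small a)))
          v = mkLinear {M = X₂ₐ} {Rest (unit K) (big a) (small a)}
            (λ { (y , y∈) → t^- a K.* y , Subring.resp subring (K.sym (cancel y)) y∈ })
            (λ { {x , _} {y , _} ((r , r∈) , p) → Subring.resp subring (K.sym (begin
              t^- a K.* ((t^- a K.* x) K.- (t^- a K.* y))      ≈⟨ K.*-congˡ (x[y-z]≈xy-xz _ _ _) ⟨
              t^- a K.* (t^- a K.* (x K.- y))                  ≈⟨ K.*-congˡ (K.*-congˡ (K.trans p (K.*-congˡ (t^-+ a a)))) ⟩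
              t^- a K.* (t^- a K.* (r K.* (t^ a K.* t^ a)))
                ≈⟨ solve 3 (λ u v r → v :* (v :* (r :* (u :* u))) := r :* ((v :* u) :* (v :* u))) K.refl
                     (t^ a) (t^- a) r ⟩
              r K.* ((t^- a K.* t^ a) K.* (t^- a K.* t^ a))    ≈⟨ K.*-congˡ (K.trans (K.*-cong (t^-*t^ a) (t^-*t^ a)) (K.*-identityˡ _)) ⟩
              r K.* K.1#                                       ≈⟨ K.*-identityʳ r ⟩
              r                                                ∎)) r∈ })
            (λ { (x , _) (y , _) → ≈⇒≈/ (over𝒪 (unit K)) (Lattice.submodule (small a)) (K.distribˡ (t^- a) x y) })
            (λ { c (x , _) → ≈⇒≈/ (over𝒪 (unit K)) (Lattice.submodule (small a))
              (solve 3 (λ u c x → u :* (c :* x) := c :* (u :* x)) K.refl (t^- a) (proj₁ (⟦ σ ⟧ c)) x) })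
            where
            cancel : ∀ y → t^ a K.* (t^- a K.* y) K.≈ y
            cancel y = K.trans (K.sym (K.*-assoc _ _ y)) (K.trans (K.*-congʳ (t^*t^- a)) (K.*-identityˡ y))

        induced-standard : ∀ (r : Refinement (unit K) (unit K) coefficientwise (big a) (small a) (small a) (big a)) →
          I (Rest (unit K) (big a) (small a)) (Rest (unit K) (big a) (small a))
              (bar (unit K) (unit K) coefficientwise r)
        induced-standard r = sandwich ι𝜿 isRing isIdeal X₂ₐ (Rest (unit K) (big a) (small a)) X₂ₐ
            (Rest (unit K) (big a) (small a))
          (Dig.Residues-FG (a ℕ.+ a)) (Rest-FG (unit K) (big a) (small a)) (Dig.Residues-FG (a ℕ.+ a))
              (Rest-FG (unit K) (big a) (small a))
          u v {Dig.applyOp ι𝜿 e (a ℕ.+ a)} {bar (unit K) (unit K) coefficientwise r} eq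
          (Dig.applyOp-∈ ι𝜿 e isRing isIdeal e∈ (a ℕ.+ a))
          where
          module Y = LeftModule (Rest (unit K) (big a) (small a))
          eq : ∀ x → fun v (fun (Dig.applyOp ι𝜿 e (a ℕ.+ a)) (fun u x)) Y.≈ᴹ fun
              (bar (unit K) (unit K) coefficientwise r) x
          eq (x , p) = Y.≈ᴹ-trans {fun v applied} {fun v (lifted y)}
              {fun (bar (unit K) (unit K) coefficientwise r) (x , p)}
            (Linear.⟦⟧-cong v {applied} {lifted y}
              -- Modulo t²ᵃ the limit agrees with its truncation to 2a digits, which is what the
              -- model operator computes.
              (Mod.trans {applied} {Dig.apply (fun e) (a ℕ.+ a) y} {lifted y}
                (Dig.applyOp-≡ ι𝜿 e (a ℕ.+ a) y)
                (Mod.sym {lifted y} {Dig.apply (fun e) (a ℕ.+ a) y}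
                  (Dig.lift-≡ (fun e) e.⟦⟧-cong e.+ᴹ-homo (a ℕ.+ a) y))))
            (≈⇒≈/ (over𝒪 (unit K)) (Lattice.submodule (small a)) (K.sym (extend-value a x p)))
            where
            module Mod = D.Mod^ (a ℕ.+ a)
            y applied : 𝒪.Carrier
            y = t^ a K.* x , p
            applied = fun (Dig.applyOp ι𝜿 e (a ℕ.+ a)) y

      -- For a large enough the symmetric refinement by tᵃ𝒪 and t⁻ᵃ𝒪 encloses the given one, and
      -- `descend` applies. The exponent is a sum, so that it dominates both the outer and the inner
      -- bound.
      coefficientwise-induced : InducedIn (unit K) (unit K) coefficientwise I
      coefficientwise-induced L₁ L₂ L₁′ L₂′ r = descend isRing isIdeal (unit K) (unit K) coefficientwise r r′
        (λ p → proj₁ (proj₂ Q) (low p)) (λ p → high (proj₁ (proj₂ J) p))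
        (λ p → proj₂ (proj₂ Q) (low p)) (λ p → high (proj₂ (proj₂ J) p)) (induced-standard a r′)
        where
        J = join (unit K) L₁ L₂′
        Q = meet (unit K) L₁′ L₂
        a : ℕ
        a = outside (proj₁ J) ℕ.+ inside (proj₁ Q)
        low : small a ⊆K proj₁ Q
        low = inside-⊆ (proj₁ Q) (outside (proj₁ J))
        high : proj₁ J ⊆K big a
        high {x} p = subst (λ j → Contains (t^ j K.* x)) (ℕ.+-comm (inside (proj₁ Q)) (outside (proj₁ J)))
          (outside-⊇ (proj₁ J) (inside (proj₁ Q)) p)
        small⊆big : small a ⊆K big a
        small⊆big p = enlarge-⊇ (unit K) a unitLattice (shrink-⊆ (unit K) a unitLattice p)
        r′ : Refinement (unit K) (unit K) coefficientwise (big a) (small a) (small a) (big a)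
        r′ = record { L₁′⊆L₁ = small⊆big ; L₂⊆L₂′ = small⊆big
                    ; φL₁′⊆L₂ = shrink-stable a ; φL₁⊆L₂′ = enlarge-stable a }

    coefficientwise-∈ : ∀ {E I : OpFamily ι𝜿} (isRing : IsOperatorRing ι𝜿 E) → IsOperatorIdeal ι𝜿 E I →
      E (unit 𝜿) (unit 𝜿) e → I (unit 𝜿) (unit 𝜿) e → StepI isRing I (unit K) (unit K) coefficientwise
    coefficientwise-∈ isRing isIdeal e∈E e∈I =
      (refinements , coefficientwise-induced isRing (IsOperatorRing.isIdeal isRing) e∈E) ,
      coefficientwise-induced isRing isIdeal e∈I

  module _ (e₁ e₂ : Op ι𝜿 (unit 𝜿) (unit 𝜿)) (p : ∀ x → fun e₁ x 𝒪.+ fun e₂ x 𝜿.≈ x) where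
    lifted-partition : ∀ y → Lifted.lifted e₁ y 𝒪.+ Lifted.lifted e₂ y 𝒪.≈ y
    lifted-partition y = Dig.lift-partition (fun e₁) (Linear.⟦⟧-cong e₁) (Linear.+ᴹ-homo e₁)
      (fun e₂) (Linear.⟦⟧-cong e₂) (Linear.+ᴹ-homo e₂) p y

    coefficientwise-partition : ∀ x → fun (Lifted.coefficientwise e₁) x K.+ fun (Lifted.coefficientwise e₂) x K.≈ x
    coefficientwise-partition x = let m , q = clearDenominator x in
      K.trans (K.+-cong (Lifted.extend-value e₁ m x q) (Lifted.extend-value e₂ m x q))
        (K.trans (K.sym (K.distribˡ (t^- m) (proj₁ (Lifted.lifted e₁ (t^ m K.* x , q)))
            (proj₁ (Lifted.lifted e₂ (t^ m K.* x , q)))))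
          (K.trans (K.*-congˡ (lifted-partition (t^ m K.* x , q)))
            (K.trans (K.sym (K.*-assoc (t^- m) (t^ m) x))
              (K.trans (K.*-congʳ (t^-*t^ m)) (K.*-identityˡ x)))))

  PartitionOf : OpFamily ι𝜿 → OpFamily ι𝜿 → Set (lsuc ℓ)
  PartitionOf I₁ I₂ = ∃₂ λ e₁ e₂ → I₁ (unit 𝜿) (unit 𝜿) e₁ × I₂ (unit 𝜿) (unit 𝜿) e₂ ×
    (∀ x → fun e₁ x 𝒪.+ fun e₂ x 𝜿.≈ x)

  coefficientwise-partitions : ∀ {E I₁ I₂ : OpFamily ι𝜿} (isRing : IsOperatorRing ι𝜿 E) →
    IsOperatorIdeal ι𝜿 E I₁ → IsOperatorIdeal ι𝜿 E I₂ →
    (∀ M N {e} → I₁ M N e → E M N e) → (∀ M N {e} → I₂ M N e → E M N e) → PartitionOf I₁ I₂ →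
    ∃₂ λ φ₁ φ₂ → StepI isRing I₁ (unit K) (unit K) φ₁ × StepI isRing I₂ (unit K) (unit K) φ₂ ×
      (∀ x → fun φ₁ x K.+ fun φ₂ x K.≈ x)
  coefficientwise-partitions isRing isIdeal₁ isIdeal₂ I₁⊆E I₂⊆E (e₁ , e₂ , e₁∈ , e₂∈ , sum≈) =
    Lifted.coefficientwise e₁ , Lifted.coefficientwise e₂ ,
    Lifted.coefficientwise-∈ e₁ isRing isIdeal₁ (I₁⊆E (unit 𝜿) (unit 𝜿) {e₁} e₁∈) e₁∈ ,
    Lifted.coefficientwise-∈ e₂ isRing isIdeal₂ (I₂⊆E (unit 𝜿) (unit 𝜿) {e₂} e₂∈) e₂∈ ,
    coefficientwise-partition e₁ e₂ sum≈

  -- Choose C inside B and killed by φ. Then (C , B) refines (B , C), and the induced φ̄ is an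
  -- endomorphism of the single space B / C. As φ kills C, it also factors through a map ψ from B /
  -- C to `M`.
  finitePotent-step : IsField 𝕜 → {P : ∀ X → Pred (Op ι𝜿 X X) (lsuc ℓ)} →
    (∀ X → FG X → ∀ ψ → P X ψ → FinitePotent 𝕜 (restrict ι𝜿 X) ψ) →
    ∀ M (φ : Op ι M M) →
    (∃ λ (B : Lattice V M) → ∀ x → Member (Lattice.submodule B) (fun φ x)) →
    (∃ λ (A : Lattice V M) → ∀ x → Member (Lattice.submodule A) x → LeftModule._≈ᴹ_ M (fun φ x) (LeftModule.0ᴹ M)) →
    (∀ B C (r : Refinement M M φ B C C B) → P (Rest M B C) (bar M M φ r)) →
    FinitePotent 𝕜 (restrict ι M) φ
  finitePotent-step 𝕜-isField ih M φ (B , bounded) (A , vanishes) φ̄∈ =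
    finitePotent-transfer {F = 𝕜} 𝕜-isField em (restrict ι M) (restrict ι𝜿 (Rest M B C)) φ (bar M M φ r) ψ
      (λ x → fun φ x , bounded x) (λ _ → ≈ᴹ-refl) (λ _ → ≈ᴹ-refl)
      (ih (Rest M B C) (Rest-FG M B C) (bar M M φ r) (φ̄∈ B C r))
    where
    open LeftModule M
    open AdditiveGroup M
    module φ = Linear φ
    C : Lattice V M
    C = proj₁ (meet M A B)
    C⊆B : _⊆ᴸ_ {M} C B
    C⊆B = proj₂ (proj₂ (meet M A B))
    φC≈0 : ∀ {x} → _∈ᴸ_ {M} x C → fun φ x ≈ᴹ 0ᴹ
    φC≈0 p = vanishes _ (proj₁ (proj₂ (meet M A B)) p)
    r : Refinement M M φ B C C B
    r = record
      { L₁′⊆L₁ = C⊆B ; L₂⊆L₂′ = C⊆B ; φL₁⊆L₂′ = λ {x} _ → bounded x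
      ; φL₁′⊆L₂ = λ p → Submodule.resp (Lattice.submodule C) (≈ᴹ-sym (φC≈0 p))
          (Submodule.0-closed (Lattice.submodule C)) }
    ψ : Linear (raw (restrict ι𝜿 (Rest M B C))) (raw (restrict ι M))
    ψ = mkLinear {M = restrict ι𝜿 (Rest M B C)} {restrict ι M} (λ x → fun φ (proj₁ x))
      (λ {x} {y} p → x∙y⁻¹≈ε⇒x≈y _ _
        (≈ᴹ-trans (≈ᴹ-sym (map-sub (restrict ι M) (restrict ι M) φ (proj₁ x) (proj₁ y))) (φC≈0 p)))
      (λ x y → φ.+ᴹ-homo (proj₁ x) (proj₁ y))
      (λ c x → ≈ᴹ-trans (φ.⟦⟧-cong (*ₗ-congʳ (σι c))) (φ.*ₗ-homo c (proj₁ x)))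

-- Induction on the dimension of the local field.

module _ {ℓ} (em : ExcludedMiddle ℓ) (𝕜 : CRing ℓ) where

  isBT-ring : ∀ {n} (K : CRing ℓ) (L : LocalField n K) s T σ →
              IsOperatorRing (StructureMap.ι s) (IsBT 𝕜 K L s T σ)
  isBT-ring K (dim0 _) s T σ = record
    { linear∈ = _
    ; isIdeal = record { resp = _ ; zero∈ = _ ; add∈ = _ ; ∘∈ˡ = _ ; ∘∈ʳ = _ } }
  isBT-ring K (step _ V L) s T (σ₁ , dσ) = StepTheory.Step-isRing em V L s T σ₁
    (isBT-ring (CompleteDVRIn.𝜿 V) L (Step.residueStructure V L s) (Lift₁.topology𝜿 V L s T) dσ)

  isBTᵢⱼ-ideal : ∀ {n} (K : CRing ℓ) (L : LocalField n K) s T σ i j →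
    IsOperatorIdeal (StructureMap.ι s) (IsBT 𝕜 K L s T σ) (λ M N → IsBTᵢⱼ 𝕜 K L s T σ M N i j)
  isBTᵢⱼ-ideal K (step _ V L) s T (σ₁ , dσ) zero zero = StepTheory.Bounding-isIdeal em V L s T σ₁
    (isBT-ring (CompleteDVRIn.𝜿 V) L (Step.residueStructure V L s) (Lift₁.topology𝜿 V L s T) dσ)
  isBTᵢⱼ-ideal K (step _ V L) s T (σ₁ , dσ) zero (suc zero) = StepTheory.Vanishing-isIdeal em V L s T σ₁
    (isBT-ring (CompleteDVRIn.𝜿 V) L (Step.residueStructure V L s) (Lift₁.topology𝜿 V L s T) dσ)
  isBTᵢⱼ-ideal K (step _ V L) s T (σ₁ , dσ) (suc i) j = StepTheory.StepI-isIdeal em V L s T σ₁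
    (isBT-ring (CompleteDVRIn.𝜿 V) L (Step.residueStructure V L s) (Lift₁.topology𝜿 V L s T) dσ)
    (isBTᵢⱼ-ideal (CompleteDVRIn.𝜿 V) L (Step.residueStructure V L s) (Lift₁.topology𝜿 V L s T) dσ i j)

  isBTᵢⱼ⇒isBT : ∀ {n} (K : CRing ℓ) (L : LocalField n K) s T σ M N i j {φ} →
                IsBTᵢⱼ 𝕜 K L s T σ M N i j φ → IsBT 𝕜 K L s T σ M N φ
  isBTᵢⱼ⇒isBT K (step _ V L) s T σ M N zero    zero       = proj₁
  isBTᵢⱼ⇒isBT K (step _ V L) s T σ M N zero    (suc zero) = proj₁
  isBTᵢⱼ⇒isBT K (step _ V L) s T σ M N (suc i) j          = proj₁

  -- Only the identity of the module K is split, so the recursion needs a splitting on 𝜿 alone and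
  -- not on all finite modules.
  Partition : ∀ {n} (K : CRing ℓ) (L : LocalField n K) s T → SystemOfLiftings 𝕜 K L s T → Fin n → Set (lsuc ℓ)
  Partition K L s T σ i = ∃₂ λ e₁ e₂ →
    IsBTᵢⱼ 𝕜 K L s T σ (unit K) (unit K) i zero e₁ ×
    IsBTᵢⱼ 𝕜 K L s T σ (unit K) (unit K) i (suc zero) e₂ ×
    (∀ x → CommutativeRing._≈_ K (CommutativeRing._+_ K (fun e₁ x) (fun e₂ x)) x)

  partition : ∀ {n} (K : CRing ℓ) (L : LocalField n K) s T σ i → Partition K L s T σ i
  partition K (step _ V L) s T (σ₁ , dσ) zero =
    S.integralPart , S.polarPart , S.integralPart-Bounding isRing , S.polarPart-Vanishing isRing , S.integral+polar
    where
    module S = StepTheory em V L s T σ₁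
    isRing = isBT-ring (CompleteDVRIn.𝜿 V) L (Step.residueStructure V L s) (Lift₁.topology𝜿 V L s T) dσ
  partition K (step _ V L) s T (σ₁ , dσ) (suc i) = StepTheory.coefficientwise-partitions em V L s T σ₁
    (isBT-ring (CompleteDVRIn.𝜿 V) L (Step.residueStructure V L s) (Lift₁.topology𝜿 V L s T) dσ)
    (isBTᵢⱼ-ideal (CompleteDVRIn.𝜿 V) L (Step.residueStructure V L s) (Lift₁.topology𝜿 V L s T) dσ i zero)
    (isBTᵢⱼ-ideal (CompleteDVRIn.𝜿 V) L (Step.residueStructure V L s) (Lift₁.topology𝜿 V L s T) dσ i (suc zero))
    (λ M N {e} → isBTᵢⱼ⇒isBT (CompleteDVRIn.𝜿 V) L (Step.residueStructure V L s)
        (Lift₁.topology𝜿 V L s T) dσ M N i zero {e})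
    (λ M N {e} → isBTᵢⱼ⇒isBT (CompleteDVRIn.𝜿 V) L (Step.residueStructure V L s)
        (Lift₁.topology𝜿 V L s T) dσ M N i (suc zero) {e})
    (partition (CompleteDVRIn.𝜿 V) L (Step.residueStructure V L s) (Lift₁.topology𝜿 V L s T) dσ i)

  scalars-FG : {K : CRing ℓ} (ι : RingHom 𝕜 K) → FG (restrict ι (unit K)) →
               (M : Mod K) → FG M → FG (restrict ι M)
  scalars-FG {K} ι (r , k , gen) M = restrict-FG ι M λ g →
    r , (λ i → k i *ₗ g) , λ { (x , e) → Submodule.resp (Span (restrict ι M) (λ i → k i *ₗ g)) (≈ᴹ-sym e)
      (map-span (restrict ι (unit K)) (restrict ι M) (·g g) (gen x)) }
    where
    open LeftModule M
    ·g : ∀ g → Linear (unit K ↾ ι) (M ↾ ι)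
    ·g g = mkLinear {M = restrict ι (unit K)} {restrict ι M} (_*ₗ g) *ₗ-congʳ (*ₗ-distribʳ g) (λ c x → *ₗ-assoc _ x g)

  -- In dimension 0 the field is 𝒌ₙ(K), finite over 𝕜, so the first power of φ already has finite
  -- rank. One level up, the two conditions for i = 1 are used at K itself and the others pass to
  -- φ̄. The last residue field is the same for K and for 𝜿, so `fin` is handed down unchanged.
  finitePotent : IsField 𝕜 → ∀ {n} (K : CRing ℓ) (L : LocalField n K) s T σ →
    FG (restrict (lastStructure 𝕜 K L s) (unit (lastResidueField K L))) → (M : Mod K) → FG M →
    ∀ {φ} → (∀ i j → IsBTᵢⱼ 𝕜 K L s T σ M M i j φ) → FinitePotent 𝕜 (restrict (StructureMap.ι s) M) φ
  finitePotent 𝕜-isField K (dim0 _) s T σ fin M fg {φ} _ = potent (0 ,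
    surjective-FG Mₖ (asModule Mₖ U)
      (mkLinear {M = Mₖ} {asModule Mₖ U} (λ x → fun φ x , x , _ , LeftModule.≈ᴹ-refl M)
        (Linear.⟦⟧-cong φ) (Linear.+ᴹ-homo φ) (Linear.*ₗ-homo φ))
      (λ { (y , x , _ , e) → x , e }) (scalars-FG (StructureMap.ι s) fin M fg))
    where
    open SemiringOps (RawRing.rawSemiring (Ring.rawRing (End (restrict (StructureMap.ι s) M)))) using () renaming
        (_^_ to _^ᴹ_)
    Mₖ = restrict (StructureMap.ι s) M
    U = image Mₖ Mₖ (φ ^ᴹ 1) (whole (raw Mₖ))
  finitePotent 𝕜-isField K (step _ V L) s T (σ₁ , dσ) fin M fg {φ} φ∈ =
    StepTheory.finitePotent-step em V L s T σ₁ 𝕜-isField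
      (λ X fgX ψ → finitePotent 𝕜-isField (CompleteDVRIn.𝜿 V) L (Step.residueStructure V L s)
        (Lift₁.topology𝜿 V L s T) dσ fin X fgX {ψ})
      M φ (proj₂ (φ∈ zero zero)) (proj₂ (φ∈ zero (suc zero))) (λ B C r i j → proj₂ (φ∈ (suc i) j) B C C B r)

theorem0p4 : (∀ {a} → ExcludedMiddle a) →
    ∀ {ℓ : Level} (𝕜 : CommutativeRing ℓ ℓ) → IsPerfectField 𝕜 →
    ∀ (n : ℕ) (K : TopologicalLocalField 𝕜 n) (σ : LiftingsOf K) →
    IsCubicallyDecomposed (TopologicalLocalField.algebra K) n (E K σ) (Eᵢⱼ K σ)
theorem0p4 em {ℓ} 𝕜 (𝕜-isField , _) n F σ = record
  { isSubring    = record
    { resp     = λ {f} {g} → E.resp U U {f} {g}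
    ; 0-closed = E.zero∈ U U {𝔼.0#} fg fg (λ _ → K.refl)
    ; 1-closed = R.linear∈ U U (identityMap U) {𝔼.1#} (λ _ → K.refl)
    ; +-closed = λ {f} {g} → E.add∈ U U {f} {g} {f 𝔼.+ g} (λ _ → K.refl)
    -- Operator ideals carry no clause for negatives: -f is the composite of f with the K-linear map
    -- -1.
    ; -‿closed = λ {f} → E.∘∈ˡ U U U {f} {negative} {𝔼.- f} fg fg fg (λ _ → K.refl) negative∈
    ; *-closed = λ {f} {g} → E.∘∈ˡ U U U {g} {f} {f 𝔼.* g} fg fg fg (λ _ → K.refl) }
  ; contains-A   = λ a → R.linear∈ U U (multiply K U a) {multiplication algebra a} (λ _ → K.refl)
  ; isIdeal      = λ i j → let module I = IsOperatorIdeal (isBTᵢⱼ-ideal em 𝕜 K localField structure topology σ i j) in record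
    { contained = λ {f} → isBTᵢⱼ⇒isBT em 𝕜 K localField structure topology σ U U i j {f}
    ; resp      = λ {f} {g} → I.resp U U {f} {g}
    ; 0-closed  = I.zero∈ U U {𝔼.0#} fg fg (λ _ → K.refl)
    ; +-closed  = λ {f} {g} → I.add∈ U U {f} {g} {f 𝔼.+ g} (λ _ → K.refl)
    ; -‿closed  = λ {f} → I.∘∈ˡ U U U {f} {negative} {𝔼.- f} fg fg fg (λ _ → K.refl) negative∈
    ; *-closedˡ = λ {e} {f} → I.∘∈ˡ U U U {f} {e} {e 𝔼.* f} fg fg fg (λ _ → K.refl)
    ; *-closedʳ = λ {e} {f} e∈ f∈ → I.∘∈ʳ U U U {e} {f} {f 𝔼.* e} fg fg fg (λ _ → K.refl) f∈ e∈ }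
  ; decomposes   = λ i {φ} φ∈ →
      let e₁ , e₂ , e₁∈ , e₂∈ , sum≈ = partition em 𝕜 K localField structure topology σ i
          module I j = IsOperatorIdeal (isBTᵢⱼ-ideal em 𝕜 K localField structure topology σ i j)
      in e₁ 𝔼.* φ , e₂ 𝔼.* φ
       , I.∘∈ʳ zero U U U {φ} {e₁} {e₁ 𝔼.* φ} fg fg fg (λ _ → K.refl) e₁∈ φ∈
       , I.∘∈ʳ (suc zero) U U U {φ} {e₂} {e₂ 𝔼.* φ} fg fg fg (λ _ → K.refl) e₂∈ φ∈
       , λ x → K.sym (sum≈ (fun φ x))
  ; finitePotent = λ {φ} _ φ∈ → FinitePotent.isFinitePotent
      (finitePotent em 𝕜 𝕜-isField K localField structure topology σ finite U fg {φ} φ∈) }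
  where
  open TopologicalLocalField F
  module K = CommutativeRing K
  module 𝔼 = Ring (End (Alg.↓ algebra))
  U : Mod K
  U = unit K
  module R = IsOperatorRing (isBT-ring em 𝕜 K localField structure topology σ)
  module E = IsOperatorIdeal R.isIdeal
  fg : FG U
  fg = unit-FG K
  negative : Op ι U U
  negative = negation (restrict ι U)
  negative∈ : IsBT 𝕜 K localField structure topology σ U U negative
  negative∈ = R.linear∈ U U (negation U) {negative} (λ _ → K.refl)
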